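{- For every $\varepsilon>0$ and every integer $\Delta\ge 2$ there exists a constant $c=c(\varepsilon,\Delta)$ such that the following holds. Let $F$ be an $n$-vertex graph with maximum degree $\Delta(F)\le \Delta$. If $p\ge c\,n^{ -2/(\Delta+1)}$ and $G$ is an $n$-vertex graph with at least $\varepsilon n^2$ edges, then with high probability $G\cup G(n,p)$ contains a copy of $F$.
   Context: $G(n,p)$ is the binomial random graph on the same vertex set as $G$, in which each pair of vertices is an edge independently with probability $p$; $G\cup G(n,p)$ is the graph on this vertex set whose edge set is the union of the two edge sets. "With high probability" means with probability tending to $1$ as $n\to\infty$.
   Formalization: The density ε and the edge probability p are taken to be rational numbers rather than arbitrary reals (the constant c is also rational, and the bound on p is stated in the equivalent form c^(Δ+1) ≤ p^(Δ+1) n²). -}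

module Defs where

open import Data.Bool using (Bool; true; false; _∧_; _∨_; if_then_else_)
open import Data.Nat as ℕ using (ℕ; zero; suc)
open import Data.Fin using (Fin; _<_; _≟_)
open import Data.Fin.Properties using ()
open import Data.List using (List; []; _∷_; map; concatMap; length; filter; sum; foldr; zip; allFin)
open import Data.Bool.ListAction using (any)
open import Data.Product using (_×_; _,_; Σ; ∃)
open import Data.Integer using (+_)
open import Data.Rational using (ℚ; _/_; 0ℚ; 1ℚ; _+_; _*_; _-_; _≤_)
open import Relation.Binary.PropositionalEquality using (_≡_)
open import Relation.Nullary.Decidable using (⌊_⌋)
open import Function.Definitions using (Injective)

Adj : ℕ → Set
Adj n = Fin n → Fin n → Bool

record IsSimpleGraph {n : ℕ} (A : Adj n) : Set where
  field
    symmetric   : ∀ u v → A u v ≡ A v u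
    irreflexive : ∀ u → A u u ≡ false

ℕ→ℚ : ℕ → ℚ
ℕ→ℚ k = (+ k) / 1

_^ℚ_ : ℚ → ℕ → ℚ
x ^ℚ zero  = 1ℚ
x ^ℚ suc k = x * (x ^ℚ k)

pairs : (n : ℕ) → List (Fin n × Fin n)
pairs n = concatMap (λ i → map (λ j → (i , j)) (filter (λ j → i <? j) (allFin n))) (allFin n)
  where open import Data.Fin using (_<?_)

edgeCount : {n : ℕ} → Adj n → ℕ
edgeCount {n} A = length (filter (λ e → A (Data.Product.proj₁ e) (Data.Product.proj₂ e) ≟ᵇ true) (pairs n))
  where
    open import Data.Bool.Properties using () renaming (_≟_ to _≟ᵇ_)
    import Data.Product

degree : {n : ℕ} → Adj n → Fin n → ℕ
degree {n} A v = length (filter (λ u → A v u ≟ᵇ true) (allFin n))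
  where open import Data.Bool.Properties using () renaming (_≟_ to _≟ᵇ_)

MaxDegreeAtMost : {n : ℕ} → Adj n → ℕ → Set
MaxDegreeAtMost A Δ = ∀ v → degree A v ℕ.≤ Δ

ContainsCopy : {n m : ℕ} → Adj m → Adj n → Set
ContainsCopy {n} {m} H F = Σ (Fin n → Fin m) λ φ →
  Injective _≡_ _≡_ φ × (∀ u v → F u v ≡ true → H (φ u) (φ v) ≡ true)

open import Data.Vec using (Vec; []; _∷_; toList)

allBoolVecs : (k : ℕ) → List (Vec Bool k)
allBoolVecs zero    = [] ∷ []
allBoolVecs (suc k) = concatMap (λ v → (false ∷ v) ∷ (true ∷ v) ∷ []) (allBoolVecs k)

-- An outcome of G(n,p): one Bool per unordered pair (in the order of 'pairs n')
Outcome : ℕ → Set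
Outcome n = Vec Bool (length (pairs n))

allOutcomes : (n : ℕ) → List (Outcome n)
allOutcomes n = allBoolVecs (length (pairs n))

weight : {n : ℕ} → ℚ → Outcome n → ℚ
weight p ω = foldr (λ b acc → (if b then p else (1ℚ - p)) * acc) 1ℚ (toList ω)

outcomeGraph : {n : ℕ} → Outcome n → Adj n
outcomeGraph {n} ω i j =
  any (λ { ((a , b) , x) → x ∧ ((⌊ a ≟ i ⌋ ∧ ⌊ b ≟ j ⌋) ∨ (⌊ a ≟ j ⌋ ∧ ⌊ b ≟ i ⌋)) })
      (zip (pairs n) (toList ω))

_∪G_ : {n : ℕ} → Adj n → Adj n → Adj n
(A ∪G B) u v = A u v ∨ B u v

massOf : {n : ℕ} → ℚ → (Outcome n → Bool) → ℚ
massOf {n} p keep = sum′ (map (λ ω → if keep ω then weight {n} p ω else 0ℚ) (allOutcomes n))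
  where
    sum′ : List ℚ → ℚ
    sum′ = foldr _+_ 0ℚ

-- P[ G ∪ G(n,p) contains a copy of F ] ≥ q, stated as: there is an event
-- (set of outcomes) of probability ≥ q all of whose outcomes give a copy of F.
ProbContainsAtLeast : {n : ℕ} → Adj n → Adj n → ℚ → ℚ → Set
ProbContainsAtLeast {n} G F p q =
  Σ (Outcome n → Bool) λ keep →
    (∀ ω → keep ω ≡ true → ContainsCopy (G ∪G outcomeGraph {n} ω) F) × (q ≤ massOf {n} p keep)

-- Spread families.  Let S be a random member of a family of sets whose probability of containing a
-- given t-set is at most q^t, and let W be a random set of density p.  Among the members S′ ⊆ W ∪ S
-- let S′ minimise the fragment T = S′ ∖ W.  Then T ⊆ S, and T is contained in every member inside
-- Z = W ∪ T, so that T is one of few subsets of a set depending on Z alone.  Replacing W by Z changes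
-- the weight by p^-|T|, hence T is small with high probability once p / q is large; iterating on the
-- fragments, a member of the family appears after boundedly many rounds if p / q is a power of n.
--
-- The copies of F.  A connected graph with v vertices and maximum degree Δ has at most
-- (Δ + 1)(v - 1) / 2 edges, and at most Δ (Δ + 2)(v - 1) / (2 (Δ + 1)) if it is not K_{Δ+1}.  Hence a
-- uniformly random placement is spread at the threshold n^(-2/(Δ+1)), and is spread with polynomial
-- room if no K_{Δ+1} is placed.  Call X, Y a dense pair of G if |X| = |Y| = 4 h is linear in n and any
-- h vertices of X and h of Y span a constant proportion of the possible edges; a density increment finds one.
-- One round outside X ∪ Y produces all but few of the disjoint cliques K_{Δ+1} of F that fit there.
-- About 8 h vertices remain, hence at most 3 h cliques as Δ + 1 ≥ 3.  Each of these loses one edge, which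
-- is put on an edge of G between X and Y by a random greedy matching; the other vertices are placed by a
-- uniform bijection, and boundedly many further rounds produce the remaining edges.
--
-- Probabilities are counted in ℕ: with b = ⌊n^(2/(Δ+1))⌋ every round has density k / b for a constant k.

module Submission where

open import Defs
open import Data.Bool using (Bool; true; false; if_then_else_; _∧_; _∨_)
open import Data.Bool.ListAction using (any)
open import Data.Empty using (⊥)
open import Data.Fin as Fin using (Fin; zero; suc)
import Data.Fin.Properties as Finₚ
open import Data.Fin.Subset as Sub using (Subset; ∣_∣; _─_) renaming (_∪_ to _∪ₛ_; _∈_ to _∈ₛ_; _⊆_ to _⊆ₛ_; ⊥ to ∅; ∁ to ∁ₛ)
import Data.Fin.Subset.Properties as Subₚ
open import Data.List using (List; []; _∷_; _++_; map; concat; concatMap; length; filter; take; drop; allFin; zip)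
import Data.List as List
import Data.List.Properties as Listₚ
open import Data.List.Membership.Propositional using (_∈_; _∉_; find; lose)
import Data.List.Membership.Propositional.Properties as ∈ₚ
open import Data.List.Relation.Unary.All as All using (All; []; _∷_)
import Data.List.Relation.Unary.All.Properties as Allₚ
open import Data.List.Relation.Unary.Any as Any using (Any; here; there)
import Data.List.Relation.Unary.Any.Properties as Anyₚ
open import Data.List.Relation.Unary.AllPairs using ([]; _∷_)
open import Data.List.Relation.Unary.Unique.Propositional using (Unique)
import Data.List.Relation.Unary.Unique.Propositional.Properties as Uniqueₚ
open import Data.Nat
open import Data.Nat.Properties
open import Data.Nat.DivMod using (m<n*o⇒m/o<n; m≥n⇒m/n>0; _/_; _%_; m≡m%n+[m/n]*n; m%n<n; m/n*n≤m)
open import Data.Nat.Tactic.RingSolver using (solve-∀)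
open import Data.Product using (Σ; ∃-syntax; _×_; _,_; proj₁; proj₂)
open import Data.Sum using (_⊎_; inj₁; inj₂)
open import Data.Vec as Vec using (Vec; []; _∷_)
import Data.Vec.Properties as Vecₚ
open import Function using (_∘_; id; case_of_)
open import Relation.Binary.PropositionalEquality
open import Relation.Nullary using (¬_; Dec; yes; no; contradiction)
open import Relation.Nullary.Decidable using (_×-dec_; _⊎-dec_; _→-dec_; ¬?; does; map′; ⌊_⌋)
open import Relation.Binary.Definitions using (tri<; tri≈; tri>)
open import Data.Bool.Properties using (∨-zeroʳ) renaming (_≟_ to _≟ᵇ_)
open import Data.List.Extrema.Nat using (argmin; argmin-sel; f[argmin]≤f[xs])
import Data.Product.Properties as ×ₚ
open import Data.List.Relation.Unary.AllPairs using (allPairs?)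
open import Data.Integer as ℤ using (-[1+_]) renaming (+_ to posℤ)
import Data.Integer.Properties as ℤₚ
import Data.Nat.Coprimality as Coprimality
open import Data.Rational as ℚ using (ℚ; mkℚ; 0ℚ; 1ℚ; toℚᵘ)
import Data.Rational.Properties as ℚₚ
import Data.Rational.Unnormalised as ℚᵘ
import Data.Rational.Unnormalised.Properties as ℚᵘₚ
import Data.Rational.Solver as ℚSolver

-- Finite sums over lists

-- The obstacle is that copies of K_{Δ+1} are exactly critical. For them the spread and the random
-- density differ by a constant factor only, so each round shrinks the fragments by a constant
-- factor, and finishing by such rounds alone would take about log n of them and cost a logarithm in
-- p. One round, however, already leaves only a small prescribed proportion of the edges missing, so
-- few cliques are damaged, and all of these are moved next to the dense pair. There the exponent Δ
-- + 1 of the edge count improves to Δ(Δ+2)/(Δ+1) = (Δ+1) - 1/(Δ+1). The gain is a power of b, and a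
-- number `ρ` of order b^(1/(2Δ(Δ+2))) spends it twice: as the shrinking factor of a round and as
-- the reciprocal of its failure probability, up to a constant. The constant c must not depend on
-- the failure probability that is finally allowed. So the density `k` and the number of rounds `R`
-- are fixed first. The first round fails with probability exponentially small in n, the later ones
-- with probability of order 1/ρ, and both are made small by n alone.

ι : {P : Set} → Dec P → ℕ
ι d = if does d then 1 else 0

ι≤1 : {P : Set} (d : Dec P) → ι d ≤ 1
ι≤1 (yes _) = ≤-refl
ι≤1 (no _)  = z≤n

ι-yes : {P : Set} (d : Dec P) → P → ι d ≡ 1
ι-yes (yes _) _ = refl
ι-yes (no ¬p) p = contradiction p ¬p

ι-no : {P : Set} (d : Dec P) → ¬ P → ι d ≡ 0
ι-no (yes p) ¬p = contradiction p ¬p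
ι-no (no _)  _  = refl

ι-mono : {P Q : Set} (d : Dec P) (e : Dec Q) → (P → Q) → ι d ≤ ι e
ι-mono (yes p) e f = ≤-reflexive (sym (ι-yes e (f p)))
ι-mono (no _)  e f = z≤n

ι-guard : {P : Set} (d : Dec P) {m k : ℕ} → (P → m ≤ k) → ι d * m ≤ k
ι-guard (yes p) {m} h = subst (_≤ _) (sym (*-identityˡ m)) (h p)
ι-guard (no _)  h = z≤n

ι-¬? : {P : Set} (d : Dec P) → ι d + ι (¬? d) ≡ 1
ι-¬? (yes _) = refl
ι-¬? (no _)  = refl

∑ : {A : Set} → List A → (A → ℕ) → ℕ
∑ []       f = 0
∑ (x ∷ xs) f = f x + ∑ xs f

∑-cong : {A : Set} (xs : List A) {f g : A → ℕ} → (∀ x → x ∈ xs → f x ≡ g x) → ∑ xs f ≡ ∑ xs g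
∑-cong []       h = refl
∑-cong (x ∷ xs) h = cong₂ _+_ (h x (here refl)) (∑-cong xs λ y m → h y (there m))

∑-mono : {A : Set} (xs : List A) {f g : A → ℕ} → (∀ x → x ∈ xs → f x ≤ g x) → ∑ xs f ≤ ∑ xs g
∑-mono []       h = z≤n
∑-mono (x ∷ xs) h = +-mono-≤ (h x (here refl)) (∑-mono xs λ y m → h y (there m))

∑-++ : {A : Set} (xs ys : List A) {f : A → ℕ} → ∑ (xs ++ ys) f ≡ ∑ xs f + ∑ ys f
∑-++ []       ys = refl
∑-++ (x ∷ xs) ys {f} = trans (cong (f x +_) (∑-++ xs ys)) (sym (+-assoc (f x) _ _))

∑-+ : {A : Set} (xs : List A) {f g : A → ℕ} → ∑ xs (λ x → f x + g x) ≡ ∑ xs f + ∑ xs g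
∑-+ [] = refl
∑-+ (x ∷ xs) {f} {g} = trans (cong (f x + g x +_) (∑-+ xs)) (lem (f x) (g x) _ _)
  where
  lem : ∀ a b c d → a + b + (c + d) ≡ a + c + (b + d)
  lem = solve-∀

∑-*ˡ : {A : Set} (c : ℕ) (xs : List A) {f : A → ℕ} → c * ∑ xs f ≡ ∑ xs (λ x → c * f x)
∑-*ˡ c [] = *-zeroʳ c
∑-*ˡ c (x ∷ xs) {f} = trans (*-distribˡ-+ c (f x) _) (cong (c * f x +_) (∑-*ˡ c xs))

∑-*ʳ : {A : Set} (c : ℕ) (xs : List A) {f : A → ℕ} → ∑ xs f * c ≡ ∑ xs (λ x → f x * c)
∑-*ʳ c xs {f} = trans (*-comm (∑ xs f) c)
  (trans (∑-*ˡ c xs) (∑-cong xs λ x _ → *-comm c (f x)))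

∑-const : {A : Set} (xs : List A) (c : ℕ) → ∑ xs (λ _ → c) ≡ length xs * c
∑-const []       c = refl
∑-const (x ∷ xs) c = cong (c +_) (∑-const xs c)

∑-≤const : {A : Set} (xs : List A) {f : A → ℕ} {c : ℕ} → (∀ x → x ∈ xs → f x ≤ c) → ∑ xs f ≤ length xs * c
∑-≤const xs {c = c} h = ≤-trans (∑-mono xs h) (≤-reflexive (∑-const xs c))

∑-0 : {A : Set} (xs : List A) → ∑ xs (λ _ → 0) ≡ 0
∑-0 xs = trans (∑-const xs 0) (*-zeroʳ (length xs))

∑-zero : {A : Set} (xs : List A) {f : A → ℕ} → (∀ x → x ∈ xs → f x ≡ 0) → ∑ xs f ≡ 0
∑-zero xs h = trans (∑-cong xs h) (∑-0 xs)

∑-length : {A : Set} (xs : List A) → ∑ xs (λ _ → 1) ≡ length xs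
∑-length xs = trans (∑-const xs 1) (*-identityʳ _)

∑-swap : {A B : Set} (xs : List A) (ys : List B) {f : A → B → ℕ} →
         ∑ xs (λ x → ∑ ys (f x)) ≡ ∑ ys (λ y → ∑ xs (λ x → f x y))
∑-swap []       ys = sym (∑-0 ys)
∑-swap (x ∷ xs) ys {f} = trans (cong (∑ ys (f x) +_) (∑-swap xs ys)) (sym (∑-+ ys))

∑-map : {A B : Set} (g : A → B) (xs : List A) {f : B → ℕ} → ∑ (map g xs) f ≡ ∑ xs (f ∘ g)
∑-map g []       = refl
∑-map g (x ∷ xs) {f} = cong (f (g x) +_) (∑-map g xs)

∑-concatMap : {A B : Set} (g : A → List B) (xs : List A) {f : B → ℕ} →
              ∑ (concatMap g xs) f ≡ ∑ xs (λ x → ∑ (g x) f)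
∑-concatMap g []       = refl
∑-concatMap g (x ∷ xs) {f} = trans (∑-++ (g x) (concatMap g xs)) (cong (∑ (g x) f +_) (∑-concatMap g xs))

∑-∈ : {A : Set} {xs : List A} {x : A} (f : A → ℕ) → x ∈ xs → f x ≤ ∑ xs f
∑-∈ f (here refl) = m≤m+n (f _) _
∑-∈ {xs = y ∷ _} f (there m) = ≤-trans (∑-∈ f m) (m≤n+m _ (f y))

∑-filter : {A : Set} {R : A → Set} (R? : ∀ x → Dec (R x)) (xs : List A) {f : A → ℕ} →
           ∑ (filter R? xs) f ≡ ∑ xs (λ x → ι (R? x) * f x)
∑-filter R? [] = refl
∑-filter R? (x ∷ xs) {f} with R? x
... | yes _ = cong₂ _+_ (sym (*-identityˡ (f x))) (∑-filter R? xs)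
... | no _  = ∑-filter R? xs

length-filter≡∑ : {A : Set} {R : A → Set} (R? : ∀ x → Dec (R x)) (xs : List A) →
                  length (filter R? xs) ≡ ∑ xs (λ x → ι (R? x))
length-filter≡∑ R? xs = trans (sym (∑-length (filter R? xs)))
  (trans (∑-filter R? xs) (∑-cong xs λ x _ → *-identityʳ _))

∑-partition : {A : Set} {R : A → Set} (R? : ∀ x → Dec (R x)) (xs : List A) {f : A → ℕ} →
              ∑ xs f ≡ ∑ (filter R? xs) f + ∑ (filter (λ x → ¬? (R? x)) xs) f
∑-partition R? xs {f} = sym (trans (cong₂ _+_ (∑-filter R? xs) (∑-filter (λ x → ¬? (R? x)) xs))
  (trans (sym (∑-+ xs)) (∑-cong xs λ x _ →
    trans (sym (*-distribʳ-+ (f x) (ι (R? x)) _)) (trans (cong (_* f x) (ι-¬? (R? x))) (*-identityˡ (f x))))))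

abstract
  searchList : {A : Set} {R : A → Set} (R? : ∀ x → Dec (R x)) (xs : List A) →
               (∃[ x ] x ∈ xs × R x) ⊎ (∀ x → x ∈ xs → ¬ R x)
  searchList R? xs with Any.any? R? xs
  ... | yes a = let x , m , r = find a in inj₁ (x , m , r)
  ... | no ¬a = inj₂ λ x m r → ¬a (lose m r)

module _ {n : ℕ} where
  abstract
    _∈?_ : (x : Fin n) (xs : List (Fin n)) → Dec (x ∈ xs)
    x ∈? xs = Any.any? (x Finₚ.≟_) xs

  _∉?_ : (x : Fin n) (xs : List (Fin n)) → Dec (x ∉ xs)
  x ∉? xs = ¬? (x ∈? xs)

  ∑-δ : (xs : List (Fin n)) (y : Fin n) (f : Fin n → ℕ) → Unique xs → y ∈ xs →
        ∑ xs (λ x → ι (x Finₚ.≟ y) * f x) ≡ f y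
  ∑-δ (x ∷ xs) y f (x∉ ∷ u) m with x Finₚ.≟ y
  ... | yes refl = trans (cong₂ _+_ (*-identityˡ (f x)) (∑-zero xs λ z z∈ →
          cong (_* f z) (ι-no (z Finₚ.≟ y) λ { refl → All.lookup x∉ z∈ refl }))) (+-identityʳ (f x))
  ... | no x≢y with m
  ...   | here refl = contradiction refl x≢y
  ...   | there m′ = ∑-δ xs y f u m′

  ∑-δ≤ : (xs : List (Fin n)) (y : Fin n) → Unique xs → ∑ xs (λ x → ι (x Finₚ.≟ y)) ≤ 1
  ∑-δ≤ xs y u with y ∈? xs
  ... | yes m = ≤-reflexive (trans (∑-cong xs λ x _ → sym (*-identityʳ _)) (∑-δ xs y (λ _ → 1) u m))
  ... | no ∉  = ≤-trans (≤-reflexive (∑-zero xs λ z z∈ → ι-no (z Finₚ.≟ y) λ { refl → ∉ z∈ })) z≤n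

  ι-∈ : (xs : List (Fin n)) (y : Fin n) → Unique xs → ι (y ∈? xs) ≡ ∑ xs (λ x → ι (x Finₚ.≟ y))
  ι-∈ xs y u with y ∈? xs
  ... | yes m = sym (trans (∑-cong xs λ x _ → sym (*-identityʳ _)) (∑-δ xs y (λ _ → 1) u m))
  ... | no ∉  = sym (∑-zero xs λ z z∈ → ι-no (z Finₚ.≟ y) λ { refl → ∉ z∈ })

  _∖_ : List (Fin n) → List (Fin n) → List (Fin n)
  xs ∖ ys = filter (λ x → ¬? (x ∈? ys)) xs

  ∈-∖⁺ : ∀ {xs ys x} → x ∈ xs → x ∉ ys → x ∈ xs ∖ ys
  ∈-∖⁺ {ys = ys} = ∈ₚ.∈-filter⁺ (λ x → ¬? (x ∈? ys))

  ∈-∖⁻ : ∀ xs {ys x} → x ∈ xs ∖ ys → x ∈ xs × x ∉ ys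
  ∈-∖⁻ xs {ys} = ∈ₚ.∈-filter⁻ (λ x → ¬? (x ∈? ys)) {xs = xs}

  Unique-∖ : ∀ {xs} ys → Unique xs → Unique (xs ∖ ys)
  Unique-∖ ys = Uniqueₚ.filter⁺ (λ x → ¬? (x ∈? ys))

  ∑-∖ : (xs ps : List (Fin n)) (f : Fin n → ℕ) → Unique xs → Unique ps → (∀ {x} → x ∈ ps → x ∈ xs) →
        ∑ xs f ≡ ∑ ps f + ∑ (xs ∖ ps) f
  ∑-∖ xs ps f ux up ⊆ = trans (∑-partition (_∈? ps) xs) (cong (_+ ∑ (xs ∖ ps) f) (begin
    ∑ (filter (_∈? ps) xs) f                            ≡⟨ ∑-filter (_∈? ps) xs ⟩
    ∑ xs (λ x → ι (x ∈? ps) * f x)                      ≡⟨ ∑-cong xs (λ x _ → cong (_* f x) (ι-∈ ps x up)) ⟩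
    ∑ xs (λ x → ∑ ps (λ p → ι (p Finₚ.≟ x)) * f x)      ≡⟨ ∑-cong xs (λ x _ → ∑-*ʳ (f x) ps) ⟩
    ∑ xs (λ x → ∑ ps (λ p → ι (p Finₚ.≟ x) * f x))      ≡⟨ ∑-swap xs ps ⟩
    ∑ ps (λ p → ∑ xs (λ x → ι (p Finₚ.≟ x) * f x))      ≡⟨ ∑-cong ps (λ p m → trans (∑-cong xs λ x _ → cong (_* f x) (ι-sym p x)) (∑-δ xs p f ux (⊆ m))) ⟩
    ∑ ps f                                              ∎))
    where
    open ≡-Reasoning
    ι-sym : ∀ p x → ι (p Finₚ.≟ x) ≡ ι (x Finₚ.≟ p)
    ι-sym p x with p Finₚ.≟ x
    ... | yes refl = sym (ι-yes (p Finₚ.≟ p) refl)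
    ... | no ≢ = sym (ι-no (x Finₚ.≟ p) (≢ ∘ sym))

  length-∖ : (xs ps : List (Fin n)) → Unique xs → Unique ps → (∀ {x} → x ∈ ps → x ∈ xs) →
             length xs ≡ length ps + length (xs ∖ ps)
  length-∖ xs ps ux up ⊆ = trans (sym (∑-length xs)) (trans (∑-∖ xs ps (λ _ → 1) ux up ⊆)
    (cong₂ _+_ (∑-length ps) (∑-length (xs ∖ ps))))

  length-mono : (xs ps : List (Fin n)) → Unique xs → Unique ps → (∀ {x} → x ∈ ps → x ∈ xs) →
                length ps ≤ length xs
  length-mono xs ps ux up ⊆ = subst (length ps ≤_) (sym (length-∖ xs ps ux up ⊆)) (m≤m+n _ _)

  -- `ps` may repeat entries and leave `xs`: each of its entries removes at most one entry of the
  -- duplicate-free `xs`. This bounds the free vertices during the greedy matching.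
  length-∖≥ : (xs ps : List (Fin n)) → Unique xs → length xs ≤ length (xs ∖ ps) + length ps
  length-∖≥ xs []       ux = ≤-reflexive (trans (sym (length-∖[] xs)) (sym (+-identityʳ _)))
    where
    length-∖[] : ∀ xs → length (xs ∖ []) ≡ length xs
    length-∖[] xs = cong length {filter (λ x → ¬? (x ∈? [])) xs} {xs} (Listₚ.filter-all (λ x → ¬? (x ∈? [])) (All.tabulate λ _ ()))
  length-∖≥ xs (p ∷ ps) ux = ≤-trans (length-∖≥ xs ps ux) (subst₂ _≤_ refl (sym (+-suc _ _)) (+-monoˡ-≤ (length ps) step))
    where
    open ≤-Reasoning
    step : length (xs ∖ ps) ≤ suc (length (xs ∖ (p ∷ ps)))
    step = begin
      length (xs ∖ ps)                                   ≡⟨ length-filter≡∑ (λ x → ¬? (x ∈? ps)) xs ⟩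
      ∑ xs (λ x → ι (¬? (x ∈? ps)))                      ≤⟨ ∑-mono xs (λ x _ → pt x) ⟩
      ∑ xs (λ x → ι (x Finₚ.≟ p) + ι (¬? (x ∈? (p ∷ ps))))  ≡⟨ ∑-+ xs ⟩
      ∑ xs (λ x → ι (x Finₚ.≟ p)) + ∑ xs (λ x → ι (¬? (x ∈? (p ∷ ps)))) ≤⟨ +-mono-≤ (∑-δ≤ xs p ux) (≤-reflexive (sym (length-filter≡∑ (λ x → ¬? (x ∈? (p ∷ ps))) xs))) ⟩
      suc (length (xs ∖ (p ∷ ps)))                       ∎
      where
      pt : ∀ x → ι (¬? (x ∈? ps)) ≤ ι (x Finₚ.≟ p) + ι (¬? (x ∈? (p ∷ ps)))
      pt x = go (x Finₚ.≟ p)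
        where
        go : (d : Dec (x ≡ p)) → ι (¬? (x ∈? ps)) ≤ ι d + ι (¬? (x ∈? (p ∷ ps)))
        go (yes _)  = ≤-trans (ι≤1 (¬? (x ∈? ps))) (m≤m+n 1 _)
        go (no x≢p) = ι-mono (¬? (x ∈? ps)) (¬? (x ∈? (p ∷ ps))) λ { x∉ (here e) → x≢p e ; x∉ (there m) → x∉ m }

length-concatMap : {A B : Set} (g : A → List B) (xs : List A) → length (concatMap g xs) ≡ ∑ xs (λ x → length (g x))
length-concatMap g xs = trans (sym (∑-length (concatMap g xs)))
  (trans (∑-concatMap g xs) (∑-cong xs λ x _ → ∑-length (g x)))

-- Enumerated for exhaustive search: sparse pairs of blocks and cliques are found among the words,
-- and the predicate searched for rules out repetitions.
words : {A : Set} → ℕ → List A → List (List A)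
words zero    xs = [] ∷ []
words (suc k) xs = concatMap (λ x → map (x ∷_) (words k xs)) xs

∈-words : {A : Set} (xs : List A) (w : List A) → (∀ {x} → x ∈ w → x ∈ xs) → w ∈ words (length w) xs
∈-words xs []      h = here refl
∈-words xs (x ∷ w) h = ∈ₚ.∈-concatMap⁺ (λ x → map (x ∷_) (words (length w) xs))
  (Any.map (λ { refl → ∈ₚ.∈-map⁺ (x ∷_) (∈-words xs w (h ∘ there)) }) (h (here refl)))

words-∈ : {A : Set} (k : ℕ) (xs : List A) {w : List A} → w ∈ words k xs → length w ≡ k × (∀ {x} → x ∈ w → x ∈ xs)
words-∈ zero    xs (here refl) = refl , λ ()
words-∈ (suc k) xs m with ∈ₚ.∈-concatMap⁻ (λ x → map (x ∷_) (words k xs)) m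
... | a = go xs id a
  where
  go : ∀ ys → (∀ {x} → x ∈ ys → x ∈ xs) → ∀ {w} → Any (λ x → w ∈ map (x ∷_) (words k xs)) ys →
       length w ≡ suc k × (∀ {x} → x ∈ w → x ∈ xs)
  go (y ∷ ys) sub (here m) with ∈ₚ.∈-map⁻ (y ∷_) m
  ... | w , w∈ , refl with words-∈ k xs w∈
  ...   | l , s = cong suc l , λ { (here refl) → sub (here refl) ; (there q) → s q }
  go (y ∷ ys) sub (there a) = go ys (sub ∘ there) a

-- Random subsets

-- (k + l)^N times the expectation of f at a random subset of density k / (k + l).
E : (k l N : ℕ) → (Subset N → ℕ) → ℕ
E k l zero    f = f []
E k l (suc N) f = k * E k l N (f ∘ (true ∷_)) + l * E k l N (f ∘ (false ∷_))

module _ (k l : ℕ) where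

  E-mono : ∀ N {f g : Subset N → ℕ} → (∀ W → f W ≤ g W) → E k l N f ≤ E k l N g
  E-mono zero    h = h []
  E-mono (suc N) h = +-mono-≤ (*-monoʳ-≤ k (E-mono N λ W → h (true ∷ W))) (*-monoʳ-≤ l (E-mono N λ W → h (false ∷ W)))

  E-cong : ∀ N {f g : Subset N → ℕ} → (∀ W → f W ≡ g W) → E k l N f ≡ E k l N g
  E-cong N h = ≤-antisym (E-mono N (≤-reflexive ∘ h)) (E-mono N (≤-reflexive ∘ sym ∘ h))

  E-+ : ∀ N {f g : Subset N → ℕ} → E k l N (λ W → f W + g W) ≡ E k l N f + E k l N g
  E-+ zero    = refl
  E-+ (suc N) {f} {g} rewrite E-+ N {f ∘ (true ∷_)} {g ∘ (true ∷_)} | E-+ N {f ∘ (false ∷_)} {g ∘ (false ∷_)} =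
    lem k l (E k l N (f ∘ (true ∷_))) _ (E k l N (f ∘ (false ∷_))) _
    where
    lem : ∀ k l a b c d → k * (a + b) + l * (c + d) ≡ k * a + l * c + (k * b + l * d)
    lem = solve-∀

  E-*ˡ : ∀ N c {f : Subset N → ℕ} → c * E k l N f ≡ E k l N (λ W → c * f W)
  E-*ˡ zero    c = refl
  E-*ˡ (suc N) c {f} rewrite sym (E-*ˡ N c {f ∘ (true ∷_)}) | sym (E-*ˡ N c {f ∘ (false ∷_)}) =
    lem k l c (E k l N (f ∘ (true ∷_))) (E k l N (f ∘ (false ∷_)))
    where
    lem : ∀ k l c a b → c * (k * a + l * b) ≡ k * (c * a) + l * (c * b)
    lem = solve-∀

  E-const : ∀ N c → E k l N (λ _ → c) ≡ (k + l) ^ N * c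
  E-const zero    c = sym (*-identityˡ c)
  E-const (suc N) c rewrite E-const N c = lem k l ((k + l) ^ N) c
    where
    lem : ∀ k l b c → k * (b * c) + l * (b * c) ≡ (k + l) * b * c
    lem = solve-∀

  E-≤const : ∀ N c {f : Subset N → ℕ} → (∀ W → f W ≤ c) → E k l N f ≤ (k + l) ^ N * c
  E-≤const N c h = ≤-trans (E-mono N h) (≤-reflexive (E-const N c))

∑⊆ : ∀ {N} → Subset N → (Subset N → ℕ) → ℕ
∑⊆ []          g = g []
∑⊆ (true ∷ S)  g = ∑⊆ S (g ∘ (true ∷_)) + ∑⊆ S (g ∘ (false ∷_))
∑⊆ (false ∷ S) g = ∑⊆ S (g ∘ (false ∷_))

∑⊆-mono : ∀ {N} (S : Subset N) {f g : Subset N → ℕ} → (∀ T → f T ≤ g T) → ∑⊆ S f ≤ ∑⊆ S g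
∑⊆-mono []          h = h []
∑⊆-mono (true ∷ S)  h = +-mono-≤ (∑⊆-mono S (h ∘ (true ∷_))) (∑⊆-mono S (h ∘ (false ∷_)))
∑⊆-mono (false ∷ S) h = ∑⊆-mono S (h ∘ (false ∷_))

∑⊆-term : ∀ {N} (S T : Subset N) (g : Subset N → ℕ) → T ⊆ₛ S → g T ≤ ∑⊆ S g
∑⊆-term []          []          g h = ≤-refl
∑⊆-term (true ∷ S)  (true ∷ T)  g h = ≤-trans (∑⊆-term S T (g ∘ (true ∷_)) (Subₚ.drop-∷-⊆ h)) (m≤m+n _ _)
∑⊆-term (true ∷ S)  (false ∷ T) g h = ≤-trans (∑⊆-term S T (g ∘ (false ∷_)) (Subₚ.drop-∷-⊆ h)) (m≤n+m _ _)
∑⊆-term (false ∷ S) (true ∷ T)  g h = case h Vec.here of λ ()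
∑⊆-term (false ∷ S) (false ∷ T) g h = ∑⊆-term S T (g ∘ (false ∷_)) (Subₚ.drop-∷-⊆ h)

-- The substitution Z = W ∪ T : pairs of disjoint sets (W , T) correspond to pairs T ⊆ Z,
-- and moving T into the random set multiplies its weight by (k / l)^|T| ≥ (k / (k + l))^|T|.
disjoint-union-swap : ∀ k l N (u v : Subset N → Subset N → ℕ) α β →
  (∀ Z T → α * (u Z T * (k + l) ^ ∣ T ∣) ≤ β * (v Z T * k ^ ∣ T ∣)) →
  α * E k l N (λ W → ∑⊆ (∁ₛ W) (λ T → u (W ∪ₛ T) T)) ≤ β * E k l N (λ Z → ∑⊆ Z (v Z))
disjoint-union-swap k l zero u v α β h = subst₂ _≤_ (cong (α *_) (*-identityʳ _)) (cong (β *_) (*-identityʳ _)) (h [] [])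
disjoint-union-swap k l (suc N) u v α β h = begin
  α * (k * X₁₀ + l * E k l N _)                  ≡⟨ cong (λ z → α * (k * X₁₀ + l * z)) (E-+ k l N) ⟩
  α * (k * X₁₀ + l * (X₁₁ + X₀₀))                ≡⟨ expand α k l X₁₀ X₁₁ X₀₀ ⟩
  k * (α * X₁₀) + (α * l * X₁₁ + l * (α * X₀₀))  ≤⟨ +-mono-≤ (*-monoʳ-≤ k p₁₀) (+-mono-≤ p₁₁ (*-monoʳ-≤ l p₀₀)) ⟩
  k * (β * Y₁₀) + (β * k * Y₁₁ + l * (β * Y₀₀))  ≡⟨ collect β k l Y₁₀ Y₁₁ Y₀₀ ⟩
  β * (k * (Y₁₁ + Y₁₀) + l * Y₀₀)                ≡⟨ cong (λ z → β * (k * z + l * Y₀₀)) (E-+ k l N) ⟨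
  β * (k * E k l N _ + l * Y₀₀)                  ∎
  where
  open ≤-Reasoning
  u₁₀ u₁₁ u₀₀ v₁₀ v₁₁ v₀₀ : Subset N → Subset N → ℕ
  u₁₀ Z T = u (true ∷ Z) (false ∷ T)
  u₁₁ Z T = u (true ∷ Z) (true ∷ T)
  u₀₀ Z T = u (false ∷ Z) (false ∷ T)
  v₁₀ Z T = v (true ∷ Z) (false ∷ T)
  v₁₁ Z T = v (true ∷ Z) (true ∷ T)
  v₀₀ Z T = v (false ∷ Z) (false ∷ T)
  X : (Subset N → Subset N → ℕ) → ℕ
  X u = E k l N (λ W → ∑⊆ (∁ₛ W) (λ T → u (W ∪ₛ T) T))
  Y : (Subset N → Subset N → ℕ) → ℕ
  Y v = E k l N (λ Z → ∑⊆ Z (v Z))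
  X₁₀ = X u₁₀
  X₁₁ = X u₁₁
  X₀₀ = X u₀₀
  Y₁₀ = Y v₁₀
  Y₁₁ = Y v₁₁
  Y₀₀ = Y v₀₀
  p₁₀ : α * X₁₀ ≤ β * Y₁₀
  p₁₀ = disjoint-union-swap k l N u₁₀ v₁₀ α β (λ Z T → h (true ∷ Z) (false ∷ T))
  p₀₀ : α * X₀₀ ≤ β * Y₀₀
  p₀₀ = disjoint-union-swap k l N u₀₀ v₀₀ α β (λ Z T → h (false ∷ Z) (false ∷ T))
  regroup : ∀ α w b e → α * (w * (b * e)) ≡ α * b * (w * e)
  regroup = solve-∀
  -- The coordinate lies in T, so it is outside `W` (factor l) but inside `Z` (factor k). The
  -- induction hypothesis takes one factor k + l into α and one factor k into β; replacing l by k +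
  -- l is the only loss.
  p₁₁ : α * l * X₁₁ ≤ β * k * Y₁₁
  p₁₁ = ≤-trans (*-monoˡ-≤ X₁₁ (*-monoʳ-≤ α (m≤n+m l k)))
    (disjoint-union-swap k l N u₁₁ v₁₁ (α * (k + l)) (β * k) λ Z T →
      subst₂ _≤_ (regroup α (u₁₁ Z T) (k + l) _) (regroup β (v₁₁ Z T) k _) (h (true ∷ Z) (true ∷ T)))
  expand : ∀ α k l a b c → α * (k * a + l * (b + c)) ≡ k * (α * a) + (α * l * b + l * (α * c))
  expand = solve-∀
  collect : ∀ β k l a b c → k * (β * a) + (β * k * b + l * (β * c)) ≡ β * (k * (b + a) + l * c)
  collect = solve-∀

-- The binomial theorem for the sum of r^-|T| over subsets of a set of at most ℓ elements,
-- multiplied by r^ℓ to stay in ℕ.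
∑⊆-power : ∀ {N} r ℓ (S Z : Subset N) → ∣ S ∣ ≤ ℓ →
  ∑⊆ Z (λ T → ι (T Subₚ.⊆? S) * r ^ (ℓ ∸ ∣ T ∣)) ≤ (1 + r) ^ ℓ
∑⊆-power r ℓ S Z h = ≤-trans (restrict Z S (λ T → r ^ (ℓ ∸ ∣ T ∣))) (total S ℓ h)
  where
  restrict : ∀ {N} (Z S : Subset N) (g : Subset N → ℕ) → ∑⊆ Z (λ T → ι (T Subₚ.⊆? S) * g T) ≤ ∑⊆ S g
  restrict []          []          g = ≤-reflexive (*-identityˡ _)
  restrict (z ∷ Z) (true ∷ S) g = go z
    where
    lt : ∑⊆ Z (λ T → ι ((true ∷ T) Subₚ.⊆? (true ∷ S)) * g (true ∷ T)) ≤ ∑⊆ S (g ∘ (true ∷_))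
    lt = ≤-trans (∑⊆-mono Z λ T → *-monoˡ-≤ (g (true ∷ T)) (ι-mono ((true ∷ T) Subₚ.⊆? (true ∷ S)) (T Subₚ.⊆? S) Subₚ.drop-∷-⊆)) (restrict Z S (g ∘ (true ∷_)))
    lf : ∑⊆ Z (λ T → ι ((false ∷ T) Subₚ.⊆? (true ∷ S)) * g (false ∷ T)) ≤ ∑⊆ S (g ∘ (false ∷_))
    lf = ≤-trans (∑⊆-mono Z λ T → *-monoˡ-≤ (g (false ∷ T)) (ι-mono ((false ∷ T) Subₚ.⊆? (true ∷ S)) (T Subₚ.⊆? S) Subₚ.drop-∷-⊆)) (restrict Z S (g ∘ (false ∷_)))
    go : ∀ z → ∑⊆ (z ∷ Z) (λ T → ι (T Subₚ.⊆? (true ∷ S)) * g T) ≤ ∑⊆ (true ∷ S) g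
    go true  = +-mono-≤ lt lf
    go false = ≤-trans lf (m≤n+m _ _)
  restrict (z ∷ Z) (false ∷ S) g = go z
    where
    lf : ∑⊆ Z (λ T → ι ((false ∷ T) Subₚ.⊆? (false ∷ S)) * g (false ∷ T)) ≤ ∑⊆ S (g ∘ (false ∷_))
    lf = ≤-trans (∑⊆-mono Z λ T → *-monoˡ-≤ (g (false ∷ T)) (ι-mono ((false ∷ T) Subₚ.⊆? (false ∷ S)) (T Subₚ.⊆? S) Subₚ.drop-∷-⊆)) (restrict Z S (g ∘ (false ∷_)))
    vanish : ∀ {M} (Y : Subset M) → ∑⊆ Y (λ _ → 0) ≡ 0
    vanish []          = refl
    vanish (true ∷ Y)  = cong₂ _+_ (vanish Y) (vanish Y)
    vanish (false ∷ Y) = vanish Y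
    go : ∀ z → ∑⊆ (z ∷ Z) (λ T → ι (T Subₚ.⊆? (false ∷ S)) * g T) ≤ ∑⊆ (false ∷ S) g
    go true  = +-mono-≤ {v = ∑⊆ S (g ∘ (false ∷_))} (≤-reflexive (vanish Z)) lf
    go false = lf
  total : ∀ {N} (S : Subset N) ℓ → ∣ S ∣ ≤ ℓ → ∑⊆ S (λ T → r ^ (ℓ ∸ ∣ T ∣)) ≤ (1 + r) ^ ℓ
  total []          ℓ       _ = ^-monoˡ-≤ ℓ (n≤1+n r)
  total (false ∷ S) ℓ       h = total S ℓ h
  total (true ∷ S) (suc ℓ) (s≤s h) = begin
    ∑⊆ S (λ T → r ^ (ℓ ∸ ∣ T ∣)) + ∑⊆ S (λ T → r ^ (suc ℓ ∸ ∣ T ∣))  ≤⟨ +-mono-≤ (total S ℓ h) (shift S ℓ h) ⟩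
    (1 + r) ^ ℓ + r * ∑⊆ S (λ T → r ^ (ℓ ∸ ∣ T ∣))                   ≤⟨ +-monoʳ-≤ ((1 + r) ^ ℓ) (*-monoʳ-≤ r (total S ℓ h)) ⟩
    (1 + r) * (1 + r) ^ ℓ                                            ∎
    where
    open ≤-Reasoning
    shift : ∀ {N} (S : Subset N) ℓ → ∣ S ∣ ≤ ℓ → ∑⊆ S (λ T → r ^ (suc ℓ ∸ ∣ T ∣)) ≤ r * ∑⊆ S (λ T → r ^ (ℓ ∸ ∣ T ∣))
    shift []          ℓ h = ≤-refl
    shift (false ∷ S) ℓ h = shift S ℓ h
    shift (true ∷ S) (suc ℓ) (s≤s h) = ≤-trans (+-mono-≤ (shift S ℓ h) (shift S (suc ℓ) (m≤n⇒m≤1+n h)))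
      (≤-reflexive (sym (*-distribˡ-+ r _ _)))

-- Minimum fragments

^-distribʳ-* : ∀ m n k → (m * n) ^ k ≡ m ^ k * n ^ k
^-distribʳ-* m n zero    = refl
^-distribʳ-* m n (suc k) rewrite ^-distribʳ-* m n k = lem m n (m ^ k) (n ^ k)
  where
  lem : ∀ a b c d → a * b * (c * d) ≡ a * c * (b * d)
  lem = solve-∀

⊆∧∣∣≥⇒⊇ : ∀ {N} {S T : Subset N} → S ⊆ₛ T → ∣ T ∣ ≤ ∣ S ∣ → T ⊆ₛ S
⊆∧∣∣≥⇒⊇ {S = S} sub le {x} x∈T with x Subₚ.∈? S
... | yes x∈S = x∈S
... | no x∉S  = contradiction (Subₚ.p⊂q⇒∣p∣<∣q∣ (sub , x , x∈T , x∉S)) (≤⇒≯ le)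

x∈p─q⇒x∉q : ∀ {N} {p q : Subset N} {x} → x ∈ₛ p ─ q → Sub._∉_ x q
x∈p─q⇒x∉q {p = _ ∷ _} {q = true ∷ _} {zero}  () Vec.here
x∈p─q⇒x∉q {p = _ ∷ p} {q = _ ∷ q} {suc x} (Vec.there m) (Vec.there m′) = x∈p─q⇒x∉q {p = p} {q} m m′

abstract
  minimiser : {A : Set} (f : A → ℕ) (a : A) (xs : List A) → ∃[ b ] (b ≡ a ⊎ b ∈ xs) × (∀ {x} → x ∈ xs → f b ≤ f x)
  minimiser f a xs = argmin f a xs , argmin-sel f a xs , All.lookup (f[argmin]≤f[xs] {f = f} a xs)

module _ {A : Set} {N : ℕ} (S : A → Subset N) (as : List A) where

  candidates : Subset N → A → List A
  candidates W a = filter (λ a′ → S a′ Subₚ.⊆? (W ∪ₛ S a)) as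

  -- The default `a` of the minimum is a legitimate choice, since S a ⊆ W ∪ S a.
  bestFor : Subset N → A → A
  bestFor W a = proj₁ (minimiser (λ a′ → ∣ S a′ ─ W ∣) a (candidates W a))

  -- The minimum fragment: what is still missing, after exposing W, from the member of the family
  -- inside W ∪ S a that has the fewest missing elements.
  fragment : Subset N → A → Subset N
  fragment W a = S (bestFor W a) ─ W

  bestFor-∈ : ∀ W {a} → a ∈ as → bestFor W a ∈ as × S (bestFor W a) ⊆ₛ W ∪ₛ S a
  bestFor-∈ W {a} a∈ = go (proj₁ (proj₂ (minimiser (λ a′ → ∣ S a′ ─ W ∣) a (candidates W a))))
    where
    go : ∀ {b} → b ≡ a ⊎ b ∈ candidates W a → b ∈ as × S b ⊆ₛ W ∪ₛ S a
    go (inj₁ refl) = a∈ , Subₚ.q⊆p∪q W (S a)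
    go (inj₂ m)    = ∈ₚ.∈-filter⁻ (λ a′ → S a′ Subₚ.⊆? (W ∪ₛ S a)) {xs = as} m

  ─-split : ∀ {T U W : Subset N} → (∀ {x} → x ∈ₛ T ─ W → x ∈ₛ U) → T ⊆ₛ W ∪ₛ U
  ─-split {T} {U} {W} rest {x} x∈ = go (x Subₚ.∈? W)
    where
    go : Dec (x ∈ₛ W) → x ∈ₛ W ∪ₛ U
    go (yes x∈W) = Subₚ.x∈p∪q⁺ (inj₁ x∈W)
    go (no x∉W)  = Subₚ.x∈p∪q⁺ {p = W} (inj₂ (rest (Subₚ.x∈p∧x∉q⇒x∈p─q x∈ x∉W)))

  ─-elim : ∀ {T U W : Subset N} → T ⊆ₛ W ∪ₛ U → T ─ W ⊆ₛ U
  ─-elim {T} {U} {W} sub {x} x∈ = go (Subₚ.x∈p∪q⁻ W U (sub (Subₚ.p─q⊆p T W x∈)))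
    where
    go : x ∈ₛ W ⊎ x ∈ₛ U → x ∈ₛ U
    go (inj₁ x∈W) = contradiction x∈W (x∈p─q⇒x∉q {p = T} x∈)
    go (inj₂ x∈U) = x∈U

  fragment⊆ : ∀ W {a} → a ∈ as → fragment W a ⊆ₛ S a
  fragment⊆ W a∈ = ─-elim (proj₂ (bestFor-∈ W a∈))

  fragment⊆∁ : ∀ W a → fragment W a ⊆ₛ ∁ₛ W
  fragment⊆∁ W a x∈ = Subₚ.x∉p⇒x∈∁p (x∈p─q⇒x∉q {p = S (bestFor W a)} x∈)

  firstOr∅ : List A → Subset N
  firstOr∅ []      = ∅
  firstOr∅ (a ∷ _) = S a

  -- A member of the family inside Z, if any: it contains every minimum fragment T with W ∪ T = Z.
  memberInside : Subset N → Subset N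
  memberInside Z = firstOr∅ (filter (λ a → S a Subₚ.⊆? Z) as)

  memberInside-∣∣ : ∀ Z {ℓ} → (∀ a → a ∈ as → ∣ S a ∣ ≤ ℓ) → ∣ memberInside Z ∣ ≤ ℓ
  memberInside-∣∣ Z {ℓ} h = go (filter (λ a → S a Subₚ.⊆? Z) as) λ m → h _ (proj₁ (∈ₚ.∈-filter⁻ (λ a → S a Subₚ.⊆? Z) {xs = as} m))
    where
    go : ∀ xs → (∀ {a} → a ∈ xs → ∣ S a ∣ ≤ ℓ) → ∣ firstOr∅ xs ∣ ≤ ℓ
    go []      _ = ≤-trans (≤-reflexive (Subₚ.∣⊥∣≡0 N)) z≤n
    go (a ∷ _) f = f (here refl)

  -- Let T be the fragment. A member S a″ inside W ∪ T is also inside W ∪ S a, because T ⊆ S a. So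
  -- it competed in the minimum and |T| ≤ |S a″ ─ W|. As S a″ ─ W ⊆ T, the two sets are equal and T
  -- ⊆ S a″. The list of members inside W ∪ T is not empty: it contains `bestFor W a`.
  fragment⊆memberInside : ∀ W {a} → a ∈ as → fragment W a ⊆ₛ memberInside (W ∪ₛ fragment W a)
  fragment⊆memberInside W {a} a∈ = go (filter inside? as) (∈ₚ.∈-filter⁺ inside? (proj₁ (bestFor-∈ W a∈)) (─-split id)) (∈ₚ.∈-filter⁻ inside? {xs = as})
    where
    inside? : ∀ a′ → Dec (S a′ ⊆ₛ W ∪ₛ fragment W a)
    inside? a′ = S a′ Subₚ.⊆? (W ∪ₛ fragment W a)
    inside′ : ∀ {a″} → S a″ ⊆ₛ W ∪ₛ fragment W a → S a″ ⊆ₛ W ∪ₛ S a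
    inside′ sub = ─-split (λ x∈ → fragment⊆ W a∈ (─-elim sub x∈))
    minimal : ∀ {a″} → a″ ∈ as → S a″ ⊆ₛ W ∪ₛ fragment W a → ∣ fragment W a ∣ ≤ ∣ S a″ ─ W ∣
    minimal a″∈ sub = proj₂ (proj₂ (minimiser (λ a′ → ∣ S a′ ─ W ∣) a (candidates W a))) (∈ₚ.∈-filter⁺ (λ a′ → S a′ Subₚ.⊆? (W ∪ₛ S a)) a″∈ (inside′ sub))
    go : ∀ xs → bestFor W a ∈ xs → (∀ {a″} → a″ ∈ xs → a″ ∈ as × S a″ ⊆ₛ W ∪ₛ fragment W a) → fragment W a ⊆ₛ firstOr∅ xs
    go (a″ ∷ _) _ good = λ x∈ → Subₚ.p─q⊆p (S a″) W (⊆∧∣∣≥⇒⊇ (─-elim sub) (minimal a″∈ sub) x∈)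
      where
      a″∈ = proj₁ (good (here refl))
      sub = proj₂ (good (here refl))

  -- With M = length as, the uniform measure on the family is (1 / d)-spread.
  Spread : ℕ → ℕ → Set
  Spread d M = ∀ T → ∑ as (λ a → ι (T Subₚ.⊆? S a)) * d ^ ∣ T ∣ ≤ M

  -- The exponential moment is a sum over pairs (W, T). Passing to Z = W ∪ T costs at most ((k + l)
  -- / k)^|T|, and spread gains d^-|T|. The hypothesis relating `λ′`, `r` and `d` leaves r^-|T|, and
  -- since T is a subset of `memberInside Z` the binomial sum (1 + 1 / r)^ℓ finishes.
  fragment-moment : ∀ k l d λ′ r M ℓ → 0 < d → λ′ * r * (k + l) ≤ k * d →
    (∀ a → a ∈ as → ∣ S a ∣ ≤ ℓ) → Spread d M →
    r ^ ℓ * E k l N (λ W → ∑ as (λ a → λ′ ^ ∣ fragment W a ∣)) ≤ M * ((k + l) ^ N * (1 + r) ^ ℓ)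
  fragment-moment k l d λ′ r M ℓ d>0 q≤p small spread = begin
    r ^ ℓ * E k l N (λ W → ∑ as (λ a → λ′ ^ ∣ fragment W a ∣))          ≤⟨ *-monoʳ-≤ (r ^ ℓ) (E-mono k l N group) ⟩
    r ^ ℓ * E k l N (λ W → ∑⊆ (∁ₛ W) (λ T → u (W ∪ₛ T) T))             ≤⟨ disjoint-union-swap k l N u v (r ^ ℓ) M weigh ⟩
    M * E k l N (λ Z → ∑⊆ Z (v Z))                                     ≤⟨ *-monoʳ-≤ M (E-≤const k l N _ λ Z → ∑⊆-power r ℓ (memberInside Z) Z (memberInside-∣∣ Z small)) ⟩
    M * ((k + l) ^ N * (1 + r) ^ ℓ)                                    ∎
    where
    open ≤-Reasoning
    # : Subset N → ℕ
    # T = ∑ as (λ a → ι (T Subₚ.⊆? S a))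
    u v : Subset N → Subset N → ℕ
    u Z T = ι (T Subₚ.⊆? memberInside Z) * (λ′ ^ ∣ T ∣ * # T)
    v Z T = ι (T Subₚ.⊆? memberInside Z) * r ^ (ℓ ∸ ∣ T ∣)
    single : ∀ W a → a ∈ as → λ′ ^ ∣ fragment W a ∣ ≤ ∑⊆ (∁ₛ W) (λ T → ι (T Subₚ.⊆? memberInside (W ∪ₛ T)) * (λ′ ^ ∣ T ∣ * ι (T Subₚ.⊆? S a)))
    single W a a∈ = ≤-trans (≤-reflexive (sym (trans (cong₂ (λ x y → x * (λ′ ^ ∣ fragment W a ∣ * y))
        (ι-yes (fragment W a Subₚ.⊆? memberInside (W ∪ₛ fragment W a)) (fragment⊆memberInside W a∈))
        (ι-yes (fragment W a Subₚ.⊆? S a) (fragment⊆ W a∈)))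
        (trans (*-identityˡ _) (*-identityʳ _)))))
      (∑⊆-term (∁ₛ W) (fragment W a) (λ T → ι (T Subₚ.⊆? memberInside (W ∪ₛ T)) * (λ′ ^ ∣ T ∣ * ι (T Subₚ.⊆? S a))) (fragment⊆∁ W a))
    ∑-∑⊆ : ∀ {M} (xs : List A) (Z : Subset M) (g : A → Subset M → ℕ) → ∑ xs (λ a → ∑⊆ Z (g a)) ≡ ∑⊆ Z (λ T → ∑ xs (λ a → g a T))
    ∑-∑⊆ xs []          g = refl
    ∑-∑⊆ xs (true ∷ Z)  g = trans (∑-+ xs) (cong₂ _+_ (∑-∑⊆ xs Z (λ a → g a ∘ (true ∷_))) (∑-∑⊆ xs Z (λ a → g a ∘ (false ∷_))))
    ∑-∑⊆ xs (false ∷ Z) g = ∑-∑⊆ xs Z (λ a → g a ∘ (false ∷_))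
    group : ∀ W → ∑ as (λ a → λ′ ^ ∣ fragment W a ∣) ≤ ∑⊆ (∁ₛ W) (λ T → u (W ∪ₛ T) T)
    group W = ≤-trans (∑-mono as (single W)) (≤-trans (≤-reflexive (∑-∑⊆ as (∁ₛ W) _))
      (∑⊆-mono (∁ₛ W) λ T → ≤-reflexive (trans (sym (∑-*ˡ (ι (T Subₚ.⊆? memberInside (W ∪ₛ T))) as)) (cong (ι (T Subₚ.⊆? memberInside (W ∪ₛ T)) *_) (sym (∑-*ˡ (λ′ ^ ∣ T ∣) as))))))
    cancelled : ∀ T → ∣ T ∣ ≤ ℓ → r ^ ℓ * (λ′ ^ ∣ T ∣ * # T * (k + l) ^ ∣ T ∣) ≤ M * (r ^ (ℓ ∸ ∣ T ∣) * k ^ ∣ T ∣)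
    cancelled T t≤ℓ = *-cancelʳ-≤ _ _ (d ^ ∣ T ∣) {{m^n≢0 d ∣ T ∣ {{>-nonZero d>0}}}} (begin
      r ^ ℓ * (λ′ ^ t * # T * (k + l) ^ t) * d ^ t             ≡⟨ cong (λ z → z * (λ′ ^ t * # T * (k + l) ^ t) * d ^ t) (trans (cong (r ^_) (sym (m∸n+n≡m t≤ℓ))) (^-distribˡ-+-* r (ℓ ∸ t) t)) ⟩
      r ^ (ℓ ∸ t) * r ^ t * (λ′ ^ t * # T * (k + l) ^ t) * d ^ t ≡⟨ arrange (r ^ (ℓ ∸ t)) (r ^ t) (λ′ ^ t) (# T) ((k + l) ^ t) (d ^ t) ⟩
      r ^ (ℓ ∸ t) * (λ′ ^ t * r ^ t * (k + l) ^ t) * (# T * d ^ t) ≡⟨ cong (λ z → r ^ (ℓ ∸ t) * z * (# T * d ^ t)) (sym (trans (^-distribʳ-* (λ′ * r) (k + l) t) (cong (_* (k + l) ^ t) (^-distribʳ-* λ′ r t)))) ⟩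
      r ^ (ℓ ∸ t) * (λ′ * r * (k + l)) ^ t * (# T * d ^ t)      ≤⟨ *-mono-≤ (*-monoʳ-≤ (r ^ (ℓ ∸ t)) (^-monoˡ-≤ t q≤p)) (spread T) ⟩
      r ^ (ℓ ∸ t) * (k * d) ^ t * M                            ≡⟨ cong (λ z → r ^ (ℓ ∸ t) * z * M) (^-distribʳ-* k d t) ⟩
      r ^ (ℓ ∸ t) * (k ^ t * d ^ t) * M                        ≡⟨ arrange′ (r ^ (ℓ ∸ t)) (k ^ t) (d ^ t) M ⟩
      M * (r ^ (ℓ ∸ t) * k ^ t) * d ^ t                        ∎)
      where
      t = ∣ T ∣
      arrange : ∀ a b c e f g → a * b * (c * e * f) * g ≡ a * (c * b * f) * (e * g)
      arrange = solve-∀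
      arrange′ : ∀ a b c e → a * (b * c) * e ≡ e * (a * b) * c
      arrange′ = solve-∀
    weigh : ∀ Z T → r ^ ℓ * (u Z T * (k + l) ^ ∣ T ∣) ≤ M * (v Z T * k ^ ∣ T ∣)
    weigh Z T with T Subₚ.⊆? memberInside Z
    ... | no _  = ≤-trans (≤-reflexive (*-zeroʳ (r ^ ℓ))) z≤n
    ... | yes T⊆ rewrite *-identityˡ (λ′ ^ ∣ T ∣ * # T) | *-identityˡ (r ^ (ℓ ∸ ∣ T ∣)) =
      cancelled T (≤-trans (Subₚ.p⊆q⇒∣p∣≤∣q∣ T⊆) (memberInside-∣∣ Z small))

-- Exposing the random set in rounds

-- (1 + x)^j ≤ 1 + j x + j² x² for x = 1 / r and j ≤ r.
[1+r]^j*r²≤ : ∀ r j → j ≤ r → (1 + r) ^ j * (r * r) ≤ r ^ j * (r * r + j * r + j * j)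
[1+r]^j*r²≤ r zero    _ = ≤-reflexive (lem r)
  where
  lem : ∀ r → 1 * (r * r) ≡ 1 * (r * r + 0 * r + 0 * 0)
  lem = solve-∀
[1+r]^j*r²≤ r (suc j) j<r = begin
  (1 + r) * (1 + r) ^ j * (r * r)                          ≡⟨ *-assoc (1 + r) ((1 + r) ^ j) (r * r) ⟩
  (1 + r) * ((1 + r) ^ j * (r * r))                        ≤⟨ *-monoʳ-≤ (1 + r) ([1+r]^j*r²≤ r j (<⇒≤ j<r)) ⟩
  (1 + r) * (r ^ j * (r * r + j * r + j * j))              ≡⟨ left r (r ^ j) j ⟩
  r ^ j * (r * r * r + (1 + j) * r * r + (j + j * j) * r + j * j)     ≤⟨ *-monoʳ-≤ (r ^ j) (+-monoʳ-≤ _ (≤-trans (*-monoʳ-≤ j (<⇒≤ j<r)) (m≤n+m (j * r) r))) ⟩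
  r ^ j * (r * r * r + (1 + j) * r * r + (j + j * j) * r + (r + j * r)) ≡⟨ right r (r ^ j) j ⟩
  r * r ^ j * (r * r + (1 + j) * r + (1 + j) * (1 + j))    ∎
  where
  open ≤-Reasoning
  left : ∀ r q j → (1 + r) * (q * (r * r + j * r + j * j)) ≡ q * (r * r * r + (1 + j) * r * r + (j + j * j) * r + j * j)
  left = solve-∀
  right : ∀ r q j → q * (r * r * r + (1 + j) * r * r + (j + j * j) * r + (r + j * r)) ≡ r * q * (r * r + (1 + j) * r + (1 + j) * (1 + j))
  right = solve-∀

[1+r]^j≤3r^j : ∀ r j → j ≤ r → (1 + r) ^ j ≤ 3 * r ^ j
[1+r]^j≤3r^j zero    zero    _   = s≤s z≤n
[1+r]^j≤3r^j r@(suc _) j j≤r = *-cancelʳ-≤ _ _ (r * r) (begin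
  (1 + r) ^ j * (r * r)                ≤⟨ [1+r]^j*r²≤ r j j≤r ⟩
  r ^ j * (r * r + j * r + j * j)      ≤⟨ *-monoʳ-≤ (r ^ j) (+-mono-≤ (+-monoʳ-≤ (r * r) (*-monoˡ-≤ r j≤r)) (*-mono-≤ j≤r j≤r)) ⟩
  r ^ j * (r * r + r * r + r * r)      ≡⟨ lem (r ^ j) r ⟩
  3 * r ^ j * (r * r)                  ∎)
  where
  open ≤-Reasoning
  lem : ∀ q r → q * (r * r + r * r + r * r) ≡ 3 * q * (r * r)
  lem = solve-∀

-- The exponent is cut into j pieces of length at most r; each costs a factor 3, standing in for e.
[1+r]^ℓ≤3^j*r^ℓ : ∀ r j ℓ → ℓ ≤ r * j → (1 + r) ^ ℓ ≤ 3 ^ j * r ^ ℓ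
[1+r]^ℓ≤3^j*r^ℓ r zero    ℓ h rewrite n≤0⇒n≡0 (subst (ℓ ≤_) (*-zeroʳ r) h) = ≤-refl
[1+r]^ℓ≤3^j*r^ℓ r (suc j) ℓ h with ℓ ≤? r
... | yes ℓ≤r = ≤-trans ([1+r]^j≤3r^j r ℓ ℓ≤r) (*-monoˡ-≤ (r ^ ℓ) (*-monoʳ-≤ 3 {1} (m^n>0 3 j)))
... | no ℓ≰r  = begin
  (1 + r) ^ ℓ                        ≡⟨ split (1 + r) ⟩
  (1 + r) ^ r * (1 + r) ^ (ℓ ∸ r)    ≤⟨ *-mono-≤ ([1+r]^j≤3r^j r r ≤-refl) ([1+r]^ℓ≤3^j*r^ℓ r j (ℓ ∸ r) (m≤n+o⇒m∸n≤o ℓ r (subst (ℓ ≤_) (*-suc r j) h))) ⟩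
  3 * r ^ r * (3 ^ j * r ^ (ℓ ∸ r))  ≡⟨ lem (r ^ r) (3 ^ j) (r ^ (ℓ ∸ r)) ⟩
  3 * 3 ^ j * (r ^ r * r ^ (ℓ ∸ r))  ≡⟨ cong (3 ^ suc j *_) (split r) ⟨
  3 ^ suc j * r ^ ℓ                  ∎
  where
  open ≤-Reasoning
  split : ∀ x → x ^ ℓ ≡ x ^ r * x ^ (ℓ ∸ r)
  split x = trans (cong (x ^_) (sym (m+[n∸m]≡n (≰⇒≥ ℓ≰r)))) (^-distribˡ-+-* x r (ℓ ∸ r))
  lem : ∀ a b c → 3 * a * (b * c) ≡ 3 * b * (a * c)
  lem = solve-∀

m≤n*[1+m/n] : ∀ m n .{{_ : NonZero n}} → m ≤ n * suc (m / n)
m≤n*[1+m/n] m n = begin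
  m                       ≡⟨ m≡m%n+[m/n]*n m n ⟩
  m % n + m / n * n       ≤⟨ +-monoˡ-≤ _ (<⇒≤ (m%n<n m n)) ⟩
  suc (m / n) * n         ≡⟨ *-comm (suc (m / n)) n ⟩
  n * suc (m / n)         ∎
  where open ≤-Reasoning

module _ {A : Set} {N : ℕ} where

  -- Despite its name this decides that the fragment is short; `#long` counts with the negation.
  long? : (S : A → Subset N) (as : List A) (ℓ′ : ℕ) (W : Subset N) (a : A) → Dec (∣ fragment S as W a ∣ ≤ ℓ′)
  long? S as ℓ′ W a = ∣ fragment S as W a ∣ ≤? ℓ′

  #long : (S : A → Subset N) (as : List A) (ℓ′ : ℕ) (W : Subset N) → ℕ
  #long S as ℓ′ W = ∑ as (λ a → ι (¬? (long? S as ℓ′ W a)))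

  -- Markov's inequality for the exponential moment. With the threshold ℓ / r, both `λ′` and the
  -- constant 3 from (1 + 1 / r)^ℓ appear to the power suc (ℓ / r), so long fragments have
  -- proportion at most (3 / λ′)^suc (ℓ / r).
  E-#long : ∀ (S : A → Subset N) as k l d λ′ r M ℓ .{{_ : NonZero r}} .{{_ : NonZero λ′}} → 0 < d →
    λ′ * r * (k + l) ≤ k * d → (∀ a → a ∈ as → ∣ S a ∣ ≤ ℓ) → Spread S as d M →
    λ′ ^ suc (ℓ / r) * E k l N (#long S as (ℓ / r)) ≤ M * ((k + l) ^ N * 3 ^ suc (ℓ / r))
  E-#long S as k l d λ′ r M ℓ d>0 q≤p small spread = *-cancelˡ-≤ (r ^ ℓ) {{m^n≢0 r ℓ}} (begin
    r ^ ℓ * (λ′ ^ j * E k l N (#long S as (ℓ / r)))                    ≡⟨ cong (r ^ ℓ *_) (E-*ˡ k l N (λ′ ^ j)) ⟩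
    r ^ ℓ * E k l N (λ W → λ′ ^ j * #long S as (ℓ / r) W)              ≤⟨ *-monoʳ-≤ (r ^ ℓ) (E-mono k l N markov) ⟩
    r ^ ℓ * E k l N (λ W → ∑ as (λ a → λ′ ^ ∣ fragment S as W a ∣))    ≤⟨ fragment-moment S as k l d λ′ r M ℓ d>0 q≤p small spread ⟩
    M * ((k + l) ^ N * (1 + r) ^ ℓ)                                    ≤⟨ *-monoʳ-≤ M (*-monoʳ-≤ ((k + l) ^ N) ([1+r]^ℓ≤3^j*r^ℓ r j ℓ (m≤n*[1+m/n] ℓ r))) ⟩
    M * ((k + l) ^ N * (3 ^ j * r ^ ℓ))                                ≡⟨ lem M ((k + l) ^ N) (3 ^ j) (r ^ ℓ) ⟩
    r ^ ℓ * (M * ((k + l) ^ N * 3 ^ j))                                ∎)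
    where
    open ≤-Reasoning
    j = suc (ℓ / r)
    lem : ∀ a b c e → a * (b * (c * e)) ≡ e * (a * (b * c))
    lem = solve-∀
    markov : ∀ W → λ′ ^ j * #long S as (ℓ / r) W ≤ ∑ as (λ a → λ′ ^ ∣ fragment S as W a ∣)
    markov W = ≤-trans (≤-reflexive (∑-*ˡ (λ′ ^ j) as)) (∑-mono as λ a _ →
      ≤-trans (≤-reflexive (*-comm (λ′ ^ j) _)) (ι-guard (¬? (long? S as (ℓ / r) W a)) λ ¬le → ^-monoʳ-≤ λ′ (≰⇒> ¬le)))

  fails : (A → Subset N) → List A → Subset N → ℕ
  fails S as Z = ι (¬? (Any.any? (λ a → S a Subₚ.⊆? Z) as))

-- (k + l)^(N R) times the expectation of f at the union of R independent random subsets.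
rounds : (k l N R : ℕ) → (Subset N → ℕ) → ℕ
rounds k l N zero    f = f ∅
rounds k l N (suc R) f = E k l N (λ W → rounds k l N R (λ Y → f (W ∪ₛ Y)))

rounds-mono : ∀ k l N R {f g : Subset N → ℕ} → (∀ W → f W ≤ g W) → rounds k l N R f ≤ rounds k l N R g
rounds-mono k l N zero    h = h ∅
rounds-mono k l N (suc R) h = E-mono k l N λ W → rounds-mono k l N R λ Y → h (W ∪ₛ Y)

rounds-≤1 : ∀ k l N R {f : Subset N → ℕ} → (∀ W → f W ≤ 1) → rounds k l N R f ≤ ((k + l) ^ N) ^ R
rounds-≤1 k l N zero    h = h ∅
rounds-≤1 k l N (suc R) h = E-≤const k l N _ λ W → rounds-≤1 k l N R λ Y → h (W ∪ₛ Y)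

-- The choice λ′ = 6 turns 3 / λ′ into 1 / 2. With r constant and ℓ linear in n this is
-- exponentially small, although the density exceeds that of the spread by a constant factor only.
one-round : ∀ {A : Set} {N} (S : A → Subset N) as k l d r M ℓ .{{_ : NonZero r}} → 0 < d →
  6 * r * (k + l) ≤ k * d → (∀ a → a ∈ as → ∣ S a ∣ ≤ ℓ) → Spread S as d M →
  2 ^ suc (ℓ / r) * E k l N (#long S as (ℓ / r)) ≤ M * (k + l) ^ N
one-round {N = N} S as k l d r M ℓ d>0 q≤p small spread = *-cancelˡ-≤ (3 ^ j) {{m^n≢0 3 j}} (begin
  3 ^ j * (2 ^ j * E k l N (#long S as (ℓ / r)))   ≡⟨ *-assoc (3 ^ j) (2 ^ j) _ ⟨
  3 ^ j * 2 ^ j * E k l N (#long S as (ℓ / r))     ≡⟨ cong (_* E k l N (#long S as (ℓ / r))) (sym (^-distribʳ-* 3 2 j)) ⟩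
  6 ^ j * E k l N (#long S as (ℓ / r))             ≤⟨ E-#long S as k l d 6 r M ℓ d>0 q≤p small spread ⟩
  M * ((k + l) ^ N * 3 ^ j)                        ≡⟨ lem M ((k + l) ^ N) (3 ^ j) ⟩
  3 ^ j * (M * (k + l) ^ N)                        ∎)
  where
  open ≤-Reasoning
  j = suc (ℓ / r)
  lem : ∀ a b c → a * (b * c) ≡ c * (a * b)
  lem = solve-∀

-- Each round replaces the members by their short fragments and divides ℓ by r. Fragments are
-- subsets of members, so the new family is spread with the same `M` although it may be smaller;
-- hence `length as` and `M` are kept apart. Every round adds at most 3 / λ′ to the failure.
many-rounds : ∀ {A : Set} {N} k l d λ′ r .{{_ : NonZero r}} .{{_ : NonZero λ′}} → 0 < d → 3 ≤ λ′ → λ′ * r * (k + l) ≤ k * d →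
  ∀ R (S : A → Subset N) as M ℓ → ℓ < r ^ R → (∀ a → a ∈ as → ∣ S a ∣ ≤ ℓ) → Spread S as d M →
  λ′ * (length as * rounds k l N R (fails S as)) ≤ 3 * R * ((k + l) ^ N) ^ R * M
many-rounds {N = N} k l d λ′ r d>0 3≤λ q≤p zero S [] M ℓ ℓ<1 small spread = ≤-reflexive (*-zeroʳ λ′)
-- Here ℓ < r ^ 0 = 1, so the members are empty and already lie in ∅.
many-rounds {N = N} k l d λ′ r d>0 3≤λ q≤p zero S as@(a ∷ _) M ℓ ℓ<1 small spread =
  ≤-trans (≤-reflexive (trans (cong (λ z → λ′ * (length as * z)) (ι-no (¬? (Any.any? (λ a → S a Subₚ.⊆? ∅) as)) λ ¬any → ¬any (here empty)))
    (trans (cong (λ′ *_) (*-zeroʳ (length as))) (*-zeroʳ λ′)))) z≤n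
  where
  empty : S a ⊆ₛ ∅
  empty = ⊆∧∣∣≥⇒⊇ Subₚ.⊥⊆ (≤-trans (small a (here refl)) (≤-trans (s≤s⁻¹ ℓ<1) z≤n))
many-rounds {A} {N} k l d λ′ r d>0 3≤λ q≤p (suc R) S as M ℓ ℓ< small spread = begin
  λ′ * (length as * E k l N (λ W → V W))                 ≡⟨ trans (cong (λ′ *_) (E-*ˡ k l N (length as))) (E-*ˡ k l N λ′) ⟩
  E k l N (λ W → λ′ * (length as * V W))                 ≤⟨ E-mono k l N step ⟩
  E k l N (λ W → B ^ R * (λ′ * #long S as ℓ′ W) + 3 * R * B ^ R * M)  ≡⟨ E-+ k l N ⟩
  E k l N (λ W → B ^ R * (λ′ * #long S as ℓ′ W)) + E k l N (λ _ → 3 * R * B ^ R * M)  ≡⟨ cong₂ _+_ (trans (cong (B ^ R *_) (E-*ˡ k l N λ′)) (E-*ˡ k l N (B ^ R))) (sym (E-const k l N _)) ⟨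
  B ^ R * (λ′ * E k l N (#long S as ℓ′)) + B * (3 * R * B ^ R * M)  ≤⟨ +-monoˡ-≤ _ (*-monoʳ-≤ (B ^ R) longs) ⟩
  B ^ R * (3 * (M * B)) + B * (3 * R * B ^ R * M)        ≡⟨ lem (B ^ R) M B R ⟩
  3 * suc R * (B * B ^ R) * M                            ∎
  where
  open ≤-Reasoning
  B = (k + l) ^ N
  ℓ′ = ℓ / r
  V : Subset N → ℕ
  V W = rounds k l N R (λ Y → fails S as (W ∪ₛ Y))
  lem : ∀ q M B R → q * (3 * (M * B)) + B * (3 * R * q * M) ≡ 3 * suc R * (B * q) * M
  lem = solve-∀
  -- Only one factor 3 / λ′ of the power is kept. That is enough because λ′ will tend to infinity,
  -- and it is uniform in ℓ.
  longs : λ′ * E k l N (#long S as ℓ′) ≤ 3 * (M * B)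
  longs = *-cancelˡ-≤ (3 ^ ℓ′) {{m^n≢0 3 ℓ′}} (begin
    3 ^ ℓ′ * (λ′ * E k l N (#long S as ℓ′))    ≤⟨ *-monoˡ-≤ _ (^-monoˡ-≤ ℓ′ 3≤λ) ⟩
    λ′ ^ ℓ′ * (λ′ * E k l N (#long S as ℓ′))   ≡⟨ lem₁ (λ′ ^ ℓ′) λ′ _ ⟩
    λ′ ^ suc ℓ′ * E k l N (#long S as ℓ′)      ≤⟨ E-#long S as k l d λ′ r M ℓ d>0 q≤p small spread ⟩
    M * (B * (3 * 3 ^ ℓ′))                     ≡⟨ lem₂ M B (3 ^ ℓ′) ⟩
    3 ^ ℓ′ * (3 * (M * B))                     ∎)
    where
    lem₁ : ∀ a b c → a * (b * c) ≡ b * a * c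
    lem₁ = solve-∀
    lem₂ : ∀ a b c → a * (b * (3 * c)) ≡ c * (3 * (a * b))
    lem₂ = solve-∀
  step : ∀ W → λ′ * (length as * V W) ≤ B ^ R * (λ′ * #long S as ℓ′ W) + 3 * R * B ^ R * M
  step W = begin
    λ′ * (length as * V W)                                       ≡⟨ cong (λ z → λ′ * (z * V W)) parts ⟩
    -- For members with a long fragment the conditional failure is bounded by 1; for the others, a
    -- fragment found in the later rounds completes a member of the present family.
    λ′ * ((#long S as ℓ′ W + length short) * V W)                ≡⟨ lem₃ λ′ (#long S as ℓ′ W) (length short) (V W) ⟩
    V W * (λ′ * #long S as ℓ′ W) + λ′ * (length short * V W)     ≤⟨ +-mono-≤ (*-monoˡ-≤ _ (rounds-≤1 k l N R λ Y → ι≤1 (¬? (Any.any? (λ a → S a Subₚ.⊆? (W ∪ₛ Y)) as)))) (*-monoʳ-≤ λ′ (*-monoʳ-≤ (length short) (rounds-mono k l N R descend))) ⟩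
    B ^ R * (λ′ * #long S as ℓ′ W) + λ′ * (length short * rounds k l N R (fails (fragment S as W) short))  ≤⟨ +-monoʳ-≤ (B ^ R * (λ′ * #long S as ℓ′ W)) (many-rounds k l d λ′ r d>0 3≤λ q≤p R (fragment S as W) short M ℓ′ (m<n*o⇒m/o<n (subst (ℓ <_) (*-comm r (r ^ R)) ℓ<)) small′ spread′) ⟩
    B ^ R * (λ′ * #long S as ℓ′ W) + 3 * R * B ^ R * M           ∎
    where
    short : List A
    short = filter (long? S as ℓ′ W) as
    lem₃ : ∀ a b c e → a * ((b + c) * e) ≡ e * (a * b) + a * (c * e)
    lem₃ = solve-∀
    parts : length as ≡ #long S as ℓ′ W + length short
    parts = trans (sym (∑-length as)) (trans (∑-cong as λ a _ → trans (sym (ι-¬? (long? S as ℓ′ W a))) (+-comm (ι (long? S as ℓ′ W a)) _))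
      (trans (∑-+ as) (cong (#long S as ℓ′ W +_) (sym (length-filter≡∑ (long? S as ℓ′ W) as)))))
    short⁻ : ∀ {a} → a ∈ short → a ∈ as × ∣ fragment S as W a ∣ ≤ ℓ′
    short⁻ = ∈ₚ.∈-filter⁻ (long? S as ℓ′ W) {xs = as}
    small′ : ∀ a → a ∈ short → ∣ fragment S as W a ∣ ≤ ℓ′
    small′ a m = proj₂ (short⁻ m)
    spread′ : Spread (fragment S as W) short d M
    spread′ T = ≤-trans (*-monoˡ-≤ (d ^ ∣ T ∣) (begin
      ∑ short (λ a → ι (T Subₚ.⊆? fragment S as W a))                         ≡⟨ ∑-filter (long? S as ℓ′ W) as ⟩
      ∑ as (λ a → ι (long? S as ℓ′ W a) * ι (T Subₚ.⊆? fragment S as W a))    ≤⟨ ∑-mono as (λ a m → ι-guard (long? S as ℓ′ W a) λ _ → ι-mono (T Subₚ.⊆? fragment S as W a) (T Subₚ.⊆? S a) λ sub → Subₚ.⊆-trans sub (fragment⊆ S as W m)) ⟩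
      ∑ as (λ a → ι (T Subₚ.⊆? S a))                                          ∎)) (spread T)
    descend : ∀ Y → fails S as (W ∪ₛ Y) ≤ fails (fragment S as W) short Y
    descend Y = ι-mono (¬? (Any.any? (λ a → S a Subₚ.⊆? (W ∪ₛ Y)) as)) (¬? (Any.any? (λ a → fragment S as W a Subₚ.⊆? Y) short)) λ none some → none (lift some)
      where
      lift : Any (λ a → fragment S as W a ⊆ₛ Y) short → Any (λ a → S a ⊆ₛ W ∪ₛ Y) as
      lift some = let a , m , sub = find some in lose (proj₁ (bestFor-∈ S as W (proj₁ (short⁻ m)))) (─-split S as sub)

-- Exploring a graph component by component

allFin-unique : ∀ n → Unique (allFin n)
allFin-unique n = Uniqueₚ.allFin⁺ n

length≤n : ∀ {n} (xs : List (Fin n)) → Unique xs → length xs ≤ n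
length≤n {n} xs u = subst (length xs ≤_) (Listₚ.length-tabulate id) (length-mono (allFin n) xs (allFin-unique n) u (λ {x} _ → ∈ₚ.∈-allFin x))

Unique-++⁻ʳ : ∀ {A : Set} (xs : List A) {ys} → Unique (xs ++ ys) → Unique ys
Unique-++⁻ʳ []       u       = u
Unique-++⁻ʳ (x ∷ xs) (_ ∷ u) = Unique-++⁻ʳ xs u

Unique-++⁻ˡ : ∀ {A : Set} (xs : List A) {ys} → Unique (xs ++ ys) → Unique xs
Unique-++⁻ˡ []       u       = []
Unique-++⁻ˡ (x ∷ xs) (a ∷ u) = Allₚ.++⁻ˡ xs a ∷ Unique-++⁻ˡ xs u

Unique-++-disjoint : ∀ {A : Set} (xs : List A) {ys x} → Unique (xs ++ ys) → x ∈ xs → x ∉ ys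
Unique-++-disjoint (x ∷ xs) (a ∷ u) (here refl) m = All.lookup a (∈ₚ.∈-++⁺ʳ xs m) refl
Unique-++-disjoint (x ∷ xs) (a ∷ u) (there p)   m = Unique-++-disjoint xs u p m

∉⇒All≢ : ∀ {A : Set} {x : A} {xs} → x ∉ xs → All (λ y → x ≢ y) xs
∉⇒All≢ h = All.tabulate λ { m refl → h m }

neighbours : ∀ {n} → Adj n → Fin n → List (Fin n)
neighbours {n} A v = filter (λ u → A v u ≟ᵇ true) (allFin n)

module _ {n : ℕ} (A : Adj n) where

  ∈-neighbours⁺ : ∀ {v u} → A v u ≡ true → u ∈ neighbours A v
  ∈-neighbours⁺ {v} {u} e = ∈ₚ.∈-filter⁺ (λ u → A v u ≟ᵇ true) (∈ₚ.∈-allFin u) e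

  ∈-neighbours⁻ : ∀ {v u} → u ∈ neighbours A v → A v u ≡ true
  ∈-neighbours⁻ {v} m = proj₂ (∈ₚ.∈-filter⁻ (λ u → A v u ≟ᵇ true) {xs = allFin n} m)

  neighbours-unique : ∀ v → Unique (neighbours A v)
  neighbours-unique v = Uniqueₚ.filter⁺ (λ u → A v u ≟ᵇ true) (allFin-unique n)

  -- ρ roots and ν further vertices, each adjacent to an earlier one.
  data Forest : List (Fin n) → ℕ → ℕ → Set where
    nil   : Forest [] 0 0
    root  : ∀ {L ρ ν v} → Forest L ρ ν → v ∉ L → Forest (v ∷ L) (suc ρ) ν
    child : ∀ {L ρ ν u v} → Forest L ρ ν → v ∉ L → u ∈ L → A u v ≡ true → Forest (v ∷ L) ρ (suc ν)

  forest-unique : ∀ {L ρ ν} → Forest L ρ ν → Unique L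
  forest-unique nil              = []
  forest-unique (root f ∉)       = ∉⇒All≢ ∉ ∷ forest-unique f
  forest-unique (child f ∉ _ _)  = ∉⇒All≢ ∉ ∷ forest-unique f

  forest-length : ∀ {L ρ ν} → Forest L ρ ν → length L ≡ ρ + ν
  forest-length nil = refl
  forest-length (root f _) = cong suc (forest-length f)
  forest-length (child {ρ = ρ} {ν} f _ _ _) = trans (cong suc (forest-length f)) (sym (+-suc ρ ν))

  Closed : List (Fin n) → Set
  Closed K = ∀ {u w} → u ∈ K → A u w ≡ true → w ∈ K

  -- 2 α e(K) ≤ β (v(K) - 1) for every component K with at least one edge.
  LocallySparse : ℕ → ℕ → Set
  LocallySparse α β = ∀ K c → Unique K → length K ≡ suc (suc c) → Closed K → α * ∑ K (degree A) ≤ β * suc c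

  -- The state after some whole components with edges have been explored. Such a component has a
  -- child besides its root; `roots≤` records this, so that constants due to roots can later be
  -- charged to children.
  record Exploration (α β : ℕ) (L : List (Fin n)) : Set where
    field
      {ρ ν}       : ℕ
      forest      : Forest L ρ ν
      roots≤      : ρ ≤ ν
      closed      : Closed L
      sparse      : α * ∑ L (degree A) ≤ β * ν
      nonisolated : ∀ {v} → v ∈ L → ∃[ w ] A v w ≡ true

  module _ (symA : ∀ u v → A u v ≡ A v u) (irr : ∀ u → A u u ≡ false) where

    abstract
      explore : ∀ {α β} → LocallySparse α β → ∃[ L ] Σ (Exploration α β L) λ X → α * ∑ (allFin n) (degree A) ≤ β * Exploration.ν X
      explore {α} {β} local = outer n [] start (≤-reflexive (sym (+-identityʳ n)))
        where
        start : Exploration α β []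
        start = record { forest = nil ; roots≤ = z≤n ; closed = λ () ; sparse = ≤-reflexive (trans (*-zeroʳ α) (sym (*-zeroʳ β))) ; nonisolated = λ () }

        -- `f` bounds the number of vertices outside K ++ D. It cannot run out while the component
        -- still grows, since a further vertex would give more than n distinct ones.
        component : ∀ {D} (X : Exploration α β D) → let open Exploration X in
          ∀ f K c → Forest (K ++ D) (suc ρ) (ν + c) → length K ≡ suc c → n ≤ f + length (K ++ D) →
          (∀ {v} → v ∈ K → ∃[ w ] A v w ≡ true) → ∃[ K′ ] Exploration α β (K′ ++ D) × 1 ≤ length K′
        component {D} X f K c F len fuel noniso with searchList (λ u → Any.any? (λ w → ((w ∉? (K ++ D)) ×-dec (A u w ≟ᵇ true))) (allFin n)) K
        ... | inj₁ (u , u∈ , some) = extend f fuel (find some)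
          where
          extend : ∀ f → n ≤ f + length (K ++ D) → ∃[ w ] w ∈ allFin n × (w ∉ (K ++ D)) × A u w ≡ true → ∃[ K′ ] Exploration α β (K′ ++ D) × 1 ≤ length K′
          extend zero fuel (w , _ , w∉ , e) = contradiction (length≤n (w ∷ K ++ D) (forest-unique (child F w∉ (∈ₚ.∈-++⁺ˡ u∈) e))) (<⇒≱ (s≤s fuel))
          extend (suc f) fuel (w , _ , w∉ , e) = component X f (w ∷ K) (suc c) (subst (Forest _ _) (sym (+-suc _ c)) (child F w∉ (∈ₚ.∈-++⁺ˡ u∈) e)) (cong suc len)
            (subst (n ≤_) (sym (+-suc f _)) fuel) λ { (here refl) → u , trans (symA w u) e ; (there m) → noniso m }
        ... | inj₂ none = K , finish K c F len noniso closedK , subst (1 ≤_) (sym len) (s≤s z≤n)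
          where
          open Exploration X
          closed-++ : ∀ {u w} → u ∈ K → A u w ≡ true → w ∈ K ++ D
          closed-++ {u} {w} u∈ e with w ∈? (K ++ D)
          ... | yes m = m
          ... | no w∉ = contradiction (Any.map (λ { refl → w∉ , e }) (∈ₚ.∈-allFin w)) (none u u∈)
          closedK : ∀ {u w} → u ∈ K → A u w ≡ true → w ∈ K
          closedK {u} {w} u∈ e with ∈ₚ.∈-++⁻ K (closed-++ u∈ e)
          ... | inj₁ m = m
          ... | inj₂ m = contradiction (closed m (trans (symA w u) e)) (Unique-++-disjoint K (forest-unique F) u∈)
          finish : ∀ K c → Forest (K ++ D) (suc ρ) (ν + c) → length K ≡ suc c → (∀ {v} → v ∈ K → ∃[ w ] A v w ≡ true) → Closed K → Exploration α β (K ++ D)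
          finish [] c F () noniso cl
          -- A closed set of one non-isolated vertex would carry a loop.
          finish (v ∷ []) c F len noniso cl with noniso (here refl)
          ... | w , e with cl (here refl) e
          ...   | here refl = case trans (sym e) (irr v) of λ ()
          finish K@(_ ∷ _ ∷ _) (suc c) F len noniso cl = record
            { forest = F
            ; roots≤ = subst (suc ρ ≤_) (sym (+-suc ν c)) (s≤s (≤-trans roots≤ (m≤m+n ν c)))
            ; closed = λ {u} u∈ e → case ∈ₚ.∈-++⁻ K u∈ of λ { (inj₁ m) → ∈ₚ.∈-++⁺ˡ (cl m e) ; (inj₂ m) → ∈ₚ.∈-++⁺ʳ K (closed m e) }
            ; sparse = begin
                α * ∑ (K ++ D) (degree A)                  ≡⟨ cong (α *_) (∑-++ K D) ⟩
                α * (∑ K (degree A) + ∑ D (degree A))      ≡⟨ *-distribˡ-+ α _ _ ⟩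
                α * ∑ K (degree A) + α * ∑ D (degree A)    ≤⟨ +-mono-≤ (local K c (Unique-++⁻ˡ K (forest-unique F)) len cl) sparse ⟩
                β * suc c + β * ν                          ≡⟨ trans (sym (*-distribˡ-+ β (suc c) ν)) (cong (β *_) (+-comm (suc c) ν)) ⟩
                β * (ν + suc c)                            ∎
            ; nonisolated = λ {v} v∈ → case ∈ₚ.∈-++⁻ K v∈ of λ { (inj₁ m) → noniso m ; (inj₂ m) → nonisolated m }
            }
            where open ≤-Reasoning

        outer : ∀ f L → (X : Exploration α β L) → n ≤ f + length L →
                ∃[ L ] Σ (Exploration α β L) λ X → α * ∑ (allFin n) (degree A) ≤ β * Exploration.ν X
        outer f L X fuel with searchList (λ v → (v ∉? L) ×-dec Any.any? (λ w → A v w ≟ᵇ true) (allFin n)) (allFin n)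
        ... | inj₂ none = L , X , ≤-trans (*-monoʳ-≤ α (≤-reflexive (begin
            ∑ (allFin n) (degree A)                             ≡⟨ ∑-∖ (allFin n) L (degree A) (allFin-unique n) (forest-unique forest) (λ {x} _ → ∈ₚ.∈-allFin x) ⟩
            ∑ L (degree A) + ∑ (allFin n ∖ L) (degree A)        ≡⟨ cong (∑ L (degree A) +_) (∑-zero (allFin n ∖ L) isolated) ⟩
            ∑ L (degree A) + 0                                  ≡⟨ +-identityʳ _ ⟩
            ∑ L (degree A)                                      ∎))) sparse
          where
          open Exploration X
          open ≡-Reasoning
          isolated : ∀ v → v ∈ allFin n ∖ L → degree A v ≡ 0
          isolated v m = cong length (Listₚ.filter-none (λ u → A v u ≟ᵇ true) (All.tabulate λ {u} u∈ e →
            none v (∈ₚ.∈-allFin v) (proj₂ (∈-∖⁻ (allFin n) m) , Any.map (λ { refl → e }) u∈)))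
        ... | inj₁ (v , _ , v∉ , some) with f
        ...   | zero = contradiction (length≤n (v ∷ L) (∉⇒All≢ v∉ ∷ forest-unique (Exploration.forest X))) (<⇒≱ (s≤s fuel))
        ...   | suc f with component X n (v ∷ []) 0 (subst (Forest _ _) (sym (+-identityʳ _)) (root (Exploration.forest X) v∉)) refl (m≤m+n n _)
                             (λ { (here refl) → let w , _ , e = find some in w , e })
        ...     | K , X′ , 1≤ = outer f (K ++ L) X′ (begin
                    n                                ≤⟨ fuel ⟩
                    suc f + length L                 ≡⟨ +-suc f (length L) ⟨
                    f + (1 + length L)               ≤⟨ +-monoʳ-≤ f (+-monoˡ-≤ (length L) 1≤) ⟩
                    f + (length K + length L)        ≡⟨ cong (f +_) (Listₚ.length-++ K) ⟨
                    f + length (K ++ L)              ∎)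
          where open ≤-Reasoning

    closed-neighbours : ∀ {K v} → Closed K → v ∈ K → ∀ {x} → x ∈ v ∷ neighbours A v → x ∈ K
    closed-neighbours cl v∈ (here refl) = v∈
    closed-neighbours cl v∈ (there m)   = cl v∈ (∈-neighbours⁻ m)

    closed-unique : ∀ v → Unique (v ∷ neighbours A v)
    closed-unique v = ∉⇒All≢ (λ m → case trans (sym (∈-neighbours⁻ m)) (irr v) of λ ()) ∷ neighbours-unique v

    degree<∣closed∣ : ∀ {K v} → Unique K → Closed K → v ∈ K → suc (degree A v) ≤ length K
    degree<∣closed∣ {K} {v} u cl v∈ = length-mono K (v ∷ neighbours A v) u (closed-unique v) (closed-neighbours cl v∈)

    module _ (Δ : ℕ) (maxdeg : MaxDegreeAtMost A Δ) where

      private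
        ∑deg≤Δ : ∀ K → ∑ K (degree A) ≤ length K * Δ
        ∑deg≤Δ K = ∑-≤const K λ v _ → maxdeg v
        ∑deg≤∣K∣ : ∀ {K c} → Unique K → length K ≡ suc c → Closed K → ∑ K (degree A) ≤ length K * c
        ∑deg≤∣K∣ {K} {c} u len cl = ∑-≤const K λ v m → s≤s⁻¹ (subst (suc (degree A v) ≤_) len (degree<∣closed∣ u cl m))

      -- In a component with v vertices all degrees are at most min(v - 1, Δ), and v min(v - 1, Δ) ≤
      -- (Δ + 1)(v - 1), with equality at v = Δ + 1: cliques are the extremal case.
      maxdeg⇒sparse : LocallySparse 1 (suc Δ)
      maxdeg⇒sparse K c u len cl = subst (_≤ suc Δ * suc c) (sym (*-identityˡ _)) go
        where
        go : ∑ K (degree A) ≤ suc Δ * suc c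
        go with suc c ≤? Δ
        ... | yes c≤ = ≤-trans (∑deg≤∣K∣ u len cl) (*-monoˡ-≤ (suc c) (subst (_≤ suc Δ) (sym len) (s≤s c≤)))
        ... | no c≰ = ≤-trans (∑deg≤Δ K) (subst (λ z → z * Δ ≤ suc Δ * suc c) (sym len) (≤-trans
            (+-monoˡ-≤ (suc c * Δ) (≤-trans (n≤1+n Δ) (≰⇒> c≰))) (≤-reflexive (cong (suc c +_) (*-comm (suc c) Δ)))))

      -- The same degree bounds, split by v - 1 against Δ. For v ≤ Δ there is room; for v ≥ Δ + 2
      -- the constant Δ(Δ + 2) / (Δ + 1) comes from the case v = Δ + 2, where it is sharp. For v = Δ
      -- + 1 some vertex has degree below Δ, and this single missing unit suffices, with 1 to spare.
      cliqueFree⇒sparse : (∀ K → Unique K → length K ≡ suc Δ → ¬ (∀ u v → u ∈ K → v ∈ K → u ≢ v → A u v ≡ true)) →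
                          LocallySparse (suc Δ) (Δ * suc (suc Δ))
      cliqueFree⇒sparse free K c u len cl with <-cmp (suc c) Δ
      ... | tri< c< _ _ = begin
          suc Δ * ∑ K (degree A)           ≤⟨ *-monoʳ-≤ (suc Δ) (∑deg≤∣K∣ u len cl) ⟩
          suc Δ * (length K * suc c)       ≤⟨ *-monoʳ-≤ (suc Δ) (*-monoˡ-≤ (suc c) (subst (_≤ Δ) (sym len) c<)) ⟩
          suc Δ * (Δ * suc c)              ≤⟨ *-monoˡ-≤ (Δ * suc c) (n≤1+n (suc Δ)) ⟩
          suc (suc Δ) * (Δ * suc c)        ≡⟨ lem Δ (suc c) ⟩
          Δ * suc (suc Δ) * suc c          ∎
        where
        open ≤-Reasoning
        lem : ∀ Δ c → (2 + Δ) * (Δ * c) ≡ Δ * (2 + Δ) * c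
        lem = solve-∀
      ... | tri> _ _ c> = begin
          suc Δ * ∑ K (degree A)           ≤⟨ *-monoʳ-≤ (suc Δ) (∑deg≤Δ K) ⟩
          suc Δ * (length K * Δ)           ≡⟨ cong (λ z → suc Δ * (z * Δ)) len ⟩
          suc Δ * ((1 + suc c) * Δ)        ≡⟨ lem Δ (suc c) ⟩
          Δ * (suc Δ + suc Δ * suc c)      ≤⟨ *-monoʳ-≤ Δ (+-monoˡ-≤ (suc Δ * suc c) c>) ⟩
          Δ * (suc c + suc Δ * suc c)      ≡⟨ *-assoc Δ (suc (suc Δ)) (suc c) ⟨
          Δ * suc (suc Δ) * suc c          ∎
        where
        open ≤-Reasoning
        lem : ∀ Δ c → (1 + Δ) * ((1 + c) * Δ) ≡ Δ * (1 + Δ + (1 + Δ) * c)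
        lem = solve-∀
      ... | tri≈ _ refl _ with searchList (λ v → degree A v <? Δ) K
      ...   | inj₂ none = contradiction clique (free K u len)
        where
        clique : ∀ v w → v ∈ K → w ∈ K → v ≢ w → A v w ≡ true
        clique v w v∈ w∈ v≢w with w ∈? (v ∷ neighbours A v)
        ... | yes (here refl) = contradiction refl v≢w
        ... | yes (there m)   = ∈-neighbours⁻ m
        ... | no w∉ = contradiction (begin
            suc (length K)                              ≡⟨ cong suc len ⟩
            2 + Δ                                       ≤⟨ s≤s (s≤s (≮⇒≥ (none v v∈))) ⟩
            length (w ∷ v ∷ neighbours A v)             ≤⟨ length-mono K _ u (∉⇒All≢ w∉ ∷ closed-unique v) (λ { (here refl) → w∈ ; (there m) → closed-neighbours cl v∈ m }) ⟩
            length K                                    ∎) (<-irrefl refl)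
          where open ≤-Reasoning
      ...   | inj₁ (v , v∈ , deg<) = +-cancelʳ-≤ (suc Δ) _ _ (begin
          suc Δ * ∑ K (degree A) + suc Δ              ≡⟨ lem₁ (suc Δ) (∑ K (degree A)) ⟩
          suc Δ * (1 + ∑ K (degree A))                ≤⟨ *-monoʳ-≤ (suc Δ) short-sum ⟩
          suc Δ * (suc Δ * Δ)                         ≤⟨ n≤1+n _ ⟩
          1 + suc Δ * (suc Δ * Δ)                     ≡⟨ lem₂ Δ ⟩
          Δ * suc (suc Δ) * Δ + suc Δ                 ∎)
        where
        open ≤-Reasoning
        lem₁ : ∀ a b → a * b + a ≡ a * (1 + b)
        lem₁ = solve-∀
        lem₂ : ∀ Δ → 1 + (1 + Δ) * ((1 + Δ) * Δ) ≡ Δ * (2 + Δ) * Δ + (1 + Δ)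
        lem₂ = solve-∀
        short-sum : 1 + ∑ K (degree A) ≤ suc Δ * Δ
        short-sum = subst (λ z → 1 + ∑ K (degree A) ≤ z * Δ) len (∑< K v∈)
          where
          ∑< : ∀ K → v ∈ K → 1 + ∑ K (degree A) ≤ length K * Δ
          ∑< (x ∷ K) (here refl) = +-mono-≤ deg< (∑deg≤Δ K)
          ∑< (x ∷ K) (there m) = subst (_≤ length (x ∷ K) * Δ) (+-suc (degree A x) _) (+-mono-≤ (maxdeg x) (∑< K m))

-- Outcomes as graphs

∧-true⁻ : ∀ {a b} → a ∧ b ≡ true → a ≡ true × b ≡ true
∧-true⁻ {true} {true} refl = refl , refl

∨-true⁻ : ∀ {a b} → a ∨ b ≡ true → a ≡ true ⊎ b ≡ true
∨-true⁻ {true}  e = inj₁ refl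
∨-true⁻ {false} e = inj₂ e

⌊⌋-true⁻ : ∀ {P : Set} (d : Dec P) → ⌊ d ⌋ ≡ true → P
⌊⌋-true⁻ (yes p) _ = p

⌊⌋-true⁺ : ∀ {P : Set} (d : Dec P) → P → ⌊ d ⌋ ≡ true
⌊⌋-true⁺ (yes _) _ = refl
⌊⌋-true⁺ (no ¬p) p = contradiction p ¬p

module _ {B : Set} where

  any-zip⁻ : ∀ (p : B × Bool → Bool) (ps : List B) (T : Subset (length ps)) →
             any p (zip ps (Vec.toList T)) ≡ true → ∃[ e ] p (List.lookup ps e , Vec.lookup T e) ≡ true
  any-zip⁻ p (b ∷ ps) (x ∷ T) h with p (b , x) in eq
  ... | true  = zero , eq
  ... | false = let e , q = any-zip⁻ p ps T h in suc e , q

  any-zip⁺ : ∀ (p : B × Bool → Bool) (ps : List B) (T : Subset (length ps)) e →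
             p (List.lookup ps e , Vec.lookup T e) ≡ true → any p (zip ps (Vec.toList T)) ≡ true
  any-zip⁺ p (b ∷ ps) (x ∷ T) zero    h rewrite h = refl
  any-zip⁺ p (b ∷ ps) (x ∷ T) (suc e) h rewrite any-zip⁺ p ps T e h = ∨-zeroʳ (p (b , x))

  ∣∣≤∑ : ∀ (ps : List B) (T : Subset (length ps)) (g : B → ℕ) →
         (∀ e → e ∈ₛ T → 1 ≤ g (List.lookup ps e)) → ∣ T ∣ ≤ ∑ ps g
  ∣∣≤∑ []       []          g h = z≤n
  ∣∣≤∑ (b ∷ ps) (true ∷ T)  g h = +-mono-≤ (h zero Vec.here) (∣∣≤∑ ps T g λ e m → h (suc e) (Vec.there m))
  ∣∣≤∑ (b ∷ ps) (false ∷ T) g h = ≤-trans (∣∣≤∑ ps T g λ e m → h (suc e) (Vec.there m)) (m≤n+m _ (g b))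

module _ {n : ℕ} where

  -- `Outcome n` unfolds to `Subset (length (pairs n))`, so the results on random subsets apply to
  -- outcomes directly; `pairAt` turns an element of the ground set back into a pair of vertices.
  pairAt : Fin (length (pairs n)) → Fin n × Fin n
  pairAt = List.lookup (pairs n)

  pairs-< : ∀ {i j} → (i , j) ∈ pairs n → i Fin.< j
  pairs-< {i} {j} m with find (∈ₚ.∈-concatMap⁻ (λ i → map (λ j → (i , j)) (filter (λ j → i Finₚ.<? j) (allFin n))) {xs = allFin n} m)
  ... | i′ , _ , m′ with ∈ₚ.∈-map⁻ (λ j → (i′ , j)) m′
  ...   | j′ , m″ , refl = proj₂ (∈ₚ.∈-filter⁻ (λ j → i′ Finₚ.<? j) {xs = allFin n} m″)

  pairs-∈ : ∀ {i j} → i Fin.< j → (i , j) ∈ pairs n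
  pairs-∈ {i} {j} i<j = ∈ₚ.∈-concatMap⁺ (λ i → map (λ j → (i , j)) (filter (λ j → i Finₚ.<? j) (allFin n)))
    (lose (∈ₚ.∈-allFin i) (∈ₚ.∈-map⁺ (λ j → (i , j)) (∈ₚ.∈-filter⁺ (λ j → i Finₚ.<? j) (∈ₚ.∈-allFin j) i<j)))

  pairAt-< : ∀ {e i j} → pairAt e ≡ (i , j) → i Fin.< j
  pairAt-< {e} eq = pairs-< (subst (_∈ pairs n) eq (∈ₚ.∈-lookup e))

  indexOf : ∀ {i j} → i Fin.< j → ∃[ e ] pairAt e ≡ (i , j)
  indexOf i<j = Any.index (pairs-∈ i<j) , sym (Anyₚ.lookup-index (pairs-∈ i<j))

  Joins : Fin (length (pairs n)) → Fin n → Fin n → Set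
  Joins e i j = pairAt e ≡ (i , j) ⊎ pairAt e ≡ (j , i)

  joins : ∀ {i j} → i ≢ j → ∃[ e ] Joins e i j
  joins {i} {j} i≢j with Finₚ.<-cmp i j
  ... | tri< i<j _ _ = let e , q = indexOf i<j in e , inj₁ q
  ... | tri≈ _ eq _  = contradiction eq i≢j
  ... | tri> _ _ j<i = let e , q = indexOf j<i in e , inj₂ q

  outcomeGraph⁻ : ∀ (T : Outcome n) {i j} → outcomeGraph {n} T i j ≡ true → ∃[ e ] e ∈ₛ T × Joins e i j
  outcomeGraph⁻ T {i} {j} h with any-zip⁻ _ (pairs n) T h
  ... | e , q with ∧-true⁻ {Vec.lookup T e} q
  ...   | inT , r with ∨-true⁻ r
  ...     | inj₁ r₁ = let a , b = ∧-true⁻ r₁ in e , Vecₚ.lookup⇒[]= e T inT ,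
              inj₁ (cong₂ _,_ (⌊⌋-true⁻ (proj₁ (pairAt e) Finₚ.≟ i) a) (⌊⌋-true⁻ (proj₂ (pairAt e) Finₚ.≟ j) b))
  ...     | inj₂ r₂ = let a , b = ∧-true⁻ r₂ in e , Vecₚ.lookup⇒[]= e T inT ,
              inj₂ (cong₂ _,_ (⌊⌋-true⁻ (proj₁ (pairAt e) Finₚ.≟ j) a) (⌊⌋-true⁻ (proj₂ (pairAt e) Finₚ.≟ i) b))

  outcomeGraph⁺ : ∀ (T : Outcome n) {i j} e → e ∈ₛ T → Joins e i j → outcomeGraph {n} T i j ≡ true
  outcomeGraph⁺ T {i} {j} e e∈ J = any-zip⁺ _ (pairs n) T e (matches J)
    where
    matches : Joins e i j → Vec.lookup T e ∧ ((⌊ proj₁ (pairAt e) Finₚ.≟ i ⌋ ∧ ⌊ proj₂ (pairAt e) Finₚ.≟ j ⌋) ∨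
                              (⌊ proj₁ (pairAt e) Finₚ.≟ j ⌋ ∧ ⌊ proj₂ (pairAt e) Finₚ.≟ i ⌋)) ≡ true
    matches J rewrite Vecₚ.[]=⇒lookup e∈ with J
    ... | inj₁ q rewrite ⌊⌋-true⁺ (proj₁ (pairAt e) Finₚ.≟ i) (cong proj₁ q) | ⌊⌋-true⁺ (proj₂ (pairAt e) Finₚ.≟ j) (cong proj₂ q) = refl
    ... | inj₂ q rewrite ⌊⌋-true⁺ (proj₁ (pairAt e) Finₚ.≟ j) (cong proj₁ q) | ⌊⌋-true⁺ (proj₂ (pairAt e) Finₚ.≟ i) (cong proj₂ q) = ∨-zeroʳ _

  outcomeGraph-mono : ∀ {T T′ : Outcome n} {i j} → T ⊆ₛ T′ → outcomeGraph {n} T i j ≡ true → outcomeGraph {n} T′ i j ≡ true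
  outcomeGraph-mono {T} {T′} sub h = let e , e∈ , J = outcomeGraph⁻ T h in outcomeGraph⁺ T′ e (sub e∈) J

  ≡true-antisym : ∀ {a b} → (a ≡ true → b ≡ true) → (b ≡ true → a ≡ true) → a ≡ b
  ≡true-antisym {true}  {b}     f g = sym (f refl)
  ≡true-antisym {false} {true}  f g = g refl
  ≡true-antisym {false} {false} f g = refl

  outcomeGraph-sym : ∀ (T : Outcome n) i j → outcomeGraph {n} T i j ≡ outcomeGraph {n} T j i
  outcomeGraph-sym T i j = ≡true-antisym swap swap
    where
    swap : ∀ {i j} → outcomeGraph {n} T i j ≡ true → outcomeGraph {n} T j i ≡ true
    swap h with outcomeGraph⁻ T h
    ... | e , e∈ , inj₁ q = outcomeGraph⁺ T e e∈ (inj₂ q)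
    ... | e , e∈ , inj₂ q = outcomeGraph⁺ T e e∈ (inj₁ q)

  outcomeGraph-irr : ∀ (T : Outcome n) i → outcomeGraph {n} T i i ≡ false
  outcomeGraph-irr T i with outcomeGraph {n} T i i in eq
  ... | false = refl
  ... | true with outcomeGraph⁻ T eq
  ...   | e , _ , inj₁ q = contradiction (pairAt-< {e} q) (Finₚ.<-irrefl refl)
  ...   | e , _ , inj₂ q = contradiction (pairAt-< {e} q) (Finₚ.<-irrefl refl)

  degree≡∑ : ∀ (A : Adj n) v → degree A v ≡ ∑ (allFin n) (λ u → ι (A v u ≟ᵇ true))
  degree≡∑ A v = length-filter≡∑ (λ u → A v u ≟ᵇ true) (allFin n)

  ∑-pairs : ∀ (g : Fin n × Fin n → ℕ) → ∑ (pairs n) g ≡ ∑ (allFin n) (λ i → ∑ (allFin n) (λ j → ι (i Finₚ.<? j) * g (i , j)))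
  ∑-pairs g = trans (∑-concatMap _ (allFin n)) (∑-cong (allFin n) λ i _ →
    trans (∑-map (λ j → (i , j)) (filter (λ j → i Finₚ.<? j) (allFin n))) (∑-filter (λ j → i Finₚ.<? j) (allFin n)))

  ∑-pairs-sym : ∀ (A : Adj n) → (∀ i j → A i j ≡ A j i) →
    2 * ∑ (pairs n) (λ e → ι (A (proj₁ e) (proj₂ e) ≟ᵇ true)) ≤ ∑ (allFin n) (degree A)
  ∑-pairs-sym A symA = begin
    2 * ∑ (pairs n) g                              ≡⟨ cong (2 *_) (∑-pairs g) ⟩
    2 * X                                          ≡⟨ cong (X +_) (+-identityʳ X) ⟩
    X + X                                          ≡⟨ cong (X +_) (trans (∑-swap (allFin n) (allFin n)) (∑-cong (allFin n) λ j _ → ∑-cong (allFin n) λ i _ → cong (λ b → ι (i Finₚ.<? j) * ι (b ≟ᵇ true)) (symA i j))) ⟩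
    X + ∑ (allFin n) (λ i → ∑ (allFin n) (λ j → ι (j Finₚ.<? i) * g (i , j)))   ≡⟨ ∑-+ (allFin n) ⟨
    ∑ (allFin n) (λ i → ∑ (allFin n) (λ j → ι (i Finₚ.<? j) * g (i , j)) + ∑ (allFin n) (λ j → ι (j Finₚ.<? i) * g (i , j)))
                                                   ≡⟨ ∑-cong (allFin n) (λ i _ → sym (∑-+ (allFin n))) ⟩
    ∑ (allFin n) (λ i → ∑ (allFin n) (λ j → ι (i Finₚ.<? j) * g (i , j) + ι (j Finₚ.<? i) * g (i , j)))
                                                   ≤⟨ ∑-mono (allFin n) (λ i _ → ∑-mono (allFin n) (λ j _ → once i j)) ⟩
    ∑ (allFin n) (λ i → ∑ (allFin n) (λ j → g (i , j)))  ≡⟨ ∑-cong (allFin n) (λ i _ → sym (degree≡∑ A i)) ⟩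
    ∑ (allFin n) (degree A)                        ∎
    where
    open ≤-Reasoning
    g : Fin n × Fin n → ℕ
    g e = ι (A (proj₁ e) (proj₂ e) ≟ᵇ true)
    X = ∑ (allFin n) (λ i → ∑ (allFin n) (λ j → ι (i Finₚ.<? j) * g (i , j)))
    once : ∀ i j → ι (i Finₚ.<? j) * g (i , j) + ι (j Finₚ.<? i) * g (i , j) ≤ g (i , j)
    once i j with Finₚ.<-cmp i j
    ... | tri< i<j _ j≮i rewrite ι-no (j Finₚ.<? i) j≮i = ≤-trans (≤-reflexive (+-identityʳ _)) (≤-trans (*-monoˡ-≤ (g (i , j)) (ι≤1 (i Finₚ.<? j))) (≤-reflexive (*-identityˡ _)))
    ... | tri≈ i≮j _ _   rewrite ι-no (i Finₚ.<? j) i≮j = ≤-trans (*-monoˡ-≤ (g (i , j)) (ι≤1 (j Finₚ.<? i))) (≤-reflexive (*-identityˡ _))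
    ... | tri> i≮j _ _   rewrite ι-no (i Finₚ.<? j) i≮j = ≤-trans (*-monoˡ-≤ (g (i , j)) (ι≤1 (j Finₚ.<? i))) (≤-reflexive (*-identityˡ _))

  2∣T∣≤∑degree : ∀ (T : Outcome n) → 2 * ∣ T ∣ ≤ ∑ (allFin n) (degree (outcomeGraph {n} T))
  2∣T∣≤∑degree T = ≤-trans (*-monoʳ-≤ 2 (∣∣≤∑ (pairs n) T _ λ e e∈ →
      ≤-reflexive (sym (ι-yes (outcomeGraph {n} T (proj₁ (pairAt e)) (proj₂ (pairAt e)) ≟ᵇ true) (outcomeGraph⁺ T e e∈ (inj₁ refl))))))
    (∑-pairs-sym (outcomeGraph {n} T) (outcomeGraph-sym T))

  edgesOf : Adj n → Outcome n
  edgesOf A = Vec.map (λ e → A (proj₁ e) (proj₂ e)) (Vec.fromList (pairs n))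

  ∈-edgesOf : ∀ A e → Vec.lookup (edgesOf A) e ≡ A (proj₁ (pairAt e)) (proj₂ (pairAt e))
  ∈-edgesOf A e = trans (Vecₚ.lookup-map e _ (Vec.fromList (pairs n))) (cong (λ e → A (proj₁ e) (proj₂ e)) (lookup-fromList (pairs n) e))
    where
    lookup-fromList : ∀ {A : Set} (xs : List A) i → Vec.lookup (Vec.fromList xs) i ≡ List.lookup xs i
    lookup-fromList (x ∷ xs) zero    = refl
    lookup-fromList (x ∷ xs) (suc i) = lookup-fromList xs i

  ∈-edgesOf⁺ : ∀ A {e i j} → (∀ i j → A i j ≡ A j i) → Joins e i j → A i j ≡ true → e ∈ₛ edgesOf A
  ∈-edgesOf⁺ A {e} symA (inj₁ q) h = Vecₚ.lookup⇒[]= e _ (trans (∈-edgesOf A e) (trans (cong (λ e → A (proj₁ e) (proj₂ e)) q) h))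
  ∈-edgesOf⁺ A {e} symA (inj₂ q) h = Vecₚ.lookup⇒[]= e _ (trans (∈-edgesOf A e) (trans (cong (λ e → A (proj₁ e) (proj₂ e)) q) (trans (symA _ _) h)))

  ⊆edgesOf : ∀ A {T i j} → (∀ i j → A i j ≡ A j i) → T ⊆ₛ edgesOf A → outcomeGraph {n} T i j ≡ true → A i j ≡ true
  ⊆edgesOf A {T} symA sub h with outcomeGraph⁻ T h
  ... | e , e∈ , J with trans (sym (∈-edgesOf A e)) (Vecₚ.[]=⇒lookup (sub e∈)) | J
  ...   | q | inj₁ r = trans (sym (cong (λ e → A (proj₁ e) (proj₂ e)) r)) q
  ...   | q | inj₂ r = trans (symA _ _) (trans (sym (cong (λ e → A (proj₁ e) (proj₂ e)) r)) q)

  edgesOf⊆ : ∀ A {Z i j} → (∀ i j → A i j ≡ A j i) → edgesOf A ⊆ₛ Z → i ≢ j → A i j ≡ true → outcomeGraph {n} Z i j ≡ true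
  edgesOf⊆ A {Z} symA sub i≢j h = let e , J = joins i≢j in outcomeGraph⁺ Z e (sub (∈-edgesOf⁺ A symA J h)) J

  missing-edge : ∀ A {W i j} → (∀ i j → A i j ≡ A j i) → i ≢ j → A i j ≡ true → outcomeGraph {n} W i j ≢ true →
                 ∃[ e ] e ∈ₛ (edgesOf A ─ W) × Joins e i j
  missing-edge A {W} symA i≢j h ¬W = let e , J = joins i≢j in
    e , Subₚ.x∈p∧x∉q⇒x∈p─q (∈-edgesOf⁺ A symA J h) (λ m → ¬W (outcomeGraph⁺ W e m J)) , J

-- Random placements and their spread

-- Pairs (target , pattern): the vertex pattern of F is placed on the vertex target of the host graph.
Placement : ℕ → Set
Placement n = List (Fin n × Fin n)

module _ {n : ℕ} where

  targets patterns : Placement n → List (Fin n)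
  targets  = map proj₁
  patterns = map proj₂

  abstract
    _∈ₚ?_ : (c : Fin n × Fin n) (a : Placement n) → Dec (c ∈ a)
    c ∈ₚ? a = Any.any? (×ₚ.≡-dec Finₚ._≟_ Finₚ._≟_ c) a

    contains? : (cs a : Placement n) → Dec (All (_∈ a) cs)
    contains? cs a = All.all? (_∈ₚ? a) cs

  same-target : ∀ {a : Placement n} {v x y} → Unique (targets a) → (v , x) ∈ a → (v , y) ∈ a → x ≡ y
  same-target (_ ∷ _)  (here refl) (here refl) = refl
  same-target (new ∷ _)  (here refl) (there m)   = contradiction refl (All.lookup new (∈ₚ.∈-map⁺ proj₁ m))
  same-target (new ∷ _)  (there m)   (here refl) = contradiction refl (All.lookup new (∈ₚ.∈-map⁺ proj₁ m))
  same-target (_ ∷ u)  (there m)   (there m′)  = same-target u m m′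

  same-pattern : ∀ {a : Placement n} {v w x} → Unique (patterns a) → (v , x) ∈ a → (w , x) ∈ a → v ≡ w
  same-pattern (_ ∷ _)  (here refl) (here refl) = refl
  same-pattern (new ∷ _)  (here refl) (there m)   = contradiction refl (All.lookup new (∈ₚ.∈-map⁺ proj₂ m))
  same-pattern (new ∷ _)  (there m)   (here refl) = contradiction refl (All.lookup new (∈ₚ.∈-map⁺ proj₂ m))
  same-pattern (_ ∷ u)  (there m)   (there m′)  = same-pattern u m m′

  module _ (H : Adj n) where

    CoveredBy : Placement n → Fin n → Fin n → Set
    CoveredBy a i j = ∃[ x ] ∃[ y ] (i , x) ∈ a × (j , y) ∈ a × H x y ≡ true

    abstract
      coveredBy? : ∀ a i j → Dec (CoveredBy a i j)
      coveredBy? a i j = map′ to from (Any.any? (λ x → Any.any? (λ y → ((i , x) ∈ₚ? a) ×-dec ((j , y) ∈ₚ? a) ×-dec (H x y ≟ᵇ true)) (allFin n)) (allFin n))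
        where
        to : Any (λ x → Any (λ y → (i , x) ∈ a × (j , y) ∈ a × H x y ≡ true) (allFin n)) (allFin n) → CoveredBy a i j
        to h = let x , _ , h′ = find h ; y , _ , p = find h′ in x , y , p
        from : CoveredBy a i j → Any (λ x → Any (λ y → (i , x) ∈ a × (j , y) ∈ a × H x y ≡ true) (allFin n)) (allFin n)
        from (x , y , p) = lose (∈ₚ.∈-allFin x) (lose (∈ₚ.∈-allFin y) p)

    image : Placement n → Adj n
    image a i j = ⌊ coveredBy? a i j ⌋

    image⁻ : ∀ a {i j} → image a i j ≡ true → CoveredBy a i j
    image⁻ a {i} {j} = ⌊⌋-true⁻ (coveredBy? a i j)

    image⁺ : ∀ a {i j} → CoveredBy a i j → image a i j ≡ true
    image⁺ a {i} {j} = ⌊⌋-true⁺ (coveredBy? a i j)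

    imageEdges : Placement n → Outcome n
    imageEdges a = edgesOf (image a)

    module _ (symH : ∀ x y → H x y ≡ H y x) where

      image-sym : ∀ a i j → image a i j ≡ image a j i
      image-sym a i j = ≡true-antisym {n} swap swap
        where
        swap : ∀ {i j} → image a i j ≡ true → image a j i ≡ true
        swap h = let x , y , p , q , e = image⁻ a h in image⁺ a (y , x , q , p , trans (symH y x) e)

      imageEdges⁻ : ∀ {T : Outcome n} a {i j} → T ⊆ₛ imageEdges a → outcomeGraph {n} T i j ≡ true → CoveredBy a i j
      imageEdges⁻ a sub h = image⁻ a (⊆edgesOf (image a) (image-sym a) sub h)

    -- Distinct targets make v the image of a single x, and distinct patterns make different
    -- neighbours of v come from different neighbours of x.
    image-degree : ∀ {Δ} (A : Adj n) a → MaxDegreeAtMost H Δ → Unique (targets a) → Unique (patterns a) →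
                   (∀ {i j} → A i j ≡ true → CoveredBy a i j) → MaxDegreeAtMost A Δ
    image-degree {Δ} A a maxdeg ut up cov v = go (neighbours A v) (neighbours-unique A v) (λ w m → cov (∈-neighbours⁻ A {v} {w} m))
      where
      open ≤-Reasoning
      once : ∀ y ws → Unique ws → ∑ ws (λ w → ι ((w , y) ∈ₚ? a)) ≤ 1
      once y []       _        = z≤n
      once y (w ∷ ws) (new ∷ u) with (w , y) ∈ₚ? a
      ... | no _  = once y ws u
      ... | yes m = s≤s (≤-reflexive (∑-zero ws λ w′ w′∈ → ι-no ((w′ , y) ∈ₚ? a) λ m′ → All.lookup new w′∈ (same-pattern up m m′)))
      go : ∀ ws → Unique ws → (∀ w → w ∈ ws → CoveredBy a v w) → length ws ≤ Δ
      go []          u c = z≤n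
      go ws@(w₀ ∷ _) u c with c w₀ (here refl)
      ... | x , _ , vx , _ , _ = begin
          length ws                              ≡⟨ sym (∑-length ws) ⟩
          ∑ ws (λ _ → 1)                         ≤⟨ ∑-mono ws hit ⟩
          ∑ ws (λ w → ∑ (neighbours H x) (λ y → ι ((w , y) ∈ₚ? a)))   ≡⟨ ∑-swap ws (neighbours H x) ⟩
          ∑ (neighbours H x) (λ y → ∑ ws (λ w → ι ((w , y) ∈ₚ? a)))   ≤⟨ ∑-≤const (neighbours H x) (λ y _ → once y ws u) ⟩
          length (neighbours H x) * 1           ≡⟨ *-identityʳ _ ⟩
          length (neighbours H x)               ≤⟨ maxdeg x ⟩
          Δ                                     ∎
        where
        hit : ∀ w → w ∈ ws → 1 ≤ ∑ (neighbours H x) (λ y → ι ((w , y) ∈ₚ? a))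
        hit w w∈ with c w w∈
        ... | x′ , y , vx′ , wy , e with same-target ut vx vx′
        ...   | refl = subst (_≤ _) (ι-yes ((w , y) ∈ₚ? a) wy) (∑-∈ (λ y → ι ((w , y) ∈ₚ? a)) (∈-neighbours⁺ H e))

    -- In `preimages` the parent of a child is already a target, so the default value `u` is not met
    -- there.
    patternAt : Placement n → Fin n → Fin n
    patternAt []             u = u
    patternAt ((v , x) ∷ cs) u = if ⌊ v Finₚ.≟ u ⌋ then x else patternAt cs u

    patternAt-∈ : ∀ cs {u} → u ∈ targets cs → (u , patternAt cs u) ∈ cs
    patternAt-∈ ((v , x) ∷ cs) {u} m with v Finₚ.≟ u | m
    ... | yes refl | _         = here refl
    ... | no v≢u   | here refl = contradiction refl v≢u
    ... | no v≢u   | there m′  = there (patternAt-∈ cs m′)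

    extendBy : Fin n → (Placement n → List (Fin n)) → List (Placement n) → List (Placement n)
    extendBy v options = concatMap (λ cs → map (λ x → (v , x) ∷ cs) (options cs ∖ patterns cs))

    -- All ways in which the vertices of an explored forest can arise as images of vertices of H.
    preimages : ∀ {A : Adj n} {L ρ ν} → Forest A L ρ ν → List (Placement n)
    preimages nil = [] ∷ []
    preimages (root {v = v} F _) = extendBy v (λ _ → allFin n) (preimages F)
    preimages (child {u = u} {v} F _ _ _) = extendBy v (λ cs → neighbours H (patternAt cs u)) (preimages F)

    extendBy-length : ∀ v options css {m} → (∀ cs → length (options cs) ≤ m) → length (extendBy v options css) ≤ length css * m
    extendBy-length v options css h = ≤-trans (≤-reflexive (length-concatMap _ css)) (∑-≤const css λ cs _ →
      ≤-trans (≤-reflexive (Listₚ.length-map _ (options cs ∖ patterns cs))) (≤-trans (Listₚ.length-filter _ (options cs)) (h cs)))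

    -- A root can come from any of n vertices, a child only from the at most Δ neighbours of the
    -- vertex placed on its parent.
    preimages-length : ∀ {A : Adj n} {L ρ ν Δ} (F : Forest A L ρ ν) → MaxDegreeAtMost H Δ → length (preimages F) ≤ n ^ ρ * Δ ^ ν
    preimages-length nil maxdeg = ≤-refl
    preimages-length {ρ = suc ρ} {ν} {Δ} (root {v = v} F _) maxdeg = ≤-trans (extendBy-length v (λ _ → allFin n) (preimages F) λ _ → ≤-reflexive (Listₚ.length-tabulate id))
      (≤-trans (*-monoˡ-≤ n (preimages-length F maxdeg)) (≤-reflexive (lem n (n ^ ρ) (Δ ^ ν))))
      where
      lem : ∀ n a b → a * b * n ≡ n * a * b
      lem = solve-∀
    preimages-length {ρ = ρ} {suc ν} {Δ} (child {u = u} {v} F _ _ _) maxdeg = ≤-trans (extendBy-length v (λ cs → neighbours H (patternAt cs u)) (preimages F) λ cs → maxdeg (patternAt cs u))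
      (≤-trans (*-monoˡ-≤ Δ (preimages-length F maxdeg)) (≤-reflexive (lem Δ (n ^ ρ) (Δ ^ ν))))
      where
      lem : ∀ d a b → a * b * d ≡ a * (d * b)
      lem = solve-∀

    extendBy⁺ : ∀ v options {css cs x} → cs ∈ css → x ∈ options cs → x ∉ patterns cs → ((v , x) ∷ cs) ∈ extendBy v options css
    extendBy⁺ v options {css} {cs} m x∈ x∉ = ∈ₚ.∈-concatMap⁺ (λ cs → map (λ x → (v , x) ∷ cs) (options cs ∖ patterns cs))
      (lose m (∈ₚ.∈-map⁺ (λ x → (v , x) ∷ cs) (∈-∖⁺ x∈ x∉)))

    extendBy⁻ : ∀ v options css {ds} → ds ∈ extendBy v options css → ∃[ cs ] ∃[ x ] cs ∈ css × x ∉ patterns cs × ds ≡ (v , x) ∷ cs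
    extendBy⁻ v options css m with find (∈ₚ.∈-concatMap⁻ (λ cs → map (λ x → (v , x) ∷ cs) (options cs ∖ patterns cs)) {xs = css} m)
    ... | cs , cs∈ , m′ with ∈ₚ.∈-map⁻ (λ x → (v , x) ∷ cs) m′
    ...   | x , x∈ , refl = cs , x , cs∈ , proj₂ (∈-∖⁻ (options cs) x∈) , refl

    preimages-wf : ∀ {A : Adj n} {L ρ ν} (F : Forest A L ρ ν) {cs} → cs ∈ preimages F → targets cs ≡ L × Unique (patterns cs)
    preimages-wf nil (here refl) = refl , []
    preimages-wf (root {v = v} F _) m with extendBy⁻ v (λ _ → allFin n) (preimages F) m
    ... | cs , x , cs∈ , x∉ , refl = let e , u = preimages-wf F cs∈ in cong (v ∷_) e , ∉⇒All≢ x∉ ∷ u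
    preimages-wf (child {u = u} {v} F _ _ _) m with extendBy⁻ v (λ cs → neighbours H (patternAt cs u)) (preimages F) m
    ... | cs , x , cs∈ , x∉ , refl = let e , u = preimages-wf F cs∈ in cong (v ∷_) e , ∉⇒All≢ x∉ ∷ u

    -- Read `a` along the forest. `CoveredBy` speaks of edges only, so it is an edge at the root
    -- that shows the root to be a target of `a`.
    preimages-cover : ∀ {A : Adj n} {L ρ ν} (F : Forest A L ρ ν) a → Unique (targets a) → Unique (patterns a) →
      (∀ {i j} → A i j ≡ true → CoveredBy a i j) → (∀ {v} → v ∈ L → ∃[ w ] A v w ≡ true) →
      ∃[ cs ] cs ∈ preimages F × All (_∈ a) cs
    preimages-cover nil a ut up cov iso = [] , here refl , []
    preimages-cover {A} (root {L} {v = v} F v∉) a ut up cov iso with preimages-cover F a ut up cov (iso ∘ there) | cov (proj₂ (iso (here refl)))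
    ... | cs , cs∈ , inside | x , _ , vx , _ = (v , x) ∷ cs , extendBy⁺ v (λ _ → allFin n) cs∈ (∈ₚ.∈-allFin x) fresh , vx ∷ inside
      where
      fresh : x ∉ patterns cs
      fresh m with ∈ₚ.∈-map⁻ proj₂ m
      ... | (w , _) , wx , refl = v∉ (subst (v ∈_) (proj₁ (preimages-wf F cs∈))
                (subst (_∈ targets cs) (same-pattern up (All.lookup inside wx) vx) (∈ₚ.∈-map⁺ proj₁ wx)))
    preimages-cover (child {L} {u = u} {v} F v∉ u∈ e) a ut up cov iso with preimages-cover F a ut up cov (iso ∘ there) | cov e
    ... | cs , cs∈ , inside | y , x , uy , vx , h = (v , x) ∷ cs , extendBy⁺ v (λ cs → neighbours H (patternAt cs u)) cs∈ option fresh , vx ∷ inside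
      where
      u∈cs : u ∈ targets cs
      u∈cs = subst (u ∈_) (sym (proj₁ (preimages-wf F cs∈))) u∈
      option : x ∈ neighbours H (patternAt cs u)
      option with same-target ut uy (All.lookup inside (patternAt-∈ cs u∈cs))
      ... | refl = ∈-neighbours⁺ H h
      fresh : x ∉ patterns cs
      fresh m with ∈ₚ.∈-map⁻ proj₂ m
      ... | (w , _) , wx , refl = v∉ (subst (v ∈_) (proj₁ (preimages-wf F cs∈))
                (subst (_∈ targets cs) (same-pattern up (All.lookup inside wx) vx) (∈ₚ.∈-map⁺ proj₁ wx)))

  -- Spread on vertices: with M the size of the family, j prescribed placements of single vertices
  -- occur together with probability at most s^-j.
  PointSpread : List (Placement n) → ℕ → ℕ → Set
  PointSpread as s M = ∀ cs → Unique (targets cs) → Unique (patterns cs) → ∑ as (λ a → ι (contains? cs a)) * s ^ length cs ≤ M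

  -- A union bound over the preimages of the explored forest gives n^ρ Δ^ν s^-(ρ+ν). Since n ≤ C s,
  -- the roots cost C^ρ ≤ C^ν, and s = C Δ s′ absorbs C^ν Δ^ν, leaving s′^-ν. Sparsity says that t
  -- edges force at least 2 α t / β children, which converts this into d^-t.
  pointSpread⇒bound : ∀ (H A : Adj n) {Δ α β} as {C s′ d M} t →
    .{{_ : NonZero C}} .{{_ : NonZero Δ}} .{{_ : NonZero s′}} .{{_ : NonZero β}} →
    MaxDegreeAtMost H Δ → (∀ a → a ∈ as → Unique (targets a) × Unique (patterns a)) →
    PointSpread as (C * Δ * s′) M → n ≤ C * (C * Δ * s′) → d ^ β ≤ s′ ^ (2 * α) →
    {P : Placement n → Set} (P? : ∀ a → Dec (P a)) → (∀ a → a ∈ as → P a → ∀ {i j} → A i j ≡ true → CoveredBy H a i j) →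
    2 * t ≤ ∑ (allFin n) (degree A) → (∃[ L ] Σ (Exploration A α β L) λ X → α * ∑ (allFin n) (degree A) ≤ β * Exploration.ν X) →
    ∑ as (λ a → ι (P? a)) * d ^ t ≤ M
  pointSpread⇒bound H A {Δ} {α} {β} as {C} {s′} {d} {M} t maxdeg wf points n≤ d≤ {P} P? cov 2t≤ (L , X , total) = ≤-trans (*-monoʳ-≤ # d^≤) #s′≤M
    where
    open Exploration X
    open ≤-Reasoning
    s = C * Δ * s′
    instance
      nz : NonZero (C * Δ)
      nz = m*n≢0 C Δ
      nz′ : NonZero s
      nz′ = m*n≢0 (C * Δ) s′
    # : ℕ
    # = ∑ as (λ a → ι (P? a))
    #≤ : # ≤ ∑ (preimages H forest) (λ cs → ∑ as (λ a → ι (contains? cs a)))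
    #≤ = ≤-trans (∑-mono as λ a m → single a m (P? a)) (≤-reflexive (∑-swap as (preimages H forest)))
      where
      single : ∀ a → a ∈ as → (Pa? : Dec (P a)) → ι Pa? ≤ ∑ (preimages H forest) (λ cs → ι (contains? cs a))
      single a m (no _)  = z≤n
      single a m (yes p) with preimages-cover H forest a (proj₁ (wf a m)) (proj₂ (wf a m)) (cov a m p) nonisolated
      ... | cs , cs∈ , inside = ≤-trans (≤-reflexive (sym (ι-yes (contains? cs a) inside))) (∑-∈ (λ cs → ι (contains? cs a)) cs∈)
    #s≤ : # * s ^ (ρ + ν) ≤ n ^ ρ * Δ ^ ν * M
    #s≤ = begin
      # * s ^ (ρ + ν)   ≤⟨ *-monoˡ-≤ _ #≤ ⟩
      ∑ (preimages H forest) (λ cs → ∑ as (λ a → ι (contains? cs a))) * s ^ (ρ + ν)  ≡⟨ ∑-*ʳ _ (preimages H forest) ⟩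
      ∑ (preimages H forest) (λ cs → ∑ as (λ a → ι (contains? cs a)) * s ^ (ρ + ν))  ≤⟨ ∑-≤const (preimages H forest) bound ⟩
      length (preimages H forest) * M                                              ≤⟨ *-monoˡ-≤ M (preimages-length H forest maxdeg) ⟩
      n ^ ρ * Δ ^ ν * M                                                            ∎
      where
      bound : ∀ cs → cs ∈ preimages H forest → ∑ as (λ a → ι (contains? cs a)) * s ^ (ρ + ν) ≤ M
      bound cs cs∈ with preimages-wf H forest cs∈
      ... | refl , up = subst (λ k → ∑ as (λ a → ι (contains? cs a)) * s ^ k ≤ M)
              (trans (sym (Listₚ.length-map proj₁ cs)) (forest-length A forest)) (points cs (forest-unique A forest) up)
    #s′≤M : # * s′ ^ ν ≤ M
    #s′≤M = *-cancelˡ-≤ ((C * Δ) ^ ν * s ^ ρ) {{m*n≢0 _ _ {{m^n≢0 (C * Δ) ν}} {{m^n≢0 s ρ}}}} (begin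
      (C * Δ) ^ ν * s ^ ρ * (# * s′ ^ ν)         ≡⟨ lem₁ ((C * Δ) ^ ν) (s ^ ρ) # (s′ ^ ν) ⟩
      # * (s ^ ρ * ((C * Δ) ^ ν * s′ ^ ν))       ≡⟨ cong (λ z → # * (s ^ ρ * z)) (sym (^-distribʳ-* (C * Δ) s′ ν)) ⟩
      # * (s ^ ρ * s ^ ν)                        ≡⟨ cong (# *_) (sym (^-distribˡ-+-* s ρ ν)) ⟩
      # * s ^ (ρ + ν)                            ≤⟨ #s≤ ⟩
      n ^ ρ * Δ ^ ν * M                          ≤⟨ *-monoˡ-≤ M (*-monoˡ-≤ (Δ ^ ν) (^-monoˡ-≤ ρ n≤)) ⟩
      (C * s) ^ ρ * Δ ^ ν * M                    ≡⟨ cong (λ z → z * Δ ^ ν * M) (^-distribʳ-* C s ρ) ⟩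
      C ^ ρ * s ^ ρ * Δ ^ ν * M                  ≤⟨ *-monoˡ-≤ M (*-monoˡ-≤ (Δ ^ ν) (*-monoˡ-≤ (s ^ ρ) (^-monoʳ-≤ C roots≤))) ⟩
      C ^ ν * s ^ ρ * Δ ^ ν * M                  ≡⟨ lem₂ (C ^ ν) (s ^ ρ) (Δ ^ ν) M ⟩
      C ^ ν * Δ ^ ν * s ^ ρ * M                  ≡⟨ cong (λ z → z * s ^ ρ * M) (sym (^-distribʳ-* C Δ ν)) ⟩
      (C * Δ) ^ ν * s ^ ρ * M                    ∎)
      where
      lem₁ : ∀ a b c e → a * b * (c * e) ≡ c * (b * (a * e))
      lem₁ = solve-∀
      lem₂ : ∀ a b c e → a * b * c * e ≡ a * c * b * e
      lem₂ = solve-∀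
    -- Both sides are raised to the power β, so that the rational exponent 2 α / β becomes integral.
    d^≤ : d ^ t ≤ s′ ^ ν
    d^≤ = ^-cancelʳ-≤ β (begin
      (d ^ t) ^ β           ≡⟨ trans (^-*-assoc d t β) (trans (cong (d ^_) (*-comm t β)) (sym (^-*-assoc d β t))) ⟩
      (d ^ β) ^ t           ≤⟨ ^-monoˡ-≤ t d≤ ⟩
      (s′ ^ (2 * α)) ^ t    ≡⟨ ^-*-assoc s′ (2 * α) t ⟩
      s′ ^ (2 * α * t)      ≤⟨ ^-monoʳ-≤ s′ (≤-trans (≤-reflexive (lem₃ α t)) (≤-trans (*-monoʳ-≤ α 2t≤) total)) ⟩
      s′ ^ (β * ν)              ≡⟨ trans (cong (s′ ^_) (*-comm β ν)) (sym (^-*-assoc s′ ν β)) ⟩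
      (s′ ^ ν) ^ β              ∎)
      where
      lem₃ : ∀ a t → 2 * a * t ≡ a * (2 * t)
      lem₃ = solve-∀
      ^-cancelʳ-≤ : ∀ k .{{_ : NonZero k}} {x y} → x ^ k ≤ y ^ k → x ≤ y
      ^-cancelʳ-≤ k {x} {y} h with x ≤? y
      ... | yes x≤y = x≤y
      ... | no x≰y  = contradiction h (<⇒≱ (^-monoˡ-< k (≰⇒> x≰y)))

  -- Sparsity is available only for edge sets inside some image. A set T inside none of them is
  -- counted zero times; otherwise one image containing T lends T its sparsity.
  pointSpread⇒spread : ∀ (H : Adj n) (symH : ∀ x y → H x y ≡ H y x) {Δ α β} as {C s′ d M} →
    .{{_ : NonZero C}} .{{_ : NonZero Δ}} .{{_ : NonZero s′}} .{{_ : NonZero β}} →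
    MaxDegreeAtMost H Δ → (∀ a → a ∈ as → Unique (targets a) × Unique (patterns a)) →
    PointSpread as (C * Δ * s′) M → n ≤ C * (C * Δ * s′) → d ^ β ≤ s′ ^ (2 * α) →
    (∀ (A : Adj n) a → a ∈ as → (∀ u v → A u v ≡ A v u) → (∀ u → A u u ≡ false) →
       (∀ {i j} → A i j ≡ true → CoveredBy H a i j) → LocallySparse A α β) →
    Spread (imageEdges H) as d M
  pointSpread⇒spread H symH {α = α} {β} as {d = d} maxdeg wf points n≤ d≤ sparse T = go (searchList (λ a → T Subₚ.⊆? imageEdges H a) as)
    where
    go : _ ⊎ _ → _
    go (inj₂ none) = ≤-trans (≤-reflexive (cong (_* d ^ ∣ T ∣) (∑-zero as λ a m → ι-no (T Subₚ.⊆? imageEdges H a) (none a m)))) z≤n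
    go (inj₁ (a₀ , a₀∈ , T⊆)) = pointSpread⇒bound H (outcomeGraph {n} T) {α = α} {β} as ∣ T ∣ maxdeg wf points n≤ d≤
      (λ a → T Subₚ.⊆? imageEdges H a) (λ a _ sub → imageEdges⁻ H symH a sub) (2∣T∣≤∑degree {n} T)
      (explore (outcomeGraph {n} T) (outcomeGraph-sym T) (outcomeGraph-irr T)
        (sparse (outcomeGraph {n} T) a₀ a₀∈ (outcomeGraph-sym T) (outcomeGraph-irr T) (imageEdges⁻ H symH a₀ T⊆)))

-- Counting placements

-- The falling factorial: the number of injections of j points into m points.
ff : ℕ → ℕ → ℕ
ff m zero    = 1
ff m (suc j) = m * ff (m ∸ 1) j

ff-+ : ∀ m k i → ff m (k + i) ≡ ff m k * ff (m ∸ k) i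
ff-+ m zero    i = sym (+-identityʳ _)
ff-+ m (suc k) i = begin
  m * ff (m ∸ 1) (k + i)                 ≡⟨ cong (m *_) (ff-+ (m ∸ 1) k i) ⟩
  m * (ff (m ∸ 1) k * ff (m ∸ 1 ∸ k) i)  ≡⟨ *-assoc m (ff (m ∸ 1) k) _ ⟨
  m * ff (m ∸ 1) k * ff (m ∸ 1 ∸ k) i    ≡⟨ cong (λ z → m * ff (m ∸ 1) k * ff z i) (∸-+-assoc m 1 k) ⟩
  m * ff (m ∸ 1) k * ff (m ∸ suc k) i    ∎
  where open ≡-Reasoning

ff>0 : ∀ m j → j ≤ m → 0 < ff m j
ff>0 m       zero    _         = s≤s z≤n
ff>0 (suc m) (suc j) (s≤s j≤m) = *-mono-≤ {1} {suc m} (s≤s z≤n) (ff>0 m j j≤m)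

-- The estimate m! ≥ (m / e)^m in falling-factorial form, with 3 for e: one step costs (1 + 1 / m)^k
-- ≤ 3.
m^k≤3^k*ff : ∀ m k → k ≤ m → m ^ k ≤ 3 ^ k * ff m k
m^k≤3^k*ff m       zero    _         = ≤-refl
m^k≤3^k*ff (suc m) (suc k) (s≤s k≤m) = begin
  suc m * suc m ^ k                 ≤⟨ *-monoʳ-≤ (suc m) ([1+r]^j≤3r^j m k k≤m) ⟩
  suc m * (3 * m ^ k)               ≤⟨ *-monoʳ-≤ (suc m) (*-monoʳ-≤ 3 (m^k≤3^k*ff m k k≤m)) ⟩
  suc m * (3 * (3 ^ k * ff m k))    ≡⟨ lem (suc m) (3 ^ k) (ff m k) ⟩
  3 ^ suc k * (suc m * ff m k)      ∎
  where
  open ≤-Reasoning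
  lem : ∀ a b c → a * (3 * (b * c)) ≡ 3 * b * (a * c)
  lem = solve-∀

s^k≤ff : ∀ {s m k} → 3 * s ≤ m → k ≤ m → s ^ k ≤ ff m k
s^k≤ff {s} {m} {k} 3s≤m k≤m = *-cancelˡ-≤ (3 ^ k) {{m^n≢0 3 k}} (begin
  3 ^ k * s ^ k     ≡⟨ ^-distribʳ-* 3 s k ⟨
  (3 * s) ^ k       ≤⟨ ^-monoˡ-≤ k 3s≤m ⟩
  m ^ k             ≤⟨ m^k≤3^k*ff m k k≤m ⟩
  3 ^ k * ff m k    ∎)
  where open ≤-Reasoning

Unique-map-filter : ∀ {A B : Set} (f : A → B) {P : A → Set} (P? : ∀ a → Dec (P a)) xs → Unique (map f xs) → Unique (map f (filter P? xs))
Unique-map-filter f P? []       u         = u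
Unique-map-filter f P? (x ∷ xs) (new ∷ u) with P? x
... | no _  = Unique-map-filter f P? xs u
... | yes _ = All.tabulate keep ∷ Unique-map-filter f P? xs u
  where
  keep : ∀ {y} → y ∈ map f (filter P? xs) → f x ≢ y
  keep m with ∈ₚ.∈-map⁻ f m
  ... | z , z∈ , refl = All.lookup new (∈ₚ.∈-map⁺ f (proj₁ (∈ₚ.∈-filter⁻ P? {xs = xs} z∈)))

module _ {n : ℕ} where

  count : List (Placement n) → Placement n → ℕ
  count as cs = ∑ as (λ a → ι (contains? cs a))

  without : Fin n → Placement n → Placement n
  without x = filter (λ c → ¬? (proj₂ c Finₚ.≟ x))

  without⁻ : ∀ x cs {c} → c ∈ without x cs → c ∈ cs × proj₂ c ≢ x
  without⁻ x cs = ∈ₚ.∈-filter⁻ (λ c → ¬? (proj₂ c Finₚ.≟ x)) {xs = cs}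

  length-without : ∀ x cs → Unique (patterns cs) → x ∈ patterns cs → length cs ≡ suc (length (without x cs))
  length-without x ((v , y) ∷ cs) (new ∷ u) m with y Finₚ.≟ x | m
  ... | yes refl | _ = cong suc (cong length (sym (Listₚ.filter-all (λ c → ¬? (proj₂ c Finₚ.≟ y)) (All.tabulate λ c∈ e → All.lookup new (∈ₚ.∈-map⁺ proj₂ c∈) (sym e)))))
  ... | no y≢x | here refl = contradiction refl y≢x
  ... | no y≢x | there m′  = cong suc (length-without x cs u m′)

  contains-∷-pinned : ∀ {cs a : Placement n} {u v x} → Unique (targets cs) → (v , x) ∈ cs → x ∉ patterns a → All (_∈ (u , x) ∷ a) cs → u ≡ v × All (_∈ a) (without x cs)
  contains-∷-pinned {cs} {a} {u} {v} {x} ut vx x∉ all = pin (All.lookup all vx) , All.tabulate rest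
    where
    pin : (v , x) ∈ (u , x) ∷ a → u ≡ v
    pin (here refl) = refl
    pin (there m)   = contradiction (∈ₚ.∈-map⁺ proj₂ m) x∉
    rest : ∀ {c} → c ∈ without x cs → c ∈ a
    rest m with without⁻ x cs m
    ... | c∈ , c≢x with All.lookup all c∈
    ...   | here refl = contradiction refl c≢x
    ...   | there m′  = m′

  contains-∷-free : ∀ {cs a : Placement n} {u x} → x ∉ patterns cs → All (_∈ (u , x) ∷ a) cs → All (_∈ a) cs
  contains-∷-free x∉ all = All.tabulate λ c∈ → case All.lookup all c∈ of λ { (here refl) → contradiction (∈ₚ.∈-map⁺ proj₂ c∈) x∉ ; (there m) → m }

  pattern-∈ : ∀ (cs : Placement n) {x} → x ∈ patterns cs → ∃[ v ] (v , x) ∈ cs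
  pattern-∈ cs m with ∈ₚ.∈-map⁻ proj₂ m
  ... | (v , x) , c∈ , refl = v , c∈

  patterns-without : ∀ {x cs ms} → (∀ {y} → y ∈ patterns cs → y ∈ x ∷ ms) → ∀ {y} → y ∈ patterns (without x cs) → y ∈ ms
  patterns-without {x} {cs} sub m with pattern-∈ (without x cs) m
  ... | v , c∈ with without⁻ x cs c∈
  ...   | c∈′ , y≢x with sub (∈ₚ.∈-map⁺ proj₂ c∈′)
  ...     | here refl = contradiction refl y≢x
  ...     | there m′  = m′

  step : Fin n → (Placement n → List (Fin n)) → List (Placement n) → List (Placement n)
  step x choice as = concatMap (λ a → map (λ u → (u , x) ∷ a) (choice a)) as

  ∑-step : ∀ x choice as (f : Placement n → ℕ) → ∑ (step x choice as) f ≡ ∑ as (λ a → ∑ (choice a) (λ u → f ((u , x) ∷ a)))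
  ∑-step x choice as f = trans (∑-concatMap _ as) (∑-cong as λ a _ → ∑-map (λ u → (u , x) ∷ a) (choice a))

  step⁻ : ∀ x choice as {b} → b ∈ step x choice as → ∃[ a ] ∃[ u ] a ∈ as × u ∈ choice a × b ≡ (u , x) ∷ a
  step⁻ x choice as m with find (∈ₚ.∈-concatMap⁻ (λ a → map (λ u → (u , x) ∷ a) (choice a)) {xs = as} m)
  ... | a , a∈ , m′ with ∈ₚ.∈-map⁻ (λ u → (u , x) ∷ a) m′
  ...   | u , u∈ , refl = a , u , a∈ , u∈ , refl

  step-all : ∀ x choice as (P : Placement n → Set) → (∀ a u → a ∈ as → u ∈ choice a → P ((u , x) ∷ a)) → ∀ b → b ∈ step x choice as → P b
  step-all x choice as P h b m = let a , u , a∈ , u∈ , e = step⁻ x choice as m in subst P (sym e) (h a u a∈ u∈)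

  step-length : ∀ x choice as {s} → (∀ a → a ∈ as → length (choice a) ≡ s) → length (step x choice as) ≡ length as * s
  step-length x choice as h = trans (length-concatMap _ as) (trans (∑-cong as λ a m → trans (Listₚ.length-map _ (choice a)) (h a m)) (∑-const as _))

  -- Constraints are limited to the patterns `ms` already placed, so that the property can be
  -- carried along while a placement is built vertex by vertex.
  PointSpreadOn : List (Fin n) → List (Placement n) → ℕ → ℕ → Set
  PointSpreadOn ms as s M = ∀ cs → Unique (targets cs) → Unique (patterns cs) → (∀ {y} → y ∈ patterns cs → y ∈ ms) → count as cs * s ^ length cs ≤ M

  trivial-spread : ∀ s → PointSpreadOn [] ([] ∷ []) s 1
  trivial-spread s []       _ _ _   = *-monoˡ-≤ 1 (+-mono-≤ (ι≤1 (contains? {n} [] [])) (z≤n {0}))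
  trivial-spread s (c ∷ cs) _ _ sub = case sub (here refl) of λ ()

  -- If `cs` prescribes the target of x, at most one option survives, which gains the factor s for
  -- this constraint. If not, all of the at most s options are counted, and the bound grows from M
  -- to M * s.
  step-spread : ∀ {ms x choice as s M} → x ∉ ms → (∀ a → a ∈ as → patterns a ≡ ms) → (∀ a → Unique (choice a) × length (choice a) ≤ s) →
                PointSpreadOn ms as s M → PointSpreadOn (x ∷ ms) (step x choice as) s (M * s)
  step-spread {ms} {x} {choice} {as} {s} {M} x∉ms pat ch spread cs ut up sub with x ∈? patterns cs
  ... | yes x∈ = let v , vx = pattern-∈ cs x∈ in begin
      count (step x choice as) cs * s ^ length cs                       ≡⟨ cong₂ (λ p q → p * s ^ q) (∑-step x choice as _) (length-without x cs up x∈) ⟩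
      ∑ as (λ a → ∑ (choice a) (λ u → ι (contains? cs ((u , x) ∷ a)))) * (s * s ^ k′)  ≤⟨ *-monoˡ-≤ (s * s ^ k′) (∑-mono as (λ a a∈ → pinned v vx a a∈)) ⟩
      count as (without x cs) * (s * s ^ k′)                            ≡⟨ lem (count as (without x cs)) s (s ^ k′) ⟩
      count as (without x cs) * s ^ k′ * s                              ≤⟨ *-monoˡ-≤ s (spread (without x cs) (Unique-map-filter proj₁ _ cs ut) (Unique-map-filter proj₂ _ cs up) (patterns-without {cs = cs} sub)) ⟩
      M * s                                                             ∎
    where
    open ≤-Reasoning
    k′ = length (without x cs)
    lem : ∀ a b c → a * (b * c) ≡ a * c * b
    lem = solve-∀
    pinned : ∀ v → (v , x) ∈ cs → ∀ a → a ∈ as → ∑ (choice a) (λ u → ι (contains? cs ((u , x) ∷ a))) ≤ ι (contains? (without x cs) a)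
    pinned v vx a a∈ = begin
      ∑ (choice a) (λ u → ι (contains? cs ((u , x) ∷ a)))               ≤⟨ ∑-mono (choice a) (λ u _ → one u) ⟩
      ∑ (choice a) (λ u → ι (u Finₚ.≟ v) * I)                           ≡⟨ ∑-*ʳ I (choice a) ⟨
      ∑ (choice a) (λ u → ι (u Finₚ.≟ v)) * I                           ≤⟨ *-monoˡ-≤ I (∑-δ≤ (choice a) v (proj₁ (ch a))) ⟩
      1 * I                                                             ≡⟨ *-identityˡ I ⟩
      I                                                                 ∎
      where
      I = ι (contains? (without x cs) a)
      one : ∀ u → ι (contains? cs ((u , x) ∷ a)) ≤ ι (u Finₚ.≟ v) * I
      one u with contains? cs ((u , x) ∷ a)
      ... | no _    = z≤n
      ... | yes all with contains-∷-pinned ut vx (λ m → x∉ms (subst (x ∈_) (pat a a∈) m)) all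
      ...   | e , all′ = ≤-reflexive (sym (cong₂ _*_ (ι-yes (u Finₚ.≟ v) e) (ι-yes (contains? (without x cs) a) all′)))
  ... | no x∉ = begin
      count (step x choice as) cs * s ^ length cs                       ≡⟨ cong (_* s ^ length cs) (∑-step x choice as _) ⟩
      ∑ as (λ a → ∑ (choice a) (λ u → ι (contains? cs ((u , x) ∷ a)))) * s ^ length cs  ≤⟨ *-monoˡ-≤ _ (∑-mono as free) ⟩
      ∑ as (λ a → s * ι (contains? cs a)) * s ^ length cs               ≡⟨ cong (_* s ^ length cs) (∑-*ˡ s as) ⟨
      s * count as cs * s ^ length cs                                   ≡⟨ trans (*-assoc s _ _) (*-comm s _) ⟩
      count as cs * s ^ length cs * s                                   ≤⟨ *-monoˡ-≤ s (spread cs ut up sub′) ⟩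
      M * s                                                             ∎
    where
    open ≤-Reasoning
    free : ∀ a → a ∈ as → ∑ (choice a) (λ u → ι (contains? cs ((u , x) ∷ a))) ≤ s * ι (contains? cs a)
    free a _ = ≤-trans (∑-≤const (choice a) λ u _ → ι-mono (contains? cs ((u , x) ∷ a)) (contains? cs a) (contains-∷-free x∉)) (*-monoˡ-≤ _ (proj₂ (ch a)))
    sub′ : ∀ {y} → y ∈ patterns cs → y ∈ ms
    sub′ m with sub m
    ... | here refl = contradiction m x∉
    ... | there m′  = m′

  -- Uniform injections and completions of partial placements

  injections : List (Fin n) → List (Fin n) → List (Placement n)
  injections []       us = [] ∷ []
  injections (x ∷ xs) us = concatMap (λ u → map ((u , x) ∷_) (injections xs (us ∖ (u ∷ [])))) us

  ∑-injections : ∀ x xs us (f : Placement n → ℕ) → ∑ (injections (x ∷ xs) us) f ≡ ∑ us (λ u → ∑ (injections xs (us ∖ (u ∷ []))) (λ a → f ((u , x) ∷ a)))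
  ∑-injections x xs us f = trans (∑-concatMap _ us) (∑-cong us λ u _ → ∑-map ((u , x) ∷_) (injections xs (us ∖ (u ∷ []))))

  length-∖₁ : ∀ (us : List (Fin n)) {u} → Unique us → u ∈ us → length (us ∖ (u ∷ [])) ≡ length us ∸ 1
  length-∖₁ us {u} uu u∈ = sym (cong (_∸ 1) (length-∖ us (u ∷ []) uu ([] ∷ []) λ { (here refl) → u∈ }))

  injections-length : ∀ xs us → Unique us → length (injections xs us) ≡ ff (length us) (length xs)
  injections-length []       us uu = refl
  injections-length (x ∷ xs) us uu = trans (length-concatMap _ us) (trans (∑-cong us λ u u∈ →
    trans (Listₚ.length-map _ (injections xs (us ∖ (u ∷ [])))) (trans (injections-length xs (us ∖ (u ∷ [])) (Unique-∖ (u ∷ []) uu))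
      (cong (λ m → ff m (length xs)) (length-∖₁ us uu u∈)))) (∑-const us _))

  injections-wf : ∀ xs us {a} → Unique us → a ∈ injections xs us → patterns a ≡ xs × Unique (targets a) × (∀ {u} → u ∈ targets a → u ∈ us)
  injections-wf []       us uu (here refl) = refl , [] , λ ()
  injections-wf (x ∷ xs) us uu m with find (∈ₚ.∈-concatMap⁻ (λ u → map ((u , x) ∷_) (injections xs (us ∖ (u ∷ [])))) {xs = us} m)
  ... | u , u∈ , m′ with ∈ₚ.∈-map⁻ ((u , x) ∷_) m′
  ...   | a , a∈ , refl with injections-wf xs (us ∖ (u ∷ [])) (Unique-∖ (u ∷ []) uu) a∈
  ...     | p , ut , sub = cong (x ∷_) p , ∉⇒All≢ (λ m″ → proj₂ (∈-∖⁻ us (sub m″)) (here refl)) ∷ ut ,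
              λ { (here refl) → u∈ ; (there m″) → proj₁ (∈-∖⁻ us (sub m″)) }

  -- A prescribed vertex has one option; a free vertex must also avoid the targets reserved by `cs`.
  -- Respecting the reserved targets is what makes the count a falling factorial that cancels in
  -- `injections-spread`.
  injections-count : ∀ xs us cs → Unique us → Unique xs → Unique (targets cs) → Unique (patterns cs) → (∀ {y} → y ∈ patterns cs → y ∈ xs) →
    count (injections xs us) cs ≤ ff (length us ∸ length cs) (length xs ∸ length cs)
  injections-count []       us []             uu ux ut up sub = +-mono-≤ (ι≤1 (contains? {n} [] [])) (z≤n {0})
  injections-count []       us ((v , x) ∷ cs) uu ux ut up sub = case sub (here refl) of λ ()
  injections-count (x ∷ xs) us cs uu (x∉xs ∷ ux) ut up sub with x ∈? patterns cs
  ... | yes x∈ = let v , vx = pattern-∈ cs x∈ in begin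
      count (injections (x ∷ xs) us) cs                                ≡⟨ ∑-injections x xs us _ ⟩
      ∑ us (λ u → ∑ (injections xs (us ∖ (u ∷ []))) (λ a → ι (contains? cs ((u , x) ∷ a))))   ≤⟨ ∑-mono us (pinned v vx) ⟩
      ∑ us (λ u → ι (u Finₚ.≟ v) * F)                                  ≡⟨ ∑-*ʳ F us ⟨
      ∑ us (λ u → ι (u Finₚ.≟ v)) * F                                  ≤⟨ *-monoˡ-≤ F (∑-δ≤ us v uu) ⟩
      1 * F                                                            ≡⟨ *-identityˡ F ⟩
      ff (length us ∸ suc k′) (suc (length xs) ∸ suc k′)               ≡⟨ cong (λ k → ff (length us ∸ k) (suc (length xs) ∸ k)) (length-without x cs up x∈) ⟨
      ff (length us ∸ length cs) (suc (length xs) ∸ length cs)         ∎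
    where
    open ≤-Reasoning
    k′ = length (without x cs)
    F = ff (length us ∸ suc k′) (length xs ∸ k′)
    pinned : ∀ v → (v , x) ∈ cs → ∀ u → u ∈ us → ∑ (injections xs (us ∖ (u ∷ []))) (λ a → ι (contains? cs ((u , x) ∷ a))) ≤ ι (u Finₚ.≟ v) * F
    pinned v vx u u∈ with u Finₚ.≟ v
    ... | no u≢v = ≤-reflexive (∑-zero (injections xs (us ∖ (u ∷ []))) λ a a∈ → ι-no (contains? cs ((u , x) ∷ a)) λ all →
            u≢v (proj₁ (contains-∷-pinned ut vx (notin a∈) all)))
      where
      notin : ∀ {a} → a ∈ injections xs (us ∖ (u ∷ [])) → x ∉ patterns a
      notin a∈ m = All.lookup x∉xs (subst (x ∈_) (proj₁ (injections-wf xs _ (Unique-∖ (u ∷ []) uu) a∈)) m) refl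
    ... | yes _ = ≤-trans (≤-trans (∑-mono (injections xs (us ∖ (u ∷ []))) λ a a∈ → ι-mono (contains? cs ((u , x) ∷ a)) (contains? (without x cs) a) λ all →
            proj₂ (contains-∷-pinned ut vx (notin a∈) all))
          (injections-count xs (us ∖ (u ∷ [])) (without x cs) (Unique-∖ (u ∷ []) uu) ux (Unique-map-filter proj₁ _ cs ut) (Unique-map-filter proj₂ _ cs up) (patterns-without {cs = cs} sub)))
          (≤-reflexive (trans (cong (λ m → ff m (length xs ∸ k′)) (trans (cong (_∸ k′) (length-∖₁ us uu u∈)) (∸-+-assoc (length us) 1 k′))) (sym (*-identityˡ F))))
      where
      notin : ∀ {a} → a ∈ injections xs (us ∖ (u ∷ [])) → x ∉ patterns a
      notin a∈ m = All.lookup x∉xs (subst (x ∈_) (proj₁ (injections-wf xs _ (Unique-∖ (u ∷ []) uu) a∈)) m) refl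
  -- No injection meets a prescribed target outside `us`. Otherwise the reserved targets all lie in
  -- `us`, and exactly length us ∸ k are free.
  ... | no x∉ with All.all? (_∈? us) (targets cs)
  ...   | no ¬all = ≤-trans (≤-reflexive (∑-zero (injections (x ∷ xs) us) λ a a∈ → ι-no (contains? cs a) λ inside →
            ¬all (Allₚ.map⁺ (All.map (λ c∈ → proj₂ (proj₂ (injections-wf (x ∷ xs) us uu a∈)) (∈ₚ.∈-map⁺ proj₁ c∈)) inside)))) z≤n
  ...   | yes all = begin
      count (injections (x ∷ xs) us) cs                                ≡⟨ ∑-injections x xs us _ ⟩
      ∑ us (λ u → ∑ (injections xs (us ∖ (u ∷ []))) (λ a → ι (contains? cs ((u , x) ∷ a))))   ≤⟨ ∑-mono us free ⟩
      ∑ us (λ u → ι (¬? (u ∈? targets cs)) * F)                        ≡⟨ ∑-*ʳ F us ⟨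
      ∑ us (λ u → ι (¬? (u ∈? targets cs))) * F                        ≡⟨ cong (_* F) (sym (length-filter≡∑ (λ u → ¬? (u ∈? targets cs)) us)) ⟩
      length (us ∖ targets cs) * F                                     ≡⟨ cong (_* F) remaining ⟩
      (length us ∸ k) * F                                              ≡⟨ cong (λ z → (length us ∸ k) * ff z (length xs ∸ k)) (trans (∸-+-assoc (length us) 1 k) (trans (cong (length us ∸_) (+-comm 1 k)) (sym (∸-+-assoc (length us) k 1)))) ⟩
      ff (length us ∸ k) (suc (length xs ∸ k))                         ≡⟨ cong (ff (length us ∸ k)) (sym (+-∸-assoc 1 k≤)) ⟩
      ff (length us ∸ k) (suc (length xs) ∸ k)                         ∎
    where
    open ≤-Reasoning
    k = length cs
    F = ff (length us ∸ 1 ∸ k) (length xs ∸ k)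
    sub′ : ∀ {y} → y ∈ patterns cs → y ∈ xs
    sub′ m with sub m
    ... | here refl = contradiction m x∉
    ... | there m′  = m′
    k≤ : k ≤ length xs
    k≤ = subst (_≤ length xs) (Listₚ.length-map proj₂ cs) (length-mono xs (patterns cs) ux up sub′)
    remaining : length (us ∖ targets cs) ≡ length us ∸ k
    remaining = sym (trans (cong₂ _∸_ (length-∖ us (targets cs) uu ut (λ m → All.lookup all m)) (sym (Listₚ.length-map proj₁ cs))) (m+n∸m≡n (length (targets cs)) _))
    free : ∀ u → u ∈ us → ∑ (injections xs (us ∖ (u ∷ []))) (λ a → ι (contains? cs ((u , x) ∷ a))) ≤ ι (¬? (u ∈? targets cs)) * F
    free u u∈ with u ∈? targets cs
    ... | yes ut∈ = ≤-reflexive (∑-zero (injections xs (us ∖ (u ∷ []))) λ a a∈ → ι-no (contains? cs ((u , x) ∷ a)) λ inside → avoid a∈ (contains-∷-free x∉ inside))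
      where
      avoid : ∀ {a} → a ∈ injections xs (us ∖ (u ∷ [])) → ¬ All (_∈ a) cs
      avoid a∈ inside with ∈ₚ.∈-map⁻ proj₁ ut∈
      ... | (_ , y) , c∈ , refl = proj₂ (∈-∖⁻ us (proj₂ (proj₂ (injections-wf xs _ (Unique-∖ (u ∷ []) uu) a∈)) (∈ₚ.∈-map⁺ proj₁ (All.lookup inside c∈)))) (here refl)
    ... | no _ = ≤-trans (≤-trans (∑-mono (injections xs (us ∖ (u ∷ []))) λ a _ → ι-mono (contains? cs ((u , x) ∷ a)) (contains? cs a) (contains-∷-free x∉))
          (injections-count xs (us ∖ (u ∷ [])) cs (Unique-∖ (u ∷ []) uu) ux ut up sub′))
          (≤-reflexive (trans (cong (λ m → ff (m ∸ k) (length xs ∸ k)) (length-∖₁ us uu u∈)) (sym (*-identityˡ F))))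

  injections-spread : ∀ {xs us s} → Unique us → Unique xs → length xs ≤ length us → 3 * s ≤ length us →
                      PointSpreadOn xs (injections xs us) s (ff (length us) (length xs))
  injections-spread {xs} {us} {s} uu ux xs≤us 3s≤ cs ut up sub = begin
    count (injections xs us) cs * s ^ k     ≤⟨ *-mono-≤ (injections-count xs us cs uu ux ut up sub) (s^k≤ff {s} 3s≤ (≤-trans k≤ xs≤us)) ⟩
    ff (m ∸ k) (length xs ∸ k) * ff m k     ≡⟨ *-comm _ (ff m k) ⟩
    ff m k * ff (m ∸ k) (length xs ∸ k)     ≡⟨ ff-+ m k (length xs ∸ k) ⟨
    ff m (k + (length xs ∸ k))              ≡⟨ cong (ff m) (m+[n∸m]≡n k≤) ⟩
    ff m (length xs)                        ∎
    where
    open ≤-Reasoning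
    m = length us
    k = length cs
    k≤ : k ≤ length xs
    k≤ = subst (_≤ length xs) (Listₚ.length-map proj₂ cs) (length-mono xs (patterns cs) ux up sub)

  complete : List (Placement n) → List (Fin n) → List (Fin n) → List (Placement n)
  complete as xs us = concatMap (λ a → map (_++ a) (injections xs (us ∖ targets a))) as

  ∑-complete : ∀ as xs us (f : Placement n → ℕ) → ∑ (complete as xs us) f ≡ ∑ as (λ a → ∑ (injections xs (us ∖ targets a)) (λ b → f (b ++ a)))
  ∑-complete as xs us f = trans (∑-concatMap _ as) (∑-cong as λ a _ → ∑-map (_++ a) (injections xs (us ∖ targets a)))

  complete⁻ : ∀ as xs us {c} → c ∈ complete as xs us → ∃[ a ] ∃[ b ] a ∈ as × b ∈ injections xs (us ∖ targets a) × c ≡ b ++ a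
  complete⁻ as xs us m with find (∈ₚ.∈-concatMap⁻ (λ a → map (_++ a) (injections xs (us ∖ targets a))) {xs = as} m)
  ... | a , a∈ , m′ with ∈ₚ.∈-map⁻ (_++ a) m′
  ...   | b , b∈ , refl = a , b , a∈ , b∈ , refl

  complete-length : ∀ as xs us {m} → Unique us → (∀ a → a ∈ as → length (us ∖ targets a) ≡ m) →
                    length (complete as xs us) ≡ length as * ff m (length xs)
  complete-length as xs us uu h = trans (length-concatMap _ as) (trans (∑-cong as λ a a∈ → trans (Listₚ.length-map _ (injections xs (us ∖ targets a)))
    (trans (injections-length xs _ (Unique-∖ (targets a) uu)) (cong (λ m → ff m (length xs)) (h a a∈)))) (∑-const as _))

  -- The constraints split by pattern: those in `ms` concern the partial placement, those in `xs`
  -- its completion. All partial placements have the same number of completions, so the two bounds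
  -- multiply.
  complete-spread : ∀ {as ms xs us s m M} → Unique us → Unique xs → (∀ {x} → x ∈ xs → x ∉ ms) → (∀ a → a ∈ as → patterns a ≡ ms × length (us ∖ targets a) ≡ m) →
                    length xs ≤ m → 3 * s ≤ m → PointSpreadOn ms as s M → PointSpread (complete as xs us) s (M * ff m (length xs))
  complete-spread {as} {ms} {xs} {us} {s} {m} {M} uu ux disj wf xs≤ 3s≤ spread cs ut up with All.all? (λ y → y ∈? (xs ++ ms)) (patterns cs)
  ... | no ¬all = ≤-trans (≤-reflexive (cong (_* s ^ length cs) (∑-zero (complete as xs us) λ c c∈ → ι-no (contains? cs c) λ inside → ¬all (Allₚ.map⁺ (All.map (located c∈) inside))))) z≤n
    where
    located : ∀ {c} → c ∈ complete as xs us → ∀ {p} → p ∈ c → proj₂ p ∈ xs ++ ms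
    located c∈ p∈ with complete⁻ as xs us c∈
    ... | a , b , a∈ , b∈ , refl with ∈ₚ.∈-++⁻ b p∈
    ...   | inj₁ q = ∈ₚ.∈-++⁺ˡ (subst (_ ∈_) (proj₁ (injections-wf xs _ (Unique-∖ (targets a) uu) b∈)) (∈ₚ.∈-map⁺ proj₂ q))
    ...   | inj₂ q = ∈ₚ.∈-++⁺ʳ xs (subst (_ ∈_) (proj₁ (wf a a∈)) (∈ₚ.∈-map⁺ proj₂ q))
  ... | yes all = begin
      count (complete as xs us) cs * s ^ length cs                                ≡⟨ cong₂ (λ p q → p * s ^ q) (∑-complete as xs us _) lengths ⟩
      ∑ as (λ a → ∑ (injections xs (us ∖ targets a)) (λ b → ι (contains? cs (b ++ a)))) * s ^ (k₁ + k₂)   ≤⟨ *-monoˡ-≤ _ (∑-mono as (λ a a∈ → split a a∈)) ⟩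
      ∑ as (λ a → ι (contains? cs₁ a) * count (injections xs (us ∖ targets a)) cs₂) * s ^ (k₁ + k₂)     ≡⟨ trans (cong (X *_) (trans (^-distribˡ-+-* s k₁ k₂) (*-comm (s ^ k₁) _))) (trans (sym (*-assoc X (s ^ k₂) _)) (cong (_* s ^ k₁) (∑-*ʳ (s ^ k₂) as))) ⟩
      ∑ as (λ a → ι (contains? cs₁ a) * count (injections xs (us ∖ targets a)) cs₂ * s ^ k₂) * s ^ k₁   ≤⟨ *-monoˡ-≤ (s ^ k₁) (∑-mono as (λ a a∈ → ≤-trans (≤-reflexive (*-assoc (ι (contains? cs₁ a)) _ _)) (*-monoʳ-≤ (ι (contains? cs₁ a)) (tail a a∈)))) ⟩
      ∑ as (λ a → ι (contains? cs₁ a) * ff m (length xs)) * s ^ k₁                ≡⟨ cong (_* s ^ k₁) (∑-*ʳ (ff m (length xs)) as) ⟨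
      count as cs₁ * ff m (length xs) * s ^ k₁                                    ≡⟨ lem (count as cs₁) (ff m (length xs)) (s ^ k₁) ⟩
      count as cs₁ * s ^ k₁ * ff m (length xs)                                    ≤⟨ *-monoˡ-≤ (ff m (length xs)) (spread cs₁ (Unique-map-filter proj₁ in? cs ut) (Unique-map-filter proj₂ in? cs up) in-ms) ⟩
      M * ff m (length xs)                                                        ∎
    where
    open ≤-Reasoning
    lem : ∀ a b c → a * b * c ≡ a * c * b
    lem = solve-∀
    in? : ∀ c → Dec (proj₂ c ∈ ms)
    in? c = proj₂ c ∈? ms
    cs₁ cs₂ : Placement n
    cs₁ = filter in? cs
    cs₂ = filter (λ c → ¬? (in? c)) cs
    k₁ = length cs₁
    k₂ = length cs₂
    X : ℕ
    X = ∑ as (λ a → ι (contains? cs₁ a) * count (injections xs (us ∖ targets a)) cs₂)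
    lengths : length cs ≡ k₁ + k₂
    lengths = trans (sym (∑-length cs)) (trans (∑-partition in? cs) (cong₂ _+_ (∑-length cs₁) (∑-length cs₂)))
    in-ms : ∀ {y} → y ∈ patterns cs₁ → y ∈ ms
    in-ms y∈ with pattern-∈ cs₁ y∈
    ... | v , c∈ = proj₂ (∈ₚ.∈-filter⁻ in? {xs = cs} c∈)
    in-xs : ∀ {y} → y ∈ patterns cs₂ → y ∈ xs
    in-xs y∈ with pattern-∈ cs₂ y∈
    ... | v , c∈ with ∈ₚ.∈-filter⁻ (λ c → ¬? (in? c)) {xs = cs} c∈
    ...   | c∈′ , ∉ms with ∈ₚ.∈-++⁻ xs (All.lookup all (∈ₚ.∈-map⁺ proj₂ c∈′))
    ...     | inj₁ q = q
    ...     | inj₂ q = contradiction q ∉ms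
    split : ∀ a → a ∈ as → ∑ (injections xs (us ∖ targets a)) (λ b → ι (contains? cs (b ++ a))) ≤ ι (contains? cs₁ a) * count (injections xs (us ∖ targets a)) cs₂
    split a a∈ = ≤-trans (∑-mono (injections xs (us ∖ targets a)) pt) (≤-reflexive (sym (∑-*ˡ (ι (contains? cs₁ a)) (injections xs (us ∖ targets a)))))
      where
      pt : ∀ b → b ∈ injections xs (us ∖ targets a) → ι (contains? cs (b ++ a)) ≤ ι (contains? cs₁ a) * ι (contains? cs₂ b)
      pt b b∈ with contains? cs (b ++ a)
      ... | no _       = z≤n
      ... | yes inside = ≤-reflexive (sym (cong₂ _*_ (ι-yes (contains? cs₁ a) (All.tabulate left)) (ι-yes (contains? cs₂ b) (All.tabulate right))))
        where
        left : ∀ {c} → c ∈ cs₁ → c ∈ a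
        left c∈ with ∈ₚ.∈-filter⁻ in? {xs = cs} c∈
        ... | c∈′ , ∈ms with ∈ₚ.∈-++⁻ b (All.lookup inside c∈′)
        ...   | inj₁ q = contradiction ∈ms (disj (subst (_ ∈_) (proj₁ (injections-wf xs _ (Unique-∖ (targets a) uu) b∈)) (∈ₚ.∈-map⁺ proj₂ q)))
        ...   | inj₂ q = q
        right : ∀ {c} → c ∈ cs₂ → c ∈ b
        right c∈ with ∈ₚ.∈-filter⁻ (λ c → ¬? (in? c)) {xs = cs} c∈
        ... | c∈′ , ∉ms with ∈ₚ.∈-++⁻ b (All.lookup inside c∈′)
        ...   | inj₁ q = q
        ...   | inj₂ q = contradiction (subst (_ ∈_) (proj₁ (wf a a∈)) (∈ₚ.∈-map⁺ proj₂ q)) ∉ms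
    tail : ∀ a → a ∈ as → count (injections xs (us ∖ targets a)) cs₂ * s ^ k₂ ≤ ff m (length xs)
    tail a a∈ with proj₂ (wf a a∈)
    ... | eq = subst (λ z → count (injections xs (us ∖ targets a)) cs₂ * s ^ k₂ ≤ ff z (length xs)) eq
          (injections-spread (Unique-∖ (targets a) uu) ux (subst (length xs ≤_) (sym eq) xs≤) (subst (3 * s ≤_) (sym eq) 3s≤)
            cs₂ (Unique-map-filter proj₁ (λ c → ¬? (in? c)) cs ut) (Unique-map-filter proj₂ (λ c → ¬? (in? c)) cs up) in-xs)

-- Dense pairs by density increment

abstract
  unique? : ∀ {n} (xs : List (Fin n)) → Dec (Unique xs)
  unique? = allPairs? λ x y → ¬? (x Finₚ.≟ y)

record Block {n : ℕ} (xs : List (Fin n)) (h : ℕ) : Set where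
  field
    block  : List (Fin n)
    size   : length block ≡ h
    inside : ∀ {x} → x ∈ block → x ∈ xs
    unique : Unique block

open Block

module _ {n : ℕ} where

  take-⊆ : ∀ h (xs : List (Fin n)) {x} → x ∈ take h xs → x ∈ xs
  take-⊆ h xs m = subst (_ ∈_) (Listₚ.take++drop≡id h xs) (∈ₚ.∈-++⁺ˡ m)

  drop-⊆ : ∀ h (xs : List (Fin n)) {x} → x ∈ drop h xs → x ∈ xs
  drop-⊆ h xs m = subst (_ ∈_) (Listₚ.take++drop≡id h xs) (∈ₚ.∈-++⁺ʳ (take h xs) m)

  ∑-take-drop : ∀ h (xs : List (Fin n)) (f : Fin n → ℕ) → ∑ xs f ≡ ∑ (take h xs) f + ∑ (drop h xs) f
  ∑-take-drop h xs f = trans (cong (λ l → ∑ l f) (sym (Listₚ.take++drop≡id h xs))) (∑-++ (take h xs) (drop h xs))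

  length-take≡ : ∀ h (xs : List (Fin n)) → h ≤ length xs → length (take h xs) ≡ h
  length-take≡ h xs h≤ = trans (Listₚ.length-take h xs) (m≤n⇒m⊓n≡m h≤)

  widen : ∀ {xs ys : List (Fin n)} {h} → (∀ {x} → x ∈ xs → x ∈ ys) → Block xs h → Block ys h
  widen sub b = record { block = block b ; size = size b ; inside = sub ∘ inside b ; unique = unique b }

  takeBlock : ∀ h xs → Unique xs → h ≤ length xs → Block xs h
  takeBlock h xs u h≤ = record { block = take h xs ; size = length-take≡ h xs h≤ ; inside = take-⊆ h xs ; unique = Uniqueₚ.take⁺ h u }

  -- Pigeonhole over consecutive blocks of length h. The scale `c` carries the denominator of a
  -- density.
  heavy-block : ∀ q h c z xs (f : Fin n → ℕ) → Unique xs → length xs ≡ suc q * h → suc q * z ≤ c * ∑ xs f →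
                Σ (Block xs h) λ b → z ≤ c * ∑ (block b) f
  heavy-block zero h c z xs f u len heavy =
    record { block = xs ; size = trans len (*-identityˡ h) ; inside = id ; unique = u } , subst (_≤ _) (*-identityˡ z) heavy
  heavy-block (suc q) h c z xs f u len heavy with z ≤? c * ∑ (take h xs) f
  ... | yes z≤ = takeBlock h xs u (subst (h ≤_) (sym len) (m≤m+n h _)) , z≤
  ... | no z≰ = let b , z≤ = heavy-block q h c z (drop h xs) f (Uniqueₚ.drop⁺ h u)
                                 (trans (Listₚ.length-drop h xs) (trans (cong (_∸ h) len) (m+n∸m≡n h (suc q * h)))) rest
                in widen (drop-⊆ h xs) b , z≤
    where
    open ≤-Reasoning
    rest : suc q * z ≤ c * ∑ (drop h xs) f
    rest = +-cancelˡ-≤ z _ _ (begin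
      z + suc q * z                                        ≤⟨ heavy ⟩
      c * ∑ xs f                                           ≡⟨ trans (cong (c *_) (∑-take-drop h xs f)) (*-distribˡ-+ c _ _) ⟩
      c * ∑ (take h xs) f + c * ∑ (drop h xs) f            ≤⟨ +-monoˡ-≤ _ (<⇒≤ (≰⇒> z≰)) ⟩
      z + c * ∑ (drop h xs) f                              ∎)

  -- When h need not divide the length, the last incomplete block contributes at most c h B; the
  -- extra term in the hypothesis pays for it.
  heavy-block′ : ∀ q h c z B xs (f : Fin n → ℕ) → Unique xs → length xs ≤ q * h → (∀ x → f x ≤ B) → q * z + c * (h * B) < c * ∑ xs f →
                 Σ (Block xs h) λ b → z ≤ c * ∑ (block b) f
  heavy-block′ q h c z B xs f u len f≤B heavy with h ≤? length xs
  ... | no h≰ = contradiction (≤-trans (*-monoʳ-≤ c (≤-trans (∑-≤const xs λ x _ → f≤B x) (*-monoˡ-≤ B (<⇒≤ (≰⇒> h≰))))) (m≤n+m _ (q * z))) (<⇒≱ heavy)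
  heavy-block′ zero h c z B [] f u len f≤B heavy | yes _ = contradiction (subst (c * (h * B) <_) (*-zeroʳ c) heavy) λ ()
  heavy-block′ (suc q) h c z B xs f u len f≤B heavy | yes h≤ with z ≤? c * ∑ (take h xs) f
  ... | yes z≤ = takeBlock h xs u h≤ , z≤
  ... | no z≰ = let b , z≤ = heavy-block′ q h c z B (drop h xs) f (Uniqueₚ.drop⁺ h u)
                                 (≤-trans (≤-reflexive (Listₚ.length-drop h xs)) (m≤n+o⇒m∸n≤o (length xs) h len)) f≤B rest
                in widen (drop-⊆ h xs) b , z≤
    where
    open ≤-Reasoning
    rest : q * z + c * (h * B) < c * ∑ (drop h xs) f
    rest = +-cancelˡ-< z _ _ (begin-strict
      z + (q * z + c * (h * B))                            ≡⟨ +-assoc z _ _ ⟨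
      suc q * z + c * (h * B)                              <⟨ heavy ⟩
      c * ∑ xs f                                           ≡⟨ trans (cong (c *_) (∑-take-drop h xs f)) (*-distribˡ-+ c _ _) ⟩
      c * ∑ (take h xs) f + c * ∑ (drop h xs) f            ≤⟨ +-monoˡ-≤ _ (<⇒≤ (≰⇒> z≰)) ⟩
      z + c * ∑ (drop h xs) f                              ∎)

  module _ (G : Adj n) where

    e : List (Fin n) → List (Fin n) → ℕ
    e xs ys = ∑ xs (λ x → ∑ ys (λ y → ι (G x y ≟ᵇ true)))

    e-swap : ∀ xs ys → e xs ys ≡ ∑ ys (λ y → ∑ xs (λ x → ι (G x y ≟ᵇ true)))
    e-swap xs ys = ∑-swap xs ys

    e-col≤ : ∀ xs y → ∑ xs (λ x → ι (G x y ≟ᵇ true)) ≤ length xs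
    e-col≤ xs y = ≤-trans (∑-≤const xs λ x _ → ι≤1 (G x y ≟ᵇ true)) (≤-reflexive (*-identityʳ _))

    e-row≤ : ∀ ys x → ∑ ys (λ y → ι (G x y ≟ᵇ true)) ≤ length ys
    e-row≤ ys x = ≤-trans (∑-≤const ys λ y _ → ι≤1 (G x y ≟ᵇ true)) (≤-reflexive (*-identityʳ _))

    e≤ : ∀ xs ys → e xs ys ≤ length xs * length ys
    e≤ xs ys = ∑-≤const xs λ x _ → e-row≤ ys x

    e-∖ˡ : ∀ {xs ps} ys → Unique xs → Unique ps → (∀ {x} → x ∈ ps → x ∈ xs) → e xs ys ≡ e ps ys + e (xs ∖ ps) ys
    e-∖ˡ {xs} {ps} ys ux up sub = ∑-∖ xs ps (λ x → ∑ ys (λ y → ι (G x y ≟ᵇ true))) ux up sub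

    e-∖ʳ : ∀ xs {ys ps} → Unique ys → Unique ps → (∀ {y} → y ∈ ps → y ∈ ys) → e xs ys ≡ e xs ps + e xs (ys ∖ ps)
    e-∖ʳ xs {ys} {ps} uy up sub = trans (∑-cong xs λ x _ → ∑-∖ ys ps (λ y → ι (G x y ≟ᵇ true)) uy up sub) (∑-+ xs)

    -- For |X| = |Y| = 4 h the average over pairs of blocks is e X Y / 16. With m = 31, the value
    -- used in the end, robustness guarantees half of it.
    Robust : (m h : ℕ) → List (Fin n) → List (Fin n) → Set
    Robust m h X Y = ∀ (P : Block X h) (Q : Block Y h) → e X Y ≤ suc m * e (block P) (block Q)

    -- If one of the 16 cells of a 4 × 4 partition is sparse, some other cell is denser than average.
    densify : ∀ m X Y h → Unique X → Unique Y → length X ≡ 4 * h → length Y ≡ 4 * h →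
              Robust m h X Y ⊎ ∃[ P ] ∃[ Q ] m * e X Y ≤ 15 * suc m * e (block {xs = X} {h} P) (block {xs = Y} {h} Q)
    densify m X Y h uX uY lX lY with searchList (λ P → unique? P ×-dec Any.any? (λ Q → unique? Q ×-dec (suc m * e P Q <? e X Y)) (words h Y)) (words h X)
    ... | inj₂ none = inj₁ λ P Q → ≮⇒≥ λ sparse → none (block P) (subst (λ k → block P ∈ words k X) (size P) (∈-words X (block P) (inside P)))
            (unique P , lose (subst (λ k → block Q ∈ words k Y) (size Q) (∈-words Y (block Q) (inside Q))) (unique Q , sparse))
    ... | inj₁ (P , P∈ , uP , some) with find some
    ...   | Q , Q∈ , uQ , sparse = inj₂ denser
      where
      P⊆ = proj₂ (words-∈ h X P∈)
      Q⊆ = proj₂ (words-∈ h Y Q∈)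
      lP = proj₁ (words-∈ h X P∈)
      lQ = proj₁ (words-∈ h Y Q∈)
      P′ = X ∖ P
      Q′ = Y ∖ Q
      Z = m * e X Y
      c = 15 * suc m
      complement : ∀ {X P} → Unique X → Unique P → (∀ {x} → x ∈ P → x ∈ X) → length X ≡ 4 * h → length P ≡ h → length (X ∖ P) ≡ 3 * h
      complement {X} {P} uX uP sub lX lP = +-cancelˡ-≡ h _ _ (trans (cong (_+ length (X ∖ P)) (sym lP)) (trans (sym (length-∖ X P uX uP sub)) lX))
      lP′ : length P′ ≡ 3 * h
      lP′ = complement uX uP P⊆ lX lP
      lQ′ : length Q′ ≡ 3 * h
      lQ′ = complement uY uQ Q⊆ lY lQ
      exact : ∀ {X P} → Unique P → (∀ {x} → x ∈ P → x ∈ X) → length P ≡ h → Block X h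
      exact uP sub lP = record { block = _ ; size = lP ; inside = sub ; unique = uP }
      total : e X Y ≡ e P Q + e P Q′ + (e P′ Q + e P′ Q′)
      total = trans (e-∖ˡ Y uX uP P⊆) (cong₂ _+_ (e-∖ʳ P uY uQ Q⊆) (e-∖ʳ P′ uY uQ Q⊆))
      denser : ∃[ P ] ∃[ Q ] m * e X Y ≤ c * e (block {xs = X} {h} P) (block {xs = Y} {h} Q)
      -- The 15 cells other than P × Q form strips of 3, 3 and 9 cells. Together they carry more
      -- than m / (m + 1) of the edges, so some strip reaches its share at Z = m e(X, Y) per cell on
      -- the scale c; pigeonhole inside the strip isolates a single cell.
      denser with 3 * Z ≤? c * e P Q′ | 3 * Z ≤? c * e P′ Q | 3 * (3 * Z) ≤? c * e P′ Q′
      ... | yes d | _ | _ = let b , z≤ = heavy-block 2 h c Z Q′ (λ y → ∑ P (λ x → ι (G x y ≟ᵇ true))) (Unique-∖ Q uY) lQ′ (subst (λ t → 3 * Z ≤ c * t) (e-swap P Q′) d) in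
              exact uP P⊆ lP , widen (proj₁ ∘ ∈-∖⁻ Y) b , subst (λ t → Z ≤ c * t) (sym (e-swap P (block b))) z≤
      ... | no _ | yes d | _ = let b , z≤ = heavy-block 2 h c Z P′ (λ x → ∑ Q (λ y → ι (G x y ≟ᵇ true))) (Unique-∖ P uX) lP′ d in
              widen (proj₁ ∘ ∈-∖⁻ X) b , exact uQ Q⊆ lQ , z≤
      ... | no _ | no _ | yes d =
              let b , z≤ = heavy-block 2 h c (3 * Z) P′ (λ x → ∑ Q′ (λ y → ι (G x y ≟ᵇ true))) (Unique-∖ P uX) lP′ d
                  b′ , z′≤ = heavy-block 2 h c Z Q′ (λ y → ∑ (block b) (λ x → ι (G x y ≟ᵇ true))) (Unique-∖ Q uY) lQ′ (subst (λ t → 3 * Z ≤ c * t) (e-swap (block b) Q′) z≤) in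
              widen (proj₁ ∘ ∈-∖⁻ X) b , widen (proj₁ ∘ ∈-∖⁻ Y) b′ , subst (λ t → Z ≤ c * t) (sym (e-swap (block b) (block b′))) z′≤
      ... | no ¬a | no ¬b | no ¬c = contradiction (begin-strict
              c * e X Y                                                          ≡⟨ cong (c *_) total ⟩
              c * (e P Q + e P Q′ + (e P′ Q + e P′ Q′))                           ≡⟨ lem₁ (e P Q) (e P Q′) (e P′ Q) (e P′ Q′) ⟩
              15 * (suc m * e P Q) + (c * e P Q′ + (c * e P′ Q + c * e P′ Q′))   <⟨ +-mono-≤-< (*-monoʳ-≤ 15 (<⇒≤ sparse)) (+-mono-< (≰⇒> ¬a) (+-mono-< (≰⇒> ¬b) (≰⇒> ¬c))) ⟩
              15 * e X Y + (3 * Z + (3 * Z + 3 * (3 * Z)))                          ≡⟨ lem₂ (e X Y) ⟩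
              c * e X Y                                                          ∎) (<-irrefl refl)
        where
        open ≤-Reasoning
        lem₁′ : ∀ k a b c d → 15 * k * (a + b + (c + d)) ≡ 15 * (k * a) + (15 * k * b + (15 * k * c + 15 * k * d))
        lem₁′ = solve-∀
        lem₁ : ∀ a b c d → 15 * suc m * (a + b + (c + d)) ≡ 15 * (suc m * a) + (15 * suc m * b + (15 * suc m * c + 15 * suc m * d))
        lem₁ = lem₁′ (suc m)
        lem₂′ : ∀ m t → 15 * t + (3 * (m * t) + (3 * (m * t) + 3 * (3 * (m * t)))) ≡ 15 * (1 + m) * t
        lem₂′ = solve-∀
        lem₂ : ∀ t → 15 * t + (3 * (m * t) + (3 * (m * t) + 3 * (3 * (m * t)))) ≡ 15 * suc m * t
        lem₂ = lem₂′ m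

    record RobustPair (p m : ℕ) (X Y : List (Fin n)) (J h₀ : ℕ) : Set where
      field
        {h}     : ℕ
        left    : Block X (4 * h)
        right   : Block Y (4 * h)
        robust  : Robust m h (block left) (block right)
        dense   : p ^ J * (4 * h * (4 * h)) ≤ m ^ J * e (block left) (block right)
        h₀≤h    : h₀ ≤ h

    -- A step multiplies the density by at least 16 m / (15 (m + 1)) = m / p and divides the side by
    -- 4. The invariant says that the density exceeds (p / m)^J with J steps left; at J = 0 it would
    -- exceed 1. So robustness occurs earlier, and `p ≤ m` lets the density bound be stated with the
    -- initial J.
    densify* : ∀ {p m} → p ≤ m → 15 * suc m ≡ 16 * p → ∀ J X Y h₀ → 0 < h₀ → Unique X → Unique Y → length X ≡ 4 ^ J * h₀ → length Y ≡ 4 ^ J * h₀ →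
               p ^ J * (length X * length X) < m ^ J * e X Y → RobustPair p m X Y J h₀
    densify* _ _ zero X Y h₀ h₀>0 uX uY lX lY d = contradiction (≤-trans (e≤ X Y) (≤-reflexive (cong (length X *_) (trans lY (sym lX)))))
      (<⇒≱ (subst₂ _<_ (*-identityˡ _) (*-identityˡ _) d))
    densify* {p} {m} p≤m ratio (suc J) X Y h₀ h₀>0 uX uY lX lY d with densify m X Y (4 ^ J * h₀) uX uY (trans lX (*-assoc 4 (4 ^ J) h₀)) (trans lY (*-assoc 4 (4 ^ J) h₀))
    ... | inj₁ r = record
      { h = 4 ^ J * h₀
      ; left = record { block = X ; size = trans lX (*-assoc 4 (4 ^ J) h₀) ; inside = id ; unique = uX }
      ; right = record { block = Y ; size = trans lY (*-assoc 4 (4 ^ J) h₀) ; inside = id ; unique = uY }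
      ; robust = r
      ; dense = <⇒≤ (subst (λ z → p ^ suc J * (z * z) < m ^ suc J * e X Y) (trans lX (*-assoc 4 (4 ^ J) h₀)) d)
      ; h₀≤h = ≤-trans (≤-reflexive (sym (*-identityˡ h₀))) (*-monoˡ-≤ h₀ (m^n>0 4 J)) }
    ... | inj₂ (P , Q , denser) = record
      { h = R.h ; left = widen (inside P) R.left ; right = widen (inside Q) R.right ; robust = R.robust
      ; dense = ≤-trans (≤-reflexive (*-assoc p (p ^ J) _)) (≤-trans (*-mono-≤ p≤m R.dense) (≤-reflexive (sym (*-assoc m (m ^ J) _))))
      ; h₀≤h = R.h₀≤h }
      where
      open ≤-Reasoning
      h = 4 ^ J * h₀
      c = 15 * suc m
      lem₁ : ∀ p a b → 16 * p * (a * (b * b)) ≡ p * a * (4 * b * (4 * b))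
      lem₁ = solve-∀
      lem₂ : ∀ m a b → m * a * b ≡ a * (m * b)
      lem₂ = solve-∀
      lem₃ : ∀ a b c → a * (c * b) ≡ c * (a * b)
      lem₃ = solve-∀
      instance
        nz : NonZero c
        nz = m*n≢0 15 (suc m)
      d′ : p ^ J * (length (block P) * length (block P)) < m ^ J * e (block P) (block Q)
      d′ = *-cancelˡ-< c _ _ (begin-strict
        c * (p ^ J * (length (block P) * length (block P)))       ≡⟨ cong₂ (λ c z → c * (p ^ J * (z * z))) ratio (size P) ⟩
        16 * p * (p ^ J * (h * h))                                ≡⟨ lem₁ p (p ^ J) h ⟩
        p ^ suc J * (4 * h * (4 * h))                             ≡⟨ cong (λ z → p ^ suc J * (z * z)) (trans lX (*-assoc 4 (4 ^ J) h₀)) ⟨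
        p ^ suc J * (length X * length X)                         <⟨ d ⟩
        m * m ^ J * e X Y                                         ≡⟨ lem₂ m (m ^ J) (e X Y) ⟩
        m ^ J * (m * e X Y)                                       ≤⟨ *-monoʳ-≤ (m ^ J) denser ⟩
        m ^ J * (c * e (block P) (block Q))                       ≡⟨ lem₃ (m ^ J) (e (block P) (block Q)) c ⟩
        c * (m ^ J * e (block P) (block Q))                       ∎)
      module R = RobustPair (densify* p≤m ratio J (block P) (block Q) h₀ h₀>0 (unique P) (unique Q) (size P) (size Q) d′)

    -- A cut containing half of the edges

    record Bipartition (vs : List (Fin n)) : Set where
      field
        A B    : List (Fin n)
        ⊆vs    : ∀ {x} → x ∈ A ++ B → x ∈ vs
        distinct : Unique (A ++ B)
        splits : ∀ f → ∑ vs f ≡ ∑ A f + ∑ B f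
        cut    : e vs vs ≤ 4 * e A B

    module _ (symG : ∀ u v → G u v ≡ G v u) (irr : ∀ u → G u u ≡ false) where

      e-∷∷ : ∀ v vs → e (v ∷ vs) (v ∷ vs) ≡ e vs vs + 2 * e (v ∷ []) vs
      e-∷∷ v vs = trans (cong₂ _+_ (cong (_+ d) (cong (λ b → ι (b ≟ᵇ true)) (irr v))) (trans (∑-+ vs) (cong (_+ e vs vs) col)))
        (lem d (e vs vs))
        where
        d = ∑ vs (λ y → ι (G v y ≟ᵇ true))
        col : ∑ vs (λ x → ι (G x v ≟ᵇ true)) ≡ d
        col = ∑-cong vs λ x _ → cong (λ b → ι (b ≟ᵇ true)) (symG x v)
        lem : ∀ d t → d + (d + t) ≡ t + 2 * (d + 0)
        lem = solve-∀

      -- Each vertex joins the side where it has fewer neighbours, so at least half of its edges to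
      -- the vertices already placed cross. `e vs vs` counts every edge twice, hence the 4.
      bipartition : ∀ vs → Unique vs → Bipartition vs
      bipartition [] _ = record { A = [] ; B = [] ; ⊆vs = λ () ; distinct = [] ; splits = λ _ → refl ; cut = z≤n }
      bipartition (v ∷ vs) (new ∷ u) with bipartition vs u
      ... | S with ≤-total (e (v ∷ []) (Bipartition.A S)) (e (v ∷ []) (Bipartition.B S))
      ...   | inj₁ A≤B = record
          { A = v ∷ A ; B = B
          ; ⊆vs = λ { (here refl) → here refl ; (there m) → there (⊆vs m) }
          ; distinct = ∉⇒All≢ (λ m → All.lookup new (⊆vs m) refl) ∷ distinct
          ; splits = λ f → trans (cong (f v +_) (splits f)) (sym (+-assoc (f v) _ _))
          ; cut = begin
              e (v ∷ vs) (v ∷ vs)                            ≡⟨ e-∷∷ v vs ⟩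
              e vs vs + 2 * e (v ∷ []) vs                    ≤⟨ +-mono-≤ cut (*-monoʳ-≤ 2 (≤-reflexive (trans (+-identityʳ _) (trans (splits (λ y → ι (G v y ≟ᵇ true))) (cong₂ _+_ (sym (+-identityʳ (∑ A (λ y → ι (G v y ≟ᵇ true))))) (sym (+-identityʳ (∑ B (λ y → ι (G v y ≟ᵇ true)))))))))) ⟩
              4 * e A B + 2 * (e (v ∷ []) A + e (v ∷ []) B)  ≤⟨ +-monoʳ-≤ (4 * e A B) (*-monoʳ-≤ 2 (+-monoˡ-≤ _ A≤B)) ⟩
              4 * e A B + 2 * (e (v ∷ []) B + e (v ∷ []) B)  ≡⟨ lem (e A B) (∑ B (λ y → ι (G v y ≟ᵇ true))) ⟩
              4 * e (v ∷ A) B                                ∎ }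
        where
        open Bipartition S
        open ≤-Reasoning
        lem : ∀ a b → 4 * a + 2 * (b + 0 + (b + 0)) ≡ 4 * (b + a)
        lem = solve-∀
      ...   | inj₂ B≤A = record
          { A = A ; B = v ∷ B
          ; ⊆vs = λ m → case ∈ₚ.∈-++⁻ A m of λ { (inj₁ q) → there (⊆vs (∈ₚ.∈-++⁺ˡ q)) ; (inj₂ (here refl)) → here refl ; (inj₂ (there q)) → there (⊆vs (∈ₚ.∈-++⁺ʳ A q)) }
          ; distinct = Uniqueₚ.++⁺ (Unique-++⁻ˡ A distinct) (∉⇒All≢ (λ m → All.lookup new (⊆vs (∈ₚ.∈-++⁺ʳ A m)) refl) ∷ Unique-++⁻ʳ A distinct)
                λ { (p , here refl) → All.lookup new (⊆vs (∈ₚ.∈-++⁺ˡ p)) refl ; (p , there q) → Unique-++-disjoint A distinct p q }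
          ; splits = λ f → trans (cong (f v +_) (splits f)) (lem′ (f v) (∑ A f) (∑ B f))
          ; cut = begin
              e (v ∷ vs) (v ∷ vs)                            ≡⟨ e-∷∷ v vs ⟩
              e vs vs + 2 * e (v ∷ []) vs                    ≤⟨ +-mono-≤ cut (*-monoʳ-≤ 2 (≤-reflexive (trans (+-identityʳ _) (trans (splits (λ y → ι (G v y ≟ᵇ true))) (cong₂ _+_ (sym (+-identityʳ (∑ A (λ y → ι (G v y ≟ᵇ true))))) (sym (+-identityʳ (∑ B (λ y → ι (G v y ≟ᵇ true)))))))))) ⟩
              4 * e A B + 2 * (e (v ∷ []) A + e (v ∷ []) B)  ≤⟨ +-monoʳ-≤ (4 * e A B) (*-monoʳ-≤ 2 (+-monoʳ-≤ (e (v ∷ []) A) B≤A)) ⟩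
              4 * e A B + 2 * (e (v ∷ []) A + e (v ∷ []) A)  ≡⟨ lem (e A B) (∑ A (λ y → ι (G v y ≟ᵇ true))) ⟩
              4 * (∑ A (λ y → ι (G v y ≟ᵇ true)) + e A B)    ≡⟨ cong (λ z → 4 * (z + e A B)) (∑-cong A λ x _ → cong (λ b → ι (b ≟ᵇ true)) (symG v x)) ⟩
              4 * (∑ A (λ x → ι (G x v ≟ᵇ true)) + e A B)    ≡⟨ cong (4 *_) (∑-+ A) ⟨
              4 * e A (v ∷ B)                                ∎ }
        where
        open Bipartition S
        open ≤-Reasoning
        lem : ∀ a b → 4 * a + 2 * (b + 0 + (b + 0)) ≡ 4 * (b + a)
        lem = solve-∀
        lem′ : ∀ a b c → a + (b + c) ≡ b + (a + c)
        lem′ = solve-∀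

factor>0 : ∀ a {b k} → 0 < k → k ≤ a * b → 0 < a
factor>0 zero    k>0 k≤ = contradiction (≤-trans k>0 k≤) λ ()
factor>0 (suc a) _   _  = s≤s z≤n
-- Bernoulli's inequality 1 + J / p ≤ (1 + 1 / p)^J with denominators cleared.
bernoulli : ∀ p J → p ^ J * (p + J) ≤ p * suc p ^ J
bernoulli p zero    = ≤-reflexive (trans (*-identityˡ (p + 0)) (trans (+-identityʳ p) (sym (*-identityʳ p))))
bernoulli p (suc J) = begin
  p * p ^ J * (p + suc J)                   ≤⟨ m≤m+n _ (p ^ J * J) ⟩
  p * p ^ J * (p + suc J) + p ^ J * J       ≡⟨ lem p (p ^ J) J ⟩
  suc p * (p ^ J * (p + J))                 ≤⟨ *-monoʳ-≤ (suc p) (bernoulli p J) ⟩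
  suc p * (p * suc p ^ J)                   ≡⟨ lem′ p (suc p ^ J) ⟩
  p * suc p ^ suc J                         ∎
  where
  open ≤-Reasoning
  lem : ∀ p q J → p * q * (p + (1 + J)) + q * J ≡ (1 + p) * (q * (p + J))
  lem = solve-∀
  lem′ : ∀ p q → (1 + p) * (p * q) ≡ p * ((1 + p) * q)
  lem′ = solve-∀

-- The sides have size 4 h because a matching of up to 3 h edges will be removed: h vertices then
-- remain on each side, which is what `dense` asks for. `64h≤n` leaves room outside the pair for the
-- first round.
record DensePair {n : ℕ} (G : Adj n) (K D : ℕ) : Set where
  field
    h        : ℕ
    X Y      : List (Fin n)
    distinct : Unique (X ++ Y)
    ∣X∣       : length X ≡ 4 * h
    ∣Y∣       : length Y ≡ 4 * h
    n≤Kh     : n ≤ K * h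
    64h≤n    : 64 * h ≤ n
    dense    : (P : Block X h) (Q : Block Y h) → h * h ≤ D * e G (block P) (block Q)

module _ {n : ℕ} (G : Adj n) (symG : ∀ u v → G u v ≡ G v u) (irr : ∀ u → G u u ≡ false) where

  initial-pair : ∀ c₀ w → .{{_ : NonZero w}} → 0 < n → n * n ≤ c₀ * e G (allFin n) (allFin n) → (128 * c₀) * w ≤ n →
    ∃[ X ] ∃[ Y ] Unique (X ++ Y) × length X ≡ w × length Y ≡ w × w * w ≤ (128 * c₀) * e G X Y
  initial-pair c₀ w n>0 dense cw≤n = block X , block Y , Uniqueₚ.++⁺ (unique X) (unique Y) (λ (p , q) → Unique-++-disjoint A distinct (inside X p) (inside Y q)) ,
      size X , size Y , subst (λ t → w * w ≤ c * t) (sym (e-swap G (block X) (block Y))) (proj₂ step₂)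
    where
    open Bipartition (bipartition G symG irr (allFin n) (allFin-unique n))
    open ≤-Reasoning
    c = 128 * c₀
    q = suc (n / w)
    -- Exactly what the second application of `heavy-block′` asks of the first; the 1 provides its
    -- strict inequality.
    z = q * (w * w) + c * (w * w) + 1
    n≤qw : n ≤ q * w
    n≤qw = ≤-trans (m≤n*[1+m/n] n w) (≤-reflexive (*-comm w q))
    c>0 : 0 < c₀
    c>0 = factor>0 c₀ (*-mono-≤ n>0 n>0) dense
    w≤n : w ≤ n
    w≤n = ≤-trans (≤-trans (≤-reflexive (sym (*-identityˡ w))) (*-monoˡ-≤ w (*-mono-≤ {1} {128} (s≤s z≤n) c>0))) cw≤n
    qw≤ : q * w ≤ 2 * n
    qw≤ = ≤-trans (+-mono-≤ w≤n (m/n*n≤m n w)) (≤-reflexive (cong (n +_) (sym (+-identityʳ n))))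
    q≤ : q ≤ 2 * n
    q≤ = ≤-trans (≤-trans (≤-reflexive (sym (*-identityʳ q))) (*-monoʳ-≤ q (>-nonZero⁻¹ w))) qw≤
    n≤n² : n ≤ n * n
    n≤n² = ≤-trans (≤-reflexive (sym (*-identityʳ n))) (*-monoʳ-≤ n n>0)
    lem : ∀ q w c n → q * (q * (w * w) + c * (w * w) + 1) + c * (w * n) ≡ q * w * (q * w) + c * w * (q * w) + q + c * w * n
    lem = solve-∀
    lem′ : ∀ n → 2 * n * (2 * n) + n * (2 * n) + 2 * n + n * n ≡ 7 * (n * n) + 2 * n
    lem′ = solve-∀
    lem″ : ∀ a → 7 * a + 2 * a + 23 * a ≡ 32 * a
    lem″ = solve-∀
    -- The cut gives c e(A, B) ≥ 32 n², while all the losses from cutting into blocks add up to at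
    -- most 9 n².
    heavy : q * z + c * (w * n) < c * e G A B
    heavy = begin-strict
      q * z + c * (w * n)                                       ≡⟨ lem q w c n ⟩
      q * w * (q * w) + c * w * (q * w) + q + c * w * n         ≤⟨ +-mono-≤ (+-mono-≤ (+-mono-≤ (*-mono-≤ qw≤ qw≤) (*-mono-≤ cw≤n qw≤)) q≤) (*-monoˡ-≤ n cw≤n) ⟩
      2 * n * (2 * n) + n * (2 * n) + 2 * n + n * n             ≡⟨ lem′ n ⟩
      7 * (n * n) + 2 * n                                       ≤⟨ +-monoʳ-≤ (7 * (n * n)) (*-monoʳ-≤ 2 n≤n²) ⟩
      7 * (n * n) + 2 * (n * n)                                 <⟨ m<m+n _ (*-mono-≤ {1} {23} (s≤s z≤n) (*-mono-≤ n>0 n>0)) ⟩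
      7 * (n * n) + 2 * (n * n) + 23 * (n * n)                  ≡⟨ lem″ (n * n) ⟩
      32 * (n * n)                                              ≤⟨ *-monoʳ-≤ 32 (≤-trans dense (*-monoʳ-≤ c₀ cut)) ⟩
      32 * (c₀ * (4 * e G A B))                                 ≡⟨ lem‴ c₀ (e G A B) ⟩
      c * e G A B                                               ∎
      where
      lem‴ : ∀ c t → 32 * (c * (4 * t)) ≡ 128 * c * t
      lem‴ = solve-∀
    step₁ : Σ (Block A w) λ b → z ≤ c * ∑ (block b) (λ x → ∑ B (λ y → ι (G x y ≟ᵇ true)))
    step₁ = heavy-block′ q w c z n A _ (Unique-++⁻ˡ A distinct) (≤-trans (length≤n A (Unique-++⁻ˡ A distinct)) n≤qw)
              (λ x → ≤-trans (e-row≤ G B x) (length≤n B (Unique-++⁻ʳ A distinct))) heavy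
    X : Block A w
    X = proj₁ step₁
    step₂ : Σ (Block B w) λ b → w * w ≤ c * ∑ (block b) (λ y → ∑ (block X) (λ x → ι (G x y ≟ᵇ true)))
    step₂ = heavy-block′ q w c (w * w) w B _ (Unique-++⁻ʳ A distinct) (≤-trans (length≤n B (Unique-++⁻ʳ A distinct)) n≤qw)
              (λ y → ≤-trans (e-col≤ G (block X) y) (≤-reflexive (size X)))
              (subst (q * (w * w) + c * (w * w) <_) (cong (c *_) (e-swap G (block X) B)) (≤-trans (≤-reflexive (+-comm 1 _)) (proj₂ step₁)))
    Y : Block B w
    Y = proj₁ step₂

  -- The initial density is at least 1 / c, and by Bernoulli p * c increments by the factor 1 + 1 /
  -- p multiply it by at least 1 + c. So the increments must stop within `depth` steps. In the final
  -- constant one factor comes from the density then guaranteed, the factor p + 2 from robustness.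
  dense-pair′ : ∀ p → .{{_ : NonZero p}} → 15 * suc (suc p) ≡ 16 * p → ∀ c₀ → let c = 128 * c₀ ; depth = p * c in .{{_ : NonZero (c * 4 ^ depth)}} →
    c * 4 ^ depth ≤ n → n * n ≤ c₀ * e G (allFin n) (allFin n) → DensePair G (2 * (c * 4 ^ depth)) (suc p ^ depth * suc (suc p))
  dense-pair′ p ratio c₀ K≤n dense-G = record
    { h = h ; X = block left ; Y = block right
    ; distinct = Uniqueₚ.++⁺ (unique left) (unique right) (λ (a , b) → Unique-++-disjoint X₀ uXY (inside left a) (inside right b))
    ; ∣X∣ = size left ; ∣Y∣ = size right
    ; n≤Kh = begin
        n                              ≤⟨ m≤n*[1+m/n] n K ⟩
        K * suc h₀                     ≤⟨ *-monoʳ-≤ K (+-monoˡ-≤ h₀ h₀>0) ⟩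
        K * (h₀ + h₀)                  ≡⟨ lem₁ K h₀ ⟩
        2 * K * h₀                     ≤⟨ *-monoʳ-≤ (2 * K) h₀≤h ⟩
        2 * K * h                      ∎
    ; 64h≤n = begin
        64 * h                         ≤⟨ *-mono-≤ {64} {128} (m≤m+n 64 64) (≤-trans (m≤m+n h _) (≤-reflexive (sym (size left)))) ⟩
        128 * length (block left)      ≤⟨ *-monoʳ-≤ 128 (≤-trans (length-mono X₀ (block left) (Unique-++⁻ˡ X₀ uXY) (unique left) (inside left)) (≤-reflexive lX)) ⟩
        128 * w                        ≤⟨ *-monoˡ-≤ w (≤-trans (≤-reflexive (sym (*-identityʳ 128))) (*-monoʳ-≤ 128 c₀>0)) ⟩
        c * w                          ≤⟨ cw≤n ⟩
        n                              ∎
    ; dense = λ P Q → begin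
        h * h                                          ≤⟨ m≤n*m (h * h) (16 * p ^ depth) {{m*n≢0 16 (p ^ depth) {{_}} {{m^n≢0 p depth}}}} ⟩
        16 * p ^ depth * (h * h)                           ≡⟨ lem₂ (p ^ depth) h ⟩
        p ^ depth * (4 * h * (4 * h))                      ≤⟨ dense ⟩
        suc p ^ depth * e G (block left) (block right)     ≤⟨ *-monoʳ-≤ (suc p ^ depth) (robust P Q) ⟩
        suc p ^ depth * (suc (suc p) * e G (block P) (block Q))  ≡⟨ *-assoc (suc p ^ depth) (suc (suc p)) _ ⟨
        suc p ^ depth * suc (suc p) * e G (block P) (block Q)    ∎
    }
    where
    open ≤-Reasoning
    c = 128 * c₀
    depth = p * c
    K = c * 4 ^ depth
    h₀ = n / K
    w = 4 ^ depth * h₀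
    lem₁ : ∀ a b → a * (b + b) ≡ 2 * a * b
    lem₁ = solve-∀
    lem₂ : ∀ a b → 16 * a * (b * b) ≡ a * (4 * b * (4 * b))
    lem₂ = solve-∀
    K>0 : 0 < K
    K>0 = >-nonZero⁻¹ K
    n>0 : 0 < n
    n>0 = ≤-trans K>0 K≤n
    c₀>0 : 0 < c₀
    c₀>0 = factor>0 c₀ (*-mono-≤ n>0 n>0) dense-G
    h₀>0 : 0 < h₀
    h₀>0 = m≥n⇒m/n>0 K≤n
    w>0 : 0 < w
    w>0 = *-mono-≤ (m^n>0 4 depth) h₀>0
    instance
      w≢0 : NonZero w
      w≢0 = >-nonZero w>0
    cw≤n : c * w ≤ n
    cw≤n = ≤-trans (≤-reflexive (trans (sym (*-assoc c (4 ^ depth) h₀)) (*-comm K h₀))) (m/n*n≤m n K)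
    initial = initial-pair c₀ w n>0 dense-G cw≤n
    X₀ = proj₁ initial
    Y₀ = proj₁ (proj₂ initial)
    uXY = proj₁ (proj₂ (proj₂ initial))
    lX = proj₁ (proj₂ (proj₂ (proj₂ initial)))
    lY = proj₁ (proj₂ (proj₂ (proj₂ (proj₂ initial))))
    w²≤ = proj₂ (proj₂ (proj₂ (proj₂ (proj₂ initial))))
    e>0 : 0 < e G X₀ Y₀
    e>0 = factor>0 (e G X₀ Y₀) (*-mono-≤ w>0 w>0) (≤-trans w²≤ (≤-reflexive (*-comm c _)))
    gap : p ^ depth * suc c ≤ suc p ^ depth
    gap = *-cancelˡ-≤ p (≤-trans (≤-reflexive (lem₃ p (p ^ depth) c)) (bernoulli p depth))
      where
      lem₃ : ∀ p q c → p * (q * (1 + c)) ≡ q * (p + p * c)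
      lem₃ = solve-∀
    increment : p ^ depth * (length X₀ * length X₀) < suc p ^ depth * e G X₀ Y₀
    increment = begin-strict
      p ^ depth * (length X₀ * length X₀)       ≡⟨ cong (λ z → p ^ depth * (z * z)) lX ⟩
      p ^ depth * (w * w)                       ≤⟨ *-monoʳ-≤ (p ^ depth) w²≤ ⟩
      p ^ depth * (c * e G X₀ Y₀)               <⟨ *-monoʳ-< (p ^ depth) {{m^n≢0 p depth}} (m<n+m (c * e G X₀ Y₀) e>0) ⟩
      p ^ depth * (suc c * e G X₀ Y₀)           ≡⟨ *-assoc (p ^ depth) (suc c) _ ⟨
      p ^ depth * suc c * e G X₀ Y₀             ≤⟨ *-monoˡ-≤ (e G X₀ Y₀) gap ⟩
      suc p ^ depth * e G X₀ Y₀                 ∎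
    open RobustPair (densify* G (n≤1+n p) ratio depth X₀ Y₀ h₀ h₀>0 (Unique-++⁻ˡ X₀ uXY) (Unique-++⁻ʳ X₀ uXY) lX lY increment)

  -- With fewer than s vertices of large degree, e(P, Q) would be below s h from these plus h s from
  -- the rest, hence below h² / D.
  many-good-vertices : ∀ {P Q h D s} → .{{_ : NonZero D}} → 0 < s → length P ≡ h → length Q ≡ h → h * h ≤ D * e G P Q → 2 * D * s ≤ h →
    s ≤ length (filter (λ u → s ≤? ∑ Q (λ y → ι (G u y ≟ᵇ true))) P)
  many-good-vertices {P} {Q} {h} {D} {s} s>0 lP lQ dense 2Ds≤h = ≮⇒≥ λ few → <-irrefl refl (begin-strict
    h * h                                     <⟨ m<m+n (h * h) (*-mono-≤ (>-nonZero⁻¹ D) h>0) ⟩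
    h * h + D * h                             ≤⟨ +-monoˡ-≤ (D * h) dense ⟩
    D * e G P Q + D * h                       ≡⟨ *-distribˡ-+ D _ h ⟨
    D * (e G P Q + h)                         ≤⟨ *-monoʳ-≤ D (+-monoˡ-≤ h count≤) ⟩
    D * (g * h + h * s + h)                   ≡⟨ lem D g h s ⟩
    D * (suc g * h + h * s)                   ≤⟨ *-monoʳ-≤ D (+-monoˡ-≤ (h * s) (*-monoˡ-≤ h few)) ⟩
    D * (s * h + h * s)                       ≡⟨ lem′ D s h ⟩
    2 * D * s * h                             ≤⟨ *-monoˡ-≤ h 2Ds≤h ⟩
    h * h                                     ∎)
    where
    open ≤-Reasoning
    deg : Fin n → ℕ
    deg u = ∑ Q (λ y → ι (G u y ≟ᵇ true))
    good? : ∀ u → Dec (s ≤ deg u)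
    good? u = s ≤? deg u
    g = length (filter good? P)
    h>0 : 0 < h
    h>0 = ≤-trans (*-mono-≤ (*-mono-≤ {1} {2} (s≤s z≤n) (>-nonZero⁻¹ D)) s>0) 2Ds≤h
    lem : ∀ D g h s → D * (g * h + h * s + h) ≡ D * ((1 + g) * h + h * s)
    lem = solve-∀
    lem′ : ∀ D s h → D * (s * h + h * s) ≡ 2 * D * s * h
    lem′ = solve-∀
    pt : ∀ u (d : Dec (s ≤ deg u)) → deg u ≤ ι d * h + s
    pt u (yes _)  = ≤-trans (≤-trans (e-row≤ G Q u) (≤-reflexive (trans lQ (sym (*-identityˡ h))))) (m≤m+n (1 * h) s)
    pt u (no few) = <⇒≤ (≰⇒> few)
    count≤ : e G P Q ≤ g * h + h * s
    count≤ = begin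
      ∑ P deg                                     ≤⟨ ∑-mono P (λ u _ → pt u (good? u)) ⟩
      ∑ P (λ u → ι (good? u) * h + s)             ≡⟨ ∑-+ P ⟩
      ∑ P (λ u → ι (good? u) * h) + ∑ P (λ _ → s) ≡⟨ cong₂ _+_ (trans (sym (∑-*ʳ h P)) (cong (_* h) (sym (length-filter≡∑ good? P)))) (trans (∑-const P s) (cong (_* s) lP)) ⟩
      g * h + h * s                               ∎

-- Cliques of size Δ + 1

module _ {n : ℕ} (F : Adj n) (Δ : ℕ) where

  record IsClique (K : List (Fin n)) : Set where
    constructor clique
    field
      distinct : Unique K
      size     : length K ≡ suc Δ
      adjacent : All (λ u → All (λ v → u ≡ v ⊎ F u v ≡ true) K) K

  abstract
    isClique? : ∀ K → Dec (IsClique K)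
    isClique? K = map′ (λ (u , l , c) → clique u l c) (λ (clique u l c) → u , l , c)
      (unique? K ×-dec (length K ≟ suc Δ) ×-dec All.all? (λ u → All.all? (λ v → (u Finₚ.≟ v) ⊎-dec (F u v ≟ᵇ true)) K) K)

  clique-edge : ∀ {K u v} → IsClique K → u ∈ K → v ∈ K → u ≢ v → F u v ≡ true
  clique-edge c u∈ v∈ u≢v with All.lookup (All.lookup (IsClique.adjacent c) u∈) v∈
  ... | inj₁ e = contradiction e u≢v
  ... | inj₂ f = f

  -- Its Δ neighbours inside the clique exhaust the degree of u, so each clique is a whole component
  -- of F.
  clique-closed : MaxDegreeAtMost F Δ → ∀ {K u w} → IsClique K → u ∈ K → F u w ≡ true → w ∈ K
  clique-closed maxdeg {K} {u} {w} c u∈ f with w ∈? K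
  ... | yes m = m
  ... | no w∉ = contradiction (length-mono (neighbours F u) (w ∷ (K ∖ (u ∷ []))) (neighbours-unique F u) (∉⇒All≢ (w∉ ∘ proj₁ ∘ ∈-∖⁻ K) ∷ Unique-∖ (u ∷ []) (IsClique.distinct c)) sub)
            (<⇒≱ (s≤s (≤-trans (maxdeg u) (≤-reflexive (sym (trans (length-∖₁ K (IsClique.distinct c) u∈) (cong (_∸ 1) (IsClique.size c))))))))
    where
    sub : ∀ {x} → x ∈ w ∷ (K ∖ (u ∷ [])) → x ∈ neighbours F u
    sub (here refl) = ∈-neighbours⁺ F f
    sub (there m)   = let x∈ , x∉ = ∈-∖⁻ K m in ∈-neighbours⁺ F (clique-edge c u∈ x∈ λ { refl → x∉ (here refl) })

  record CliqueDecomposition (vs : List (Fin n)) : Set where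
    field
      cliques    : List (List (Fin n))
      rest       : List (Fin n)
      areCliques : All IsClique cliques
      distinct   : Unique (concat cliques ++ rest)
      ⊆vs        : ∀ {x} → x ∈ concat cliques ++ rest → x ∈ vs
      vs⊆        : ∀ {x} → x ∈ vs → x ∈ concat cliques ++ rest
      cliqueFree : ∀ K → IsClique K → ¬ (∀ {x} → x ∈ K → x ∈ rest)

  abstract
    -- Greedy removal of cliques until the search fails; the failed search is the clique-freeness of
    -- `rest`.
    decompose : ∀ fuel vs → length vs ≤ fuel → Unique vs → CliqueDecomposition vs
    decompose fuel vs len u with searchList isClique? (words (suc Δ) vs)
    decompose fuel vs len u | inj₂ none = record
      { cliques = [] ; rest = vs ; areCliques = [] ; distinct = u ; ⊆vs = id ; vs⊆ = id
      ; cliqueFree = λ K c K⊆ → none K (subst (λ k → K ∈ words k vs) (IsClique.size c) (∈-words vs K K⊆)) c }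
    decompose zero [] len u | inj₁ (K , () , c)
    decompose (suc fuel) vs len u | inj₁ (K , K∈ , c) = record
      { cliques = K ∷ cliques ; rest = rest ; areCliques = c ∷ areCliques
      ; distinct = subst Unique (sym (Listₚ.++-assoc K (concat cliques) rest)) (Uniqueₚ.++⁺ (IsClique.distinct c) distinct (λ (a , b) → proj₂ (∈-∖⁻ vs (⊆vs b)) a))
      ; ⊆vs = λ m → case ∈ₚ.∈-++⁻ K (subst (_ ∈_) (Listₚ.++-assoc K (concat cliques) rest) m) of λ { (inj₁ q) → K⊆ q ; (inj₂ q) → proj₁ (∈-∖⁻ vs (⊆vs q)) }
      ; vs⊆ = λ {x} m → subst (x ∈_) (sym (Listₚ.++-assoc K (concat cliques) rest)) (place x m)
      ; cliqueFree = cliqueFree }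
      where
      K⊆ : ∀ {x} → x ∈ K → x ∈ vs
      K⊆ = proj₂ (words-∈ (suc Δ) vs K∈)
      shorter : length (vs ∖ K) ≤ fuel
      shorter = s≤s⁻¹ (≤-trans (≤-trans (+-monoˡ-≤ (length (vs ∖ K)) (subst (1 ≤_) (sym (IsClique.size c)) (s≤s z≤n))) (≤-reflexive (sym (length-∖ vs K u (IsClique.distinct c) K⊆)))) len)
      open CliqueDecomposition (decompose fuel (vs ∖ K) shorter (Unique-∖ K u))
      place : ∀ x → x ∈ vs → x ∈ K ++ (concat cliques ++ rest)
      place x m with x ∈? K
      ... | yes q = ∈ₚ.∈-++⁺ˡ q
      ... | no x∉ = ∈ₚ.∈-++⁺ʳ K (vs⊆ (∈-∖⁺ m x∉))

length-concat : ∀ {A : Set} {k} (xss : List (List A)) → All (λ xs → length xs ≡ k) xss → length (concat xss) ≡ length xss * k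
length-concat []         []       = refl
length-concat (xs ∷ xss) (e ∷ es) = trans (Listₚ.length-++ xs) (cong₂ _+_ e (length-concat xss es))

∈-concat-unique : ∀ {A : Set} {xss : List (List A)} {xs ys x} → Unique (concat xss) → xs ∈ xss → ys ∈ xss → x ∈ xs → x ∈ ys → xs ≡ ys
∈-concat-unique u (here refl) (here refl) _ _ = refl
∈-concat-unique {xss = xs ∷ _} u (here refl) (there m) p q = contradiction (∈ₚ.∈-concat⁺′ q m) (Unique-++-disjoint xs u p)
∈-concat-unique {xss = xs ∷ _} u (there m) (here refl) p q = contradiction (∈ₚ.∈-concat⁺′ p m) (Unique-++-disjoint xs u q)
∈-concat-unique {xss = xs ∷ _} u (there m) (there m′) p q = ∈-concat-unique (Unique-++⁻ʳ xs u) m m′ p q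

Unique-concat-filter : ∀ {A : Set} {P : List A → Set} (P? : ∀ xs → Dec (P xs)) xss → Unique (concat xss) → Unique (concat (filter P? xss))
Unique-concat-filter P? []         u = []
Unique-concat-filter P? (xs ∷ xss) u with P? xs
... | no _  = Unique-concat-filter P? xss (Unique-++⁻ʳ xs u)
... | yes _ = Uniqueₚ.++⁺ (Unique-++⁻ˡ xs u) (Unique-concat-filter P? xss (Unique-++⁻ʳ xs u)) λ (p , q) → Unique-++-disjoint xs u p (shrink q)
  where
  shrink : ∀ {x} → x ∈ concat (filter P? xss) → x ∈ concat xss
  shrink q with find (∈ₚ.∈-concat⁻ (filter P? xss) q)
  ... | ys , ys∈ , x∈ = ∈ₚ.∈-concat⁺′ x∈ (proj₁ (∈ₚ.∈-filter⁻ P? {xs = xss} ys∈))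

-- Random matchings in a dense pair

module _ {n : ℕ} where

  matched : List (Fin n × Fin n) → List (Fin n)
  matched []             = []
  matched ((x , y) ∷ ps) = y ∷ x ∷ matched ps

  length-matched : ∀ ps → length (matched ps) ≡ 2 * length ps
  length-matched []       = refl
  length-matched (p ∷ ps) = trans (cong (2 +_) (length-matched ps)) (lem (length ps))
    where
    lem : ∀ k → 2 + 2 * k ≡ 2 * (1 + k)
    lem = solve-∀

  module _ (G : Adj n) {K D : ℕ} (DP : DensePair G K D) (s : ℕ) where

    open DensePair DP

    pool : List (Fin n) → Placement n → List (Fin n)
    pool Z a = take h (Z ∖ targets a)

    -- Truncation to s options makes the number of options independent of earlier choices, so that
    -- the list of all outcomes is a uniform distribution. `choiceX` admits only vertices with s
    -- neighbours in the free part of Y, so the partner also has s options. `choiceY` reads the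
    -- target just chosen off the head of the placement.
    choiceX choiceY : Placement n → List (Fin n)
    choiceX a = take s (filter (λ u → s ≤? ∑ (pool Y a) (λ w → ι (G u w ≟ᵇ true))) (pool X a))
    choiceY []            = []
    choiceY ((u , _) ∷ a) = take s (filter (λ w → G u w ≟ᵇ true) (pool Y a))

    matchings : List (Fin n × Fin n) → List (Placement n)
    matchings []             = [] ∷ []
    matchings ((x , y) ∷ ps) = step y choiceY (step x choiceX (matchings ps))

    -- `us` and `ws` list the targets used in X and in Y separately: each pair consumes one vertex
    -- per side, which keeps h of the 4 h vertices free after 3 h pairs.
    record Matched (ps : List (Fin n × Fin n)) (a : Placement n) : Set where
      field
        pats   : patterns a ≡ matched ps
        uniq   : Unique (targets a)
        ⊆XY    : ∀ {t} → t ∈ targets a → t ∈ X ++ Y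
        us ws  : List (Fin n)
        ∣us∣    : length us ≡ length ps
        ∣ws∣    : length ws ≡ length ps
        X-used : ∀ {t} → t ∈ targets a → t ∈ X → t ∈ us
        Y-used : ∀ {t} → t ∈ targets a → t ∈ Y → t ∈ ws
        edges  : ∀ {x y} → (x , y) ∈ ps → ∃[ u ] ∃[ w ] (u , x) ∈ a × (w , y) ∈ a × G u w ≡ true

    choiceX⁻ : ∀ a {u} → u ∈ choiceX a → u ∈ X × u ∉ targets a × s ≤ ∑ (pool Y a) (λ w → ι (G u w ≟ᵇ true))
    choiceX⁻ a m with ∈ₚ.∈-filter⁻ (λ u → s ≤? ∑ (pool Y a) (λ w → ι (G u w ≟ᵇ true))) {xs = pool X a} (take-⊆ s _ m)
    ... | m′ , deg with ∈-∖⁻ X (take-⊆ h (X ∖ targets a) m′)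
    ...   | u∈ , u∉ = u∈ , u∉ , deg

    choiceY⁻ : ∀ u x a {w} → w ∈ choiceY ((u , x) ∷ a) → w ∈ Y × w ∉ targets a × G u w ≡ true
    choiceY⁻ u x a m with ∈ₚ.∈-filter⁻ (λ w → G u w ≟ᵇ true) {xs = pool Y a} (take-⊆ s _ m)
    ... | m′ , g with ∈-∖⁻ Y (take-⊆ h (Y ∖ targets a) m′)
    ...   | w∈ , w∉ = w∈ , w∉ , g

    matchings⁻ : ∀ {x y} ps {b} → b ∈ matchings ((x , y) ∷ ps) →
      ∃[ a ] ∃[ u ] ∃[ w ] a ∈ matchings ps × u ∈ choiceX a × w ∈ choiceY ((u , x) ∷ a) × b ≡ (w , y) ∷ (u , x) ∷ a
    matchings⁻ {x} {y} ps m =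
      let a′ , w , a′∈ , w∈ , e′ = step⁻ y choiceY (step x choiceX (matchings ps)) m
          a , u , a∈ , u∈ , q = step⁻ x choiceX (matchings ps) a′∈
      in a , u , w , a∈ , u∈ , subst (λ z → w ∈ choiceY z) q w∈ , trans e′ (cong ((w , y) ∷_) q)

    matchings-wf : ∀ ps {a} → a ∈ matchings ps → Matched ps a
    matchings-wf [] (here refl) = record { pats = refl ; uniq = [] ; ⊆XY = λ () ; us = [] ; ws = [] ; ∣us∣ = refl ; ∣ws∣ = refl ; X-used = λ () ; Y-used = λ () ; edges = λ () }
    matchings-wf ((x , y) ∷ ps) m =
      let a , u , w , a∈ , u∈ , w∈ , q = matchings⁻ {x} {y} ps m
      in subst (Matched ((x , y) ∷ ps)) (sym q) (extend a u w (matchings-wf ps a∈) (choiceX⁻ a u∈) (choiceY⁻ u x a w∈))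
      where
      extend : ∀ a u w → Matched ps a → u ∈ X × u ∉ targets a × s ≤ ∑ (pool Y a) (λ w → ι (G u w ≟ᵇ true)) →
               w ∈ Y × w ∉ targets a × G u w ≡ true → Matched ((x , y) ∷ ps) ((w , y) ∷ (u , x) ∷ a)
      extend a u w M (u∈X , u∉ , _) (w∈Y , w∉ , g) = record
        { pats = cong (λ l → y ∷ x ∷ l) M.pats
        ; uniq = ∉⇒All≢ (λ { (here refl) → Unique-++-disjoint X distinct u∈X w∈Y ; (there q) → w∉ q }) ∷ ∉⇒All≢ u∉ ∷ M.uniq
        ; ⊆XY = λ { (here refl) → ∈ₚ.∈-++⁺ʳ X w∈Y ; (there (here refl)) → ∈ₚ.∈-++⁺ˡ u∈X ; (there (there q)) → M.⊆XY q }
        ; us = u ∷ M.us ; ws = w ∷ M.ws ; ∣us∣ = cong suc M.∣us∣ ; ∣ws∣ = cong suc M.∣ws∣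
        ; X-used = λ { (here refl) t∈ → contradiction w∈Y (Unique-++-disjoint X distinct t∈) ; (there (here refl)) _ → here refl ; (there (there q)) t∈ → there (M.X-used q t∈) }
        ; Y-used = λ { (here refl) _ → here refl ; (there (here refl)) t∈ → contradiction t∈ (Unique-++-disjoint X distinct u∈X) ; (there (there q)) t∈ → there (M.Y-used q t∈) }
        ; edges = λ { (here refl) → u , w , there (here refl) , here refl , g
                    ; (there q) → let u′ , w′ , p₁ , p₂ , g′ = M.edges q in u′ , w′ , there (there p₁) , there (there p₂) , g′ } }
        where module M = Matched M

    pool-size : ∀ (Z : List (Fin n)) {ts vs : List (Fin n)} {k} → Unique Z → length Z ≡ 4 * h → (∀ {t} → t ∈ ts → t ∈ Z → t ∈ vs) → length vs ≡ k → k ≤ 3 * h → h ≤ length (Z ∖ ts)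
    pool-size Z {ts} {vs} {k} uZ lZ used lvs k≤ = ≤-trans (+-cancelʳ-≤ (3 * h) _ _ (begin
      h + 3 * h                          ≡⟨ lZ ⟨
      length Z                           ≤⟨ length-∖≥ Z vs uZ ⟩
      length (Z ∖ vs) + length vs        ≤⟨ +-monoʳ-≤ (length (Z ∖ vs)) (subst (_≤ 3 * h) (sym lvs) k≤) ⟩
      length (Z ∖ vs) + 3 * h            ∎)) (length-mono (Z ∖ ts) (Z ∖ vs) (Unique-∖ ts uZ) (Unique-∖ vs uZ) λ m → let z∈ , z∉ = ∈-∖⁻ Z m in ∈-∖⁺ z∈ (λ t∈ → z∉ (used t∈ z∈)))
      where open ≤-Reasoning

    private
      uX : Unique X
      uX = Unique-++⁻ˡ X distinct
      uY : Unique Y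
      uY = Unique-++⁻ʳ X distinct

    choiceX-unique : ∀ a → Unique (choiceX a) × length (choiceX a) ≤ s
    choiceX-unique a = Uniqueₚ.take⁺ s (Uniqueₚ.filter⁺ _ (Uniqueₚ.take⁺ h (Unique-∖ (targets a) uX))) ,
      ≤-trans (≤-reflexive (Listₚ.length-take s _)) (m⊓n≤m s _)

    choiceY-unique : ∀ a → Unique (choiceY a) × length (choiceY a) ≤ s
    choiceY-unique []            = [] , z≤n
    choiceY-unique ((u , _) ∷ a) = Uniqueₚ.take⁺ s (Uniqueₚ.filter⁺ _ (Uniqueₚ.take⁺ h (Unique-∖ (targets a) uY))) ,
      ≤-trans (≤-reflexive (Listₚ.length-take s _)) (m⊓n≤m s _)

    module _ (symG : ∀ u v → G u v ≡ G v u) (irr : ∀ u → G u u ≡ false) .{{_ : NonZero D}} (s>0 : 0 < s) (2Ds≤h : 2 * D * s ≤ h) where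

      choiceX-length : ∀ {ps a} → length ps ≤ 3 * h → Matched ps a → length (choiceX a) ≡ s
      choiceX-length {ps} {a} k≤ M = length-take≡ s _ (many-good-vertices G symG irr {P = pool X a} {pool Y a} {h} {D} s>0
          (size PX) (size PY) (dense PX PY) 2Ds≤h)
        where
        open Matched M
        PX : Block X h
        PX = widen (proj₁ ∘ ∈-∖⁻ X) (takeBlock h (X ∖ targets a) (Unique-∖ (targets a) uX) (pool-size X uX ∣X∣ X-used ∣us∣ k≤))
        PY : Block Y h
        PY = widen (proj₁ ∘ ∈-∖⁻ Y) (takeBlock h (Y ∖ targets a) (Unique-∖ (targets a) uY) (pool-size Y uY ∣Y∣ Y-used ∣ws∣ k≤))

      choiceY-length : ∀ x a {u} → u ∈ choiceX a → length (choiceY ((u , x) ∷ a)) ≡ s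
      choiceY-length x a {u} u∈ = length-take≡ s _ (≤-trans (proj₂ (proj₂ (choiceX⁻ a u∈))) (≤-reflexive (sym (length-filter≡∑ (λ w → G u w ≟ᵇ true) (pool Y a)))))

      matchings-spread : ∀ ps → length ps ≤ 3 * h → Unique (matched ps) → PointSpreadOn (matched ps) (matchings ps) s (length (matchings ps))
      matchings-spread [] _ _ = trivial-spread s
      matchings-spread ((x , y) ∷ ps) k≤ (y∉ ∷ x∉ ∷ u) = subst (PointSpreadOn (y ∷ x ∷ matched ps) (matchings ((x , y) ∷ ps)) s) (sym len)
        (step-spread (λ m → All.lookup y∉ m refl) pats₁ choiceY-unique
          (step-spread (λ m → All.lookup x∉ m refl) (λ a a∈ → Matched.pats (matchings-wf ps a∈)) choiceX-unique (matchings-spread ps (<⇒≤ k≤) u)))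
        where
        as₁ = step x choiceX (matchings ps)
        pats₁ : ∀ a → a ∈ as₁ → patterns a ≡ x ∷ matched ps
        pats₁ = step-all x choiceX (matchings ps) (λ a → patterns a ≡ x ∷ matched ps) λ a u a∈ _ → cong (x ∷_) (Matched.pats (matchings-wf ps a∈))
        lenY : ∀ a → a ∈ as₁ → length (choiceY a) ≡ s
        lenY = step-all x choiceX (matchings ps) (λ a → length (choiceY a) ≡ s) λ a u _ u∈ → choiceY-length x a u∈
        len : length (matchings ((x , y) ∷ ps)) ≡ length (matchings ps) * s * s
        len = trans (step-length y choiceY as₁ lenY) (cong (_* s) (step-length x choiceX (matchings ps) λ a a∈ → choiceX-length (<⇒≤ k≤) (matchings-wf ps a∈)))

      matchings-nonempty : ∀ ps → length ps ≤ 3 * h → 0 < length (matchings ps)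
      matchings-nonempty [] _ = s≤s z≤n
      matchings-nonempty ((x , y) ∷ ps) k≤ = subst (0 <_) (sym (trans (step-length y choiceY as₁ lenY) (cong (_* s) (step-length x choiceX (matchings ps) λ a a∈ → choiceX-length (<⇒≤ k≤) (matchings-wf ps a∈)))))
          (*-mono-≤ (*-mono-≤ (matchings-nonempty ps (<⇒≤ k≤)) s>0) s>0)
        where
        as₁ = step x choiceX (matchings ps)
        lenY : ∀ a → a ∈ as₁ → length (choiceY a) ≡ s
        lenY = step-all x choiceX (matchings ps) (λ a → length (choiceY a) ≡ s) λ a u _ u∈ → choiceY-length x a u∈

-- Completing a partial embedding

∧-true⁺ : ∀ {a b} → a ≡ true → b ≡ true → a ∧ b ≡ true
∧-true⁺ refl refl = refl

∨-true⁺ : ∀ {a b} → a ≡ true ⊎ b ≡ true → a ∨ b ≡ true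
∨-true⁺ {true}  _        = refl
∨-true⁺ {false} (inj₂ e) = e

module _ {n : ℕ} where

  targetAt : Placement n → Fin n → Fin n
  targetAt []            x = x
  targetAt ((v , y) ∷ a) x = if ⌊ y Finₚ.≟ x ⌋ then v else targetAt a x

  targetAt-∈ : ∀ a {x} → x ∈ patterns a → (targetAt a x , x) ∈ a
  targetAt-∈ ((v , y) ∷ a) {x} m with y Finₚ.≟ x | m
  ... | yes refl | _         = here refl
  ... | no y≢x   | here refl = contradiction refl y≢x
  ... | no y≢x   | there m′  = there (targetAt-∈ a m′)

  Unique-map-++ : ∀ {A : Set} (f : A → Fin n) xs {ys} → Unique (map f xs) → Unique (map f ys) → (∀ {z} → z ∈ map f xs → z ∉ map f ys) → Unique (map f (xs ++ ys))
  Unique-map-++ f xs {ys} u v disj = subst Unique (sym (Listₚ.map-++ f xs ys)) (Uniqueₚ.++⁺ u v λ (p , q) → disj p q)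

  -- This pair is the edge of its clique that G will supply.
  firstTwo : List (Fin n) → List (Fin n × Fin n)
  firstTwo (x ∷ y ∷ _) = (x , y) ∷ []
  firstTwo _           = []

  designatedPairs : List (List (Fin n)) → List (Fin n × Fin n)
  designatedPairs = concatMap firstTwo

  firstTwo-⊆ : ∀ Q {z} → z ∈ matched (firstTwo Q) → z ∈ Q
  firstTwo-⊆ (x ∷ y ∷ _) (here refl)         = there (here refl)
  firstTwo-⊆ (x ∷ y ∷ _) (there (here refl)) = here refl
  firstTwo-⊆ (x ∷ y ∷ _) (there (there ()))

  matched-++ : ∀ ps qs → matched (ps ++ qs) ≡ matched ps ++ matched {n} qs
  matched-++ []             qs = refl
  matched-++ ((x , y) ∷ ps) qs = cong (λ l → y ∷ x ∷ l) (matched-++ ps qs)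

  designated-⊆ : ∀ Qs {z} → z ∈ matched (designatedPairs Qs) → z ∈ concat Qs
  designated-⊆ (Q ∷ Qs) m with ∈ₚ.∈-++⁻ (matched (firstTwo Q)) (subst (_ ∈_) (matched-++ (firstTwo Q) (designatedPairs Qs)) m)
  ... | inj₁ q = ∈ₚ.∈-++⁺ˡ (firstTwo-⊆ Q q)
  ... | inj₂ q = ∈ₚ.∈-++⁺ʳ Q (designated-⊆ Qs q)

  designated-unique : ∀ Qs → Unique (concat Qs) → Unique (matched (designatedPairs Qs))
  designated-unique []       _ = []
  designated-unique (Q ∷ Qs) u = subst Unique (sym (matched-++ (firstTwo Q) (designatedPairs Qs)))
    (Uniqueₚ.++⁺ (two Q (Unique-++⁻ˡ Q u)) (designated-unique Qs (Unique-++⁻ʳ Q u)) λ (p , q) → Unique-++-disjoint Q u (firstTwo-⊆ Q p) (designated-⊆ Qs q))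
    where
    two : ∀ Q → Unique Q → Unique (matched (firstTwo Q))
    two []          _                 = []
    two (_ ∷ [])    _                 = []
    two (x ∷ y ∷ _) ((x≢y ∷ _) ∷ _) = ((λ e → x≢y (sym e)) ∷ []) ∷ [] ∷ []

  designated-length : ∀ Qs → length (designatedPairs Qs) ≤ length Qs
  designated-length []       = z≤n
  designated-length (Q ∷ Qs) = ≤-trans (≤-reflexive (Listₚ.length-++ (firstTwo Q))) (+-mono-≤ (atMostOne Q) (designated-length Qs))
    where
    atMostOne : ∀ Q → length (firstTwo Q) ≤ 1
    atMostOne []          = z≤n
    atMostOne (_ ∷ [])    = z≤n
    atMostOne (_ ∷ _ ∷ _) = s≤s z≤n

  designated-hit : ∀ {Q Qs} → Q ∈ Qs → Unique Q → 2 ≤ length Q → ∃[ x ] ∃[ y ] x ∈ Q × y ∈ Q × x ≢ y × (x , y) ∈ designatedPairs Qs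
  designated-hit {Q} m u two = let x , y , p , q , r , s = own Q u two in x , y , p , q , r , ∈ₚ.∈-concatMap⁺ firstTwo (lose m s)
    where
    own : ∀ Q → Unique Q → 2 ≤ length Q → ∃[ x ] ∃[ y ] x ∈ Q × y ∈ Q × x ≢ y × (x , y) ∈ firstTwo Q
    own (x ∷ y ∷ _) ((x≢y ∷ _) ∷ _) _ = x , y , here refl , there (here refl) , x≢y , here refl
    own (_ ∷ []) _ (s≤s ())

  -- Deleting the designated edges

  module _ (F : Adj n) (ps : List (Fin n × Fin n)) where

    Designated : Fin n → Fin n → Set
    Designated u v = (u , v) ∈ ps ⊎ (v , u) ∈ ps

    abstract
      designated? : ∀ u v → Dec (Designated u v)
      designated? u v = ((u , v) ∈ₚ? ps) ⊎-dec ((v , u) ∈ₚ? ps)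

    reduced : Adj n
    reduced u v = F u v ∧ ⌊ ¬? (designated? u v) ⌋

    reduced⁻ : ∀ {u v} → reduced u v ≡ true → F u v ≡ true × ¬ Designated u v
    reduced⁻ {u} {v} h = let f , g = ∧-true⁻ h in f , ⌊⌋-true⁻ (¬? (designated? u v)) g

    reduced⁺ : ∀ {u v} → F u v ≡ true → ¬ Designated u v → reduced u v ≡ true
    reduced⁺ {u} {v} f ¬d = ∧-true⁺ f (⌊⌋-true⁺ (¬? (designated? u v)) ¬d)

    reduced-sym : (∀ u v → F u v ≡ F v u) → ∀ u v → reduced u v ≡ reduced v u
    reduced-sym symF u v = ≡true-antisym {n} swap swap
      where
      swap : ∀ {u v} → reduced u v ≡ true → reduced v u ≡ true
      swap {u} {v} h = let f , ¬d = reduced⁻ h in reduced⁺ (trans (symF v u) f) (λ { (inj₁ m) → ¬d (inj₂ m) ; (inj₂ m) → ¬d (inj₁ m) })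

    reduced-degree : ∀ {Δ} → MaxDegreeAtMost F Δ → MaxDegreeAtMost reduced Δ
    reduced-degree maxdeg v = ≤-trans (length-mono (neighbours F v) (neighbours reduced v) (neighbours-unique F v) (neighbours-unique reduced v)
      (λ {u} m → ∈-neighbours⁺ F (proj₁ (reduced⁻ (∈-neighbours⁻ reduced {v} {u} m))))) (maxdeg v)

  covers⇒length : ∀ (zs : List (Fin n)) → Unique zs → (∀ x → x ∈ zs) → length zs ≡ n
  covers⇒length zs u all = ≤-antisym (length≤n zs u) (subst (_≤ length zs) (Listₚ.length-tabulate id) (length-mono zs (allFin n) u (allFin-unique n) (λ {x} _ → all x)))

  -- The situation after the first exposure W₀: the part of F on the patterns of a₁ is embedded,
  -- the cliques Qs and the clique-free residue are still to be placed.
  record PartialEmbedding (F : Adj n) (Δ : ℕ) (XY : List (Fin n)) (bound : ℕ) (W₀ : Outcome n) : Set where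
    field
      a₁         : Placement n
      Qs         : List (List (Fin n))
      residue          : List (Fin n)
      uniq-t     : Unique (targets a₁)
      uniq-p     : Unique (patterns a₁)
      avoids     : ∀ {t} → t ∈ targets a₁ → t ∉ XY
      cover      : ∀ x → x ∈ patterns a₁ ⊎ x ∈ concat Qs ++ residue
      disjoint   : ∀ {x} → x ∈ patterns a₁ → x ∉ concat Qs ++ residue
      uniq-rest  : Unique (concat Qs ++ residue)
      closed     : ∀ {x y} → x ∈ patterns a₁ → F x y ≡ true → y ∈ patterns a₁
      realised   : ∀ {i j x y} → (i , x) ∈ a₁ → (j , y) ∈ a₁ → F x y ≡ true → outcomeGraph {n} W₀ i j ≡ true
      areCliques : All (IsClique F Δ) Qs
      cliqueFree : ∀ K → IsClique F Δ K → ¬ (∀ {x} → x ∈ K → x ∈ residue)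
      few        : length Qs ≤ bound

  module _ (F G : Adj n) (symF : ∀ u v → F u v ≡ F v u) (irrF : ∀ u → F u u ≡ false) (symG : ∀ u v → G u v ≡ G v u) (irrG : ∀ u → G u u ≡ false)
           (Δ : ℕ) (maxdeg : MaxDegreeAtMost F Δ) {K D : ℕ} (DP : DensePair G K D) (s : ℕ) {W₀ : Outcome n}
           (PE : PartialEmbedding F Δ (DensePair.X DP ++ DensePair.Y DP) (3 * DensePair.h DP) W₀) where

    open DensePair DP
    open PartialEmbedding PE

    ps : List (Fin n × Fin n)
    ps = designatedPairs Qs

    ms xs xs₂ U : List (Fin n)
    ms  = matched ps
    xs₂ = concat Qs ++ residue
    xs  = xs₂ ∖ ms
    U   = allFin n ∖ targets a₁

    H : Adj n
    H = reduced F ps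

    family : List (Placement n)
    family = complete (matchings G DP s ps) xs U

    U-unique : Unique U
    U-unique = Unique-∖ (targets a₁) (allFin-unique n)

    ms⊆xs₂ : ∀ {z} → z ∈ ms → z ∈ xs₂
    ms⊆xs₂ m = ∈ₚ.∈-++⁺ˡ (designated-⊆ Qs m)

    ms-unique : Unique ms
    ms-unique = designated-unique Qs (Unique-++⁻ˡ (concat Qs) uniq-rest)

    XY⊆U : ∀ {t} → t ∈ X ++ Y → t ∈ U
    XY⊆U {t} m = ∈-∖⁺ (∈ₚ.∈-allFin t) (λ t∈ → avoids t∈ m)

    record InFamily (c : Placement n) : Set where
      field
        pats⁺   : ∀ {x} → x ∈ xs₂ → x ∈ patterns c
        pats⁻   : ∀ {x} → x ∈ patterns c → x ∈ xs₂
        uniq-p′ : Unique (patterns c)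
        uniq-t′ : Unique (targets c)
        ⊆U      : ∀ {t} → t ∈ targets c → t ∈ U
        edges   : ∀ {x y} → (x , y) ∈ ps → ∃[ u ] ∃[ w ] (u , x) ∈ c × (w , y) ∈ c × G u w ≡ true

    family-wf : ∀ c → c ∈ family → InFamily c
    family-wf c m with complete⁻ (matchings G DP s ps) xs U m
    ... | a , b , a∈ , b∈ , refl with matchings-wf G DP s ps a∈ | injections-wf xs (U ∖ targets a) (Unique-∖ (targets a) U-unique) b∈
    ...   | M | pats-b , ut , sub = record
      { pats⁺ = λ {x} x∈ → subst (x ∈_) (sym (Listₚ.map-++ proj₂ b a)) (place x x∈)
      ; pats⁻ = λ {x} x∈ → case ∈ₚ.∈-++⁻ (patterns b) (subst (x ∈_) (Listₚ.map-++ proj₂ b a) x∈) of λ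
          { (inj₁ q) → proj₁ (∈-∖⁻ xs₂ (subst (x ∈_) pats-b q)) ; (inj₂ q) → ms⊆xs₂ (subst (x ∈_) M.pats q) }
      ; uniq-p′ = Unique-map-++ proj₂ b (subst Unique (sym pats-b) (Unique-∖ ms uniq-rest)) (subst Unique (sym M.pats) ms-unique)
          λ p q → proj₂ (∈-∖⁻ xs₂ (subst (_ ∈_) pats-b p)) (subst (_ ∈_) M.pats q)
      ; uniq-t′ = Unique-map-++ proj₁ b ut M.uniq λ p → proj₂ (∈-∖⁻ U (sub p))
      ; ⊆U = λ {t} t∈ → case ∈ₚ.∈-++⁻ (targets b) (subst (t ∈_) (Listₚ.map-++ proj₁ b a) t∈) of λ
          { (inj₁ q) → proj₁ (∈-∖⁻ U (sub q)) ; (inj₂ q) → XY⊆U (M.⊆XY q) }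
      ; edges = λ m → let u , w , p , q , g = M.edges m in u , w , ∈ₚ.∈-++⁺ʳ b p , ∈ₚ.∈-++⁺ʳ b q , g }
      where
      module M = Matched M
      place : ∀ x → x ∈ xs₂ → x ∈ patterns b ++ patterns a
      place x x∈ with x ∈? ms
      ... | yes q = ∈ₚ.∈-++⁺ʳ (patterns b) (subst (x ∈_) (sym M.pats) q)
      ... | no x∉ = ∈ₚ.∈-++⁺ˡ (subst (x ∈_) (sym pats-b) (∈-∖⁺ x∈ x∉))

    -- A clique K_{Δ+1} in the image pulls back to a clique P of F that avoids designated edges. If
    -- P meets some Q of `Qs`, then P = Q, because Q is a component of the same size, yet Q has a
    -- designated edge. Otherwise P lies in the clique-free residue. Δ ≥ 1 gives every vertex of K
    -- an edge, hence a preimage.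
    family-sparse : 1 ≤ Δ → ∀ (A : Adj n) c → c ∈ family → (∀ u v → A u v ≡ A v u) → (∀ u → A u u ≡ false) →
      (∀ {i j} → A i j ≡ true → CoveredBy H c i j) → LocallySparse A (suc Δ) (Δ * suc (suc Δ))
    family-sparse 1≤Δ A c c∈ symA irrA cov = cliqueFree⇒sparse A symA irrA Δ (image-degree H A c (reduced-degree F ps maxdeg) uniq-t′ uniq-p′ cov) noClique
      where
      open InFamily (family-wf c c∈)
      noClique : ∀ K → Unique K → length K ≡ suc Δ → ¬ (∀ u v → u ∈ K → v ∈ K → u ≢ v → A u v ≡ true)
      noClique K uK lK adj = finish (searchList (λ Q → Any.any? (_∈? Q) P) Qs)
        where
        other : ∀ {u} → u ∈ K → ∃[ v ] v ∈ K × u ≢ v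
        other {u} u∈ with K ∖ (u ∷ []) in eq
        ... | [] = contradiction (trans (sym (cong length eq)) (trans (length-∖₁ K uK u∈) (cong (_∸ 1) lK))) (λ e → case subst (1 ≤_) (sym e) 1≤Δ of λ ())
        ... | v ∷ _ = let v∈ , v∉ = ∈-∖⁻ K (subst (v ∈_) (sym eq) (here refl)) in v , v∈ , λ e → v∉ (here (sym e))
        f : Fin n → Fin n
        f = patternAt H c
        placed : ∀ {u} → u ∈ K → (u , f u) ∈ c
        placed u∈ = let v , v∈ , u≢v = other u∈ ; x , _ , p , _ = cov (adj _ v u∈ v∈ u≢v) in patternAt-∈ H c (∈ₚ.∈-map⁺ proj₁ p)
        P : List (Fin n)
        P = map f K
        f-inj : ∀ {u v} → u ∈ K → v ∈ K → f u ≡ f v → u ≡ v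
        f-inj {u} {v} u∈ v∈ e = same-pattern uniq-p′ (placed u∈) (subst (λ z → (v , z) ∈ c) (sym e) (placed v∈))
        Unique-map : ∀ L → Unique L → (∀ {u} → u ∈ L → u ∈ K) → Unique (map f L)
        Unique-map []      _       _   = []
        Unique-map (u ∷ L) (a ∷ l) sub = ∉⇒All≢ (λ m → let v , v∈ , e = ∈ₚ.∈-map⁻ f m in All.lookup a v∈ (f-inj (sub (here refl)) (sub (there v∈)) e)) ∷ Unique-map L l (sub ∘ there)
        reducedClique : ∀ {x y} → x ∈ P → y ∈ P → x ≢ y → H x y ≡ true
        reducedClique x∈ y∈ x≢y with ∈ₚ.∈-map⁻ f x∈ | ∈ₚ.∈-map⁻ f y∈
        ... | u , u∈ , refl | v , v∈ , refl with cov (adj u v u∈ v∈ λ e → x≢y (cong f e))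
        ...   | x′ , y′ , p , q , h = subst₂ (λ a b → H a b ≡ true) (same-target uniq-t′ p (placed u∈)) (same-target uniq-t′ q (placed v∈)) h
        uP : Unique P
        uP = Unique-map K uK id
        isClique : IsClique F Δ P
        isClique = clique uP (trans (Listₚ.length-map f K) lK) (All.tabulate λ {x} x∈ → All.tabulate λ {y} y∈ → pair x y x∈ y∈)
          where
          pair : ∀ x y → x ∈ P → y ∈ P → x ≡ y ⊎ F x y ≡ true
          pair x y x∈ y∈ with x Finₚ.≟ y
          ... | yes e = inj₁ e
          ... | no x≢y = inj₂ (proj₁ (reduced⁻ F ps (reducedClique x∈ y∈ x≢y)))
        P⊆xs₂ : ∀ {x} → x ∈ P → x ∈ xs₂
        P⊆xs₂ x∈ with ∈ₚ.∈-map⁻ f x∈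
        ... | u , u∈ , refl = pats⁻ (∈ₚ.∈-map⁺ proj₂ (placed u∈))
        finish : (∃[ Q ] Q ∈ Qs × Any (_∈ Q) P) ⊎ (∀ Q → Q ∈ Qs → ¬ Any (_∈ Q) P) → ⊥
        finish (inj₂ none) = cliqueFree P isClique λ {x} x∈ → case ∈ₚ.∈-++⁻ (concat Qs) (P⊆xs₂ x∈) of λ
          { (inj₂ q) → q ; (inj₁ q) → let Q , x∈Q , Q∈ = ∈ₚ.∈-concat⁻′ Qs q in contradiction (lose x∈ x∈Q) (none Q Q∈) }
        finish (inj₁ (Q , Q∈ , some)) = let x , y , x∈ , y∈ , x≢y , des = designated-hit Q∈ (IsClique.distinct cQ) (≤-trans (s≤s 1≤Δ) (≤-reflexive (sym (IsClique.size cQ)))) in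
            proj₂ (reduced⁻ F ps (reducedClique (Q⊆P x∈) (Q⊆P y∈) x≢y)) (inj₁ des)
          where
          cQ : IsClique F Δ Q
          cQ = All.lookup areCliques Q∈
          P⊆Q : ∀ {y} → y ∈ P → y ∈ Q
          P⊆Q {y} y∈ with find some
          ... | x , x∈P , x∈Q with x Finₚ.≟ y
          ...   | yes refl = x∈Q
          ...   | no x≢y = clique-closed F Δ maxdeg cQ x∈Q (clique-edge F Δ isClique x∈P y∈ x≢y)
          Q⊆P : ∀ {y} → y ∈ Q → y ∈ P
          Q⊆P {y} y∈ with y ∈? P
          ... | yes m = m
          ... | no y∉ = contradiction (length-mono Q (y ∷ P) (IsClique.distinct cQ) (∉⇒All≢ y∉ ∷ uP) (λ { (here refl) → y∈ ; (there m) → P⊆Q m }))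
                  (<⇒≱ (s≤s (≤-reflexive (trans (IsClique.size cQ) (sym (IsClique.size isClique))))))

    -- Edges of F inside the kept part come from W₀, designated edges from G and all others from Z.
    -- No edge joins the kept part to the rest, since the kept part is closed under adjacency.
    embed : ∀ c (Z : Outcome n) → c ∈ family → imageEdges H c ⊆ₛ Z → ContainsCopy (G ∪G outcomeGraph {n} (W₀ ∪ₛ Z)) F
    embed c Z c∈ sub = φ , (λ {x} {y} e → same-target full-t (φ-∈ x) (subst (λ z → (z , y) ∈ full) (sym e) (φ-∈ y))) , edge
      where
      open InFamily (family-wf c c∈)
      full : Placement n
      full = c ++ a₁
      full-t : Unique (targets full)
      full-t = Unique-map-++ proj₁ c uniq-t′ uniq-t λ p → proj₂ (∈-∖⁻ (allFin n) (⊆U p))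
      full-p : Unique (patterns full)
      full-p = Unique-map-++ proj₂ c uniq-p′ uniq-p λ p q → disjoint q (pats⁻ p)
      φ : Fin n → Fin n
      φ = targetAt full
      φ-∈ : ∀ x → (φ x , x) ∈ full
      φ-∈ x = targetAt-∈ full (subst (x ∈_) (sym (Listₚ.map-++ proj₂ c a₁)) (case cover x of λ { (inj₁ q) → ∈ₚ.∈-++⁺ʳ (patterns c) q ; (inj₂ q) → ∈ₚ.∈-++⁺ˡ (pats⁺ q) }))
      φ≡ : ∀ {v x} → (v , x) ∈ full → v ≡ φ x
      φ≡ m = same-pattern full-p m (φ-∈ _)
      inRandom : ∀ {u v} → outcomeGraph {n} W₀ u v ≡ true ⊎ outcomeGraph {n} Z u v ≡ true → (G ∪G outcomeGraph {n} (W₀ ∪ₛ Z)) u v ≡ true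
      inRandom {u} {v} (inj₁ h) = ∨-true⁺ {G u v} (inj₂ (outcomeGraph-mono {n} {W₀} {W₀ ∪ₛ Z} (Subₚ.p⊆p∪q Z) h))
      inRandom {u} {v} (inj₂ h) = ∨-true⁺ {G u v} (inj₂ (outcomeGraph-mono {n} {Z} {W₀ ∪ₛ Z} (Subₚ.q⊆p∪q W₀ Z) h))
      first : ∀ {x y} → x ∈ patterns a₁ → F x y ≡ true → outcomeGraph {n} W₀ (φ x) (φ y) ≡ true
      first x∈ f with pattern-∈ a₁ x∈ | pattern-∈ a₁ (closed x∈ f)
      ... | v , vx | w , wy = subst₂ (λ a b → outcomeGraph {n} W₀ a b ≡ true) (φ≡ (∈ₚ.∈-++⁺ʳ c vx)) (φ≡ (∈ₚ.∈-++⁺ʳ c wy)) (realised vx wy f)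
      inG : ∀ {x y} → (x , y) ∈ ps → G (φ x) (φ y) ≡ true
      inG m with edges m
      ... | u , w , p , q , g = subst₂ (λ a b → G a b ≡ true) (φ≡ (∈ₚ.∈-++⁺ˡ p)) (φ≡ (∈ₚ.∈-++⁺ˡ q)) g
      second : ∀ x y → x ∈ xs₂ → y ∈ xs₂ → F x y ≡ true → (G ∪G outcomeGraph {n} (W₀ ∪ₛ Z)) (φ x) (φ y) ≡ true
      second x y x∈ y∈ f with designated? F ps x y
      ... | yes (inj₁ m) = ∨-true⁺ {G (φ x) (φ y)} (inj₁ (inG m))
      ... | yes (inj₂ m) = ∨-true⁺ {G (φ x) (φ y)} (inj₁ (trans (symG (φ x) (φ y)) (inG m)))
      ... | no ¬d with pattern-∈ c (pats⁺ x∈) | pattern-∈ c (pats⁺ y∈)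
      ...   | v , vx | w , wy = inRandom {φ x} {φ y} (inj₂ (subst₂ (λ a b → outcomeGraph {n} Z a b ≡ true) (φ≡ (∈ₚ.∈-++⁺ˡ vx)) (φ≡ (∈ₚ.∈-++⁺ˡ wy))
                (edgesOf⊆ (image H c) (image-sym H (reduced-sym F ps symF) c) sub v≢w (image⁺ H c (x , y , vx , wy , reduced⁺ F ps f ¬d)))))
        where
        v≢w : v ≢ w
        v≢w refl with same-target uniq-t′ vx wy
        ... | refl = case trans (sym f) (irrF x) of λ ()
      edge : ∀ x y → F x y ≡ true → (G ∪G outcomeGraph {n} (W₀ ∪ₛ Z)) (φ x) (φ y) ≡ true
      edge x y f with cover x | cover y
      ... | inj₁ x∈ | _       = inRandom {φ x} {φ y} (inj₁ (first x∈ f))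
      ... | inj₂ _  | inj₁ y∈ = inRandom {φ x} {φ y} (inj₁ (trans (outcomeGraph-sym W₀ (φ x) (φ y)) (first y∈ (trans (symF y x) f))))
      ... | inj₂ x∈ | inj₂ y∈ = second x y x∈ y∈ f

-- The two phases

length≤∣D∣ : ∀ {N} (D : Subset N) (es : List (Fin N)) → Unique es → (∀ {x} → x ∈ es → x ∈ₛ D) → length es ≤ ∣ D ∣
length≤∣D∣ D []       _         _   = z≤n
length≤∣D∣ D (x ∷ es) (new ∷ u) sub = ≤-trans (s≤s (length≤∣D∣ (D Sub.- x) es u λ m → Subₚ.x∈p∧x≢y⇒x∈p-y (sub (there m)) λ { refl → All.lookup new m refl }))
  (Subₚ.x∈p⇒∣p-x∣<∣p∣ (sub (here refl)))

imageEdges-small : ∀ {n} (H : Adj n) → (∀ x y → H x y ≡ H y x) → ∀ {Δ} → MaxDegreeAtMost H Δ → ∀ a → Unique (targets a) → Unique (patterns a) → ∣ imageEdges H a ∣ ≤ n * Δ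
imageEdges-small {n} H symH {Δ} maxdeg a ut up = begin
  ∣ imageEdges H a ∣                             ≤⟨ m≤m+n _ _ ⟩
  2 * ∣ imageEdges H a ∣                         ≤⟨ 2∣T∣≤∑degree {n} (imageEdges H a) ⟩
  ∑ (allFin n) (degree (outcomeGraph {n} (imageEdges H a)))  ≤⟨ ∑-≤const (allFin n) (λ v _ → image-degree H (outcomeGraph {n} (imageEdges H a)) a maxdeg ut up (imageEdges⁻ H symH a Subₚ.⊆-refl) v) ⟩
  length (allFin n) * Δ                          ≡⟨ cong (λ z → z * Δ) (Listₚ.length-tabulate {n = n} (λ i → i)) ⟩
  n * Δ                                          ∎
  where open ≤-Reasoning

module _ {n : ℕ} (F : Adj n) (symF : ∀ u v → F u v ≡ F v u) (irrF : ∀ u → F u u ≡ false) (Δ : ℕ) (maxdeg : MaxDegreeAtMost F Δ) where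

  -- Any indicator f that vanishes wherever a copy exists is at most the indicator that no member of
  -- the family appears; `many-rounds` bounds the latter, and the positive size M of the family
  -- cancels.
  second-phase : ∀ (G : Adj n) (symG : ∀ u v → G u v ≡ G v u) (irrG : ∀ u → G u u ≡ false) {K D} (DP : DensePair G K D) {W₀ : Outcome n} →
    let open DensePair DP in (PE : PartialEmbedding F Δ (X ++ Y) (3 * h) W₀) →
    ∀ k l d λ′ r R C s′ → .{{_ : NonZero r}} .{{_ : NonZero λ′}} .{{_ : NonZero C}} .{{_ : NonZero Δ}} .{{_ : NonZero s′}} .{{_ : NonZero D}} →
    let s = C * Δ * s′ in 3 * s ≤ 2 * h → 2 * D * s ≤ h → n ≤ C * s → d ^ (Δ * suc (suc Δ)) ≤ s′ ^ (2 * suc Δ) →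
    0 < d → 3 ≤ λ′ → λ′ * r * (k + l) ≤ k * d → n * Δ < r ^ R →
    (f : Outcome n → ℕ) → (∀ Z → f Z ≤ 1) → (∀ Z → ContainsCopy (G ∪G outcomeGraph {n} (W₀ ∪ₛ Z)) F → f Z ≡ 0) →
    λ′ * rounds k l (length (pairs n)) R f ≤ 3 * R * ((k + l) ^ length (pairs n)) ^ R
  second-phase G symG irrG {K} {D} DP {W₀} PE k l d λ′ r R C s′ 3s≤2h 2Ds≤h n≤Cs d≤ d>0 3≤λ q≤p nΔ< f f≤1 f≡0 =
    *-cancelˡ-≤ M {{>-nonZero M>0}} (begin
      M * (λ′ * V f)                              ≡⟨ lem M λ′ (V f) ⟩
      λ′ * (M * V f)                              ≤⟨ *-monoʳ-≤ λ′ (*-monoʳ-≤ M (rounds-mono k l N R f≤fails)) ⟩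
      λ′ * (M * V (fails (imageEdges H₂) fam))    ≡⟨ cong (λ z → λ′ * (z * V (fails (imageEdges H₂) fam))) fam-length ⟨
      λ′ * (length fam * V (fails (imageEdges H₂) fam))  ≤⟨ many-rounds k l d λ′ r d>0 3≤λ q≤p R (imageEdges H₂) fam M (n * Δ) nΔ< small spread ⟩
      3 * R * B ^ R * M                           ≡⟨ *-comm _ M ⟩
      M * (3 * R * B ^ R)                         ∎)
    where
    open DensePair DP
    open PartialEmbedding PE
    open ≤-Reasoning
    s = C * Δ * s′
    N = length (pairs n)
    B = (k + l) ^ N
    V = rounds k l N R
    lem : ∀ a b c → a * (b * c) ≡ b * (a * c)
    lem = solve-∀
    s>0 : 0 < s
    s>0 = *-mono-≤ (*-mono-≤ (>-nonZero⁻¹ C) (>-nonZero⁻¹ Δ)) (>-nonZero⁻¹ s′)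
    instance
      β≢0 : NonZero (Δ * suc (suc Δ))
      β≢0 = m*n≢0 Δ (suc (suc Δ))
    H₂ = reduced F (designatedPairs Qs)
    symH₂ = reduced-sym F (designatedPairs Qs) symF
    as₁ = matchings G DP s (designatedPairs Qs)
    ms′ = matched (designatedPairs Qs)
    xs′ = (concat Qs ++ residue) ∖ ms′
    U′ = allFin n ∖ targets a₁
    fam = complete as₁ xs′ U′
    wf = family-wf F G symF irrF symG irrG Δ maxdeg DP s PE
    ps≤ : length (designatedPairs Qs) ≤ 3 * h
    ps≤ = ≤-trans (designated-length Qs) few
    m = length xs′
    U-uniq : Unique U′
    U-uniq = Unique-∖ (targets a₁) (allFin-unique n)
    ms-uniq : Unique ms′
    ms-uniq = designated-unique Qs (Unique-++⁻ˡ (concat Qs) uniq-rest)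
    n≡U : n ≡ length (patterns a₁) + length U′
    n≡U = trans (sym (Listₚ.length-tabulate id)) (trans (length-∖ (allFin n) (targets a₁) (allFin-unique n) uniq-t (λ {x} _ → ∈ₚ.∈-allFin x))
      (cong (_+ length U′) (trans (Listₚ.length-map proj₁ a₁) (sym (Listₚ.length-map proj₂ a₁)))))
    n≡xs : n ≡ length (patterns a₁) + length (concat Qs ++ residue)
    n≡xs = trans (sym (covers⇒length (patterns a₁ ++ (concat Qs ++ residue)) (Uniqueₚ.++⁺ uniq-p uniq-rest λ (p , q) → disjoint p q)
      (λ x → case cover x of λ { (inj₁ q) → ∈ₚ.∈-++⁺ˡ q ; (inj₂ q) → ∈ₚ.∈-++⁺ʳ (patterns a₁) q }))) (Listₚ.length-++ (patterns a₁))
    -- F and the host both have n vertices, so free targets and unplaced vertices are equal in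
    -- number and the completions are bijections.
    U≡xs₂ : length U′ ≡ length (concat Qs ++ residue)
    U≡xs₂ = +-cancelˡ-≡ (length (patterns a₁)) _ _ (trans (sym n≡U) n≡xs)
    xs₂≡ : length (concat Qs ++ residue) ≡ length ms′ + m
    xs₂≡ = length-∖ (concat Qs ++ residue) ms′ uniq-rest ms-uniq (λ q → ∈ₚ.∈-++⁺ˡ (designated-⊆ Qs q))
    XY⊆ : ∀ {t} → t ∈ X ++ Y → t ∈ U′
    XY⊆ {t} q = ∈-∖⁺ (∈ₚ.∈-allFin t) (λ t∈ → avoids t∈ q)
    as₁-wf : ∀ a → a ∈ as₁ → patterns a ≡ ms′ × length (U′ ∖ targets a) ≡ m
    as₁-wf a a∈ = Matched.pats M′ , +-cancelˡ-≡ (length ms′) _ _ (trans (cong (_+ length (U′ ∖ targets a)) (trans (cong length (sym (Matched.pats M′)))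
        (trans (Listₚ.length-map proj₂ a) (sym (Listₚ.length-map proj₁ a))))) (trans (sym (length-∖ U′ (targets a) U-uniq (Matched.uniq M′) (λ q → XY⊆ (Matched.⊆XY M′ q)))) (trans U≡xs₂ xs₂≡)))
      where M′ = matchings-wf G DP s (designatedPairs Qs) a∈
    8h≤U : 4 * h + 4 * h ≤ length U′
    8h≤U = ≤-trans (≤-reflexive (sym (trans (Listₚ.length-++ X) (cong₂ _+_ ∣X∣ ∣Y∣)))) (length-mono U′ (X ++ Y) U-uniq distinct XY⊆)
    -- The 8 h vertices of the pair are all free, and the matching uses at most 2 * 3 h of them.
    2h≤m : 2 * h ≤ m
    2h≤m = +-cancelˡ-≤ (6 * h) _ _ (begin
      6 * h + 2 * h            ≡⟨ lem₈ h ⟩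
      4 * h + 4 * h            ≤⟨ 8h≤U ⟩
      length U′                ≡⟨ trans U≡xs₂ xs₂≡ ⟩
      length ms′ + m           ≤⟨ +-monoˡ-≤ m (≤-trans (≤-reflexive (length-matched (designatedPairs Qs))) (≤-trans (*-monoʳ-≤ 2 ps≤) (≤-reflexive (lem₆ h)))) ⟩
      6 * h + m                ∎)
      where
      lem₈ : ∀ h → 6 * h + 2 * h ≡ 4 * h + 4 * h
      lem₈ = solve-∀
      lem₆ : ∀ h → 2 * (3 * h) ≡ 6 * h
      lem₆ = solve-∀
    3s≤m : 3 * s ≤ m
    3s≤m = ≤-trans 3s≤2h 2h≤m
    M = length as₁ * ff m m
    points : PointSpread fam s M
    points = complete-spread U-uniq (Unique-∖ ms′ uniq-rest) (λ q → proj₂ (∈-∖⁻ (concat Qs ++ residue) q)) as₁-wf ≤-refl 3s≤m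
      (matchings-spread G DP s symG irrG s>0 2Ds≤h (designatedPairs Qs) ps≤ ms-uniq)
    fam-length : length fam ≡ M
    fam-length = complete-length as₁ xs′ U′ U-uniq (λ a a∈ → proj₂ (as₁-wf a a∈))
    M>0 : 0 < M
    M>0 = *-mono-≤ (matchings-nonempty G DP s symG irrG s>0 2Ds≤h (designatedPairs Qs) ps≤) (ff>0 m m ≤-refl)
    wf-unique : ∀ a → a ∈ fam → Unique (targets a) × Unique (patterns a)
    wf-unique a a∈ = InFamily.uniq-t′ (wf a a∈) , InFamily.uniq-p′ (wf a a∈)
    spread : Spread (imageEdges H₂) fam d M
    spread = pointSpread⇒spread H₂ symH₂ {α = suc Δ} {Δ * suc (suc Δ)} fam {C} {s′} (reduced-degree F (designatedPairs Qs) maxdeg) wf-unique points n≤Cs d≤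
      (family-sparse F G symF irrF symG irrG Δ maxdeg DP s PE (>-nonZero⁻¹ Δ))
    small : ∀ a → a ∈ fam → ∣ imageEdges H₂ a ∣ ≤ n * Δ
    small a a∈ = imageEdges-small H₂ symH₂ (reduced-degree F (designatedPairs Qs) maxdeg) a (proj₁ (wf-unique a a∈)) (proj₂ (wf-unique a a∈))
    f≤fails : ∀ Z → f Z ≤ fails (imageEdges H₂) fam Z
    f≤fails Z = go (Any.any? (λ a → imageEdges H₂ a Subₚ.⊆? Z) fam)
      where
      go : (D : Dec (Any (λ a → imageEdges H₂ a ⊆ₛ Z) fam)) → f Z ≤ ι (¬? D)
      go (no _)    = f≤1 Z
      go (yes some) = let c , c∈ , sub = find some in ≤-reflexive (f≡0 Z (embed F G symF irrF symG irrG Δ maxdeg DP s PE c Z c∈ sub))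

  -- The first round: disjoint cliques outside the dense pair

  module _ (XY : List (Fin n)) (XY-unique : Unique XY) (CD : CliqueDecomposition F Δ (allFin n)) where

    open CliqueDecomposition CD

    outside : List (Fin n)
    outside = allFin n ∖ XY

    outside-unique : Unique outside
    outside-unique = Unique-∖ XY (allFin-unique n)

    -- As many cliques as fit outside the pair. Rounding down wastes fewer than Δ + 1 vertices, a
    -- loss that reappears in `few-left`.
    quota : ℕ
    quota = length outside / suc Δ

    firstCliques : List (List (Fin n))
    firstCliques = take quota cliques

    firstPatterns : List (Fin n)
    firstPatterns = concat firstCliques

    private
      split-concat : concat cliques ≡ firstPatterns ++ concat (drop quota cliques)
      split-concat = trans (cong concat (sym (Listₚ.take++drop≡id quota cliques))) (sym (Listₚ.concat-++ firstCliques (drop quota cliques)))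

      unique-split : Unique (firstPatterns ++ (concat (drop quota cliques) ++ rest))
      unique-split = subst Unique (trans (cong (_++ rest) split-concat) (Listₚ.++-assoc firstPatterns _ rest)) distinct

      first∈ : ∀ {Q} → Q ∈ firstCliques → IsClique F Δ Q
      first∈ m = All.lookup areCliques (subst (_ ∈_) (Listₚ.take++drop≡id quota cliques) (∈ₚ.∈-++⁺ˡ m))

      drop∈ : ∀ {Q} → Q ∈ drop quota cliques → IsClique F Δ Q
      drop∈ m = All.lookup areCliques (subst (_ ∈_) (Listₚ.take++drop≡id quota cliques) (∈ₚ.∈-++⁺ʳ firstCliques m))

    firstPatterns-unique : Unique firstPatterns
    firstPatterns-unique = Unique-++⁻ˡ firstPatterns unique-split

    firstPatterns-length : length firstPatterns ≤ length outside
    firstPatterns-length = ≤-trans (≤-reflexive (length-concat firstCliques (All.tabulate λ m → IsClique.size (first∈ m))))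
      (≤-trans (*-monoˡ-≤ (suc Δ) (≤-trans (≤-reflexive (Listₚ.length-take quota cliques)) (m⊓n≤m quota _))) (m/n*n≤m (length outside) (suc Δ)))

    firstFamily : List (Placement n)
    firstFamily = complete ([] ∷ []) firstPatterns outside

    record InFirstFamily (a : Placement n) : Set where
      field
        pats : patterns a ≡ firstPatterns
        ut   : Unique (targets a)
        ⊆out : ∀ {t} → t ∈ targets a → t ∈ outside
      up : Unique (patterns a)
      up = subst Unique (sym pats) firstPatterns-unique

    firstFamily-wf : ∀ {a} → a ∈ firstFamily → InFirstFamily a
    firstFamily-wf m with complete⁻ ([] ∷ []) firstPatterns outside m
    ... | .[] , b , here refl , b∈ , refl with injections-wf firstPatterns (outside ∖ []) (Unique-∖ [] outside-unique) b∈
    ...   | p , ut , sub rewrite Listₚ.++-identityʳ b = record { pats = p ; ut = ut ; ⊆out = λ t∈ → proj₁ (∈-∖⁻ outside (sub t∈)) }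

    private
      outside∖[] : length (outside ∖ []) ≡ length outside
      outside∖[] = sym (length-∖ outside [] outside-unique [] λ ())

    firstFamily-length : length firstFamily ≡ 1 * ff (length outside) (length firstPatterns)
    firstFamily-length = complete-length ([] ∷ []) firstPatterns outside outside-unique λ { .[] (here refl) → outside∖[] }

    -- The critical case of the edge bound, α = 1 and β = Δ + 1: d can be of order n^(2/(Δ+1)) and
    -- no larger power.
    firstFamily-spread : ∀ {C s′ d} → .{{_ : NonZero C}} .{{_ : NonZero Δ}} .{{_ : NonZero s′}} →
      3 * (C * Δ * s′) ≤ length outside → n ≤ C * (C * Δ * s′) → d ^ suc Δ ≤ s′ ^ 2 →
      Spread (imageEdges F) firstFamily d (length firstFamily)
    firstFamily-spread {C} {s′} {d} 3s≤ n≤ d≤ = subst (Spread (imageEdges F) firstFamily d) (sym firstFamily-length)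
      (pointSpread⇒spread F symF {α = 1} {suc Δ} firstFamily {C} {s′} maxdeg (λ a a∈ → InFirstFamily.ut (firstFamily-wf a∈) , InFirstFamily.up (firstFamily-wf a∈))
        (complete-spread {as = [] ∷ []} {[]} {firstPatterns} {outside} {C * Δ * s′} {length outside} {1} outside-unique firstPatterns-unique (λ _ ()) (λ { .[] (here refl) → refl , outside∖[] }) firstPatterns-length 3s≤ (trivial-spread (C * Δ * s′)))
        n≤ d≤ λ A a a∈ symA irrA cov → maxdeg⇒sparse A symA irrA Δ (image-degree F A a maxdeg (InFirstFamily.ut (firstFamily-wf a∈)) (InFirstFamily.up (firstFamily-wf a∈)) cov))

    module _ (W₀ : Outcome n) (a : Placement n) (I : InFirstFamily a) (ℓ′ h : ℕ) (missing : ∣ imageEdges F a ─ W₀ ∣ ≤ ℓ′)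
             (2≤Δ : 2 ≤ Δ) (∣XY∣ : length XY ≡ 8 * h) (slack : suc Δ * suc ℓ′ ≤ h) where

      private
        open InFirstFamily I

        pos : Fin n → Fin n
        pos = targetAt a

        Realised : List (Fin n) → Set
        Realised Q = All (λ x → All (λ y → x ≡ y ⊎ outcomeGraph {n} W₀ (pos x) (pos y) ≡ true) Q) Q

        realised? : ∀ Q → Dec (Realised Q)
        realised? Q = All.all? (λ x → All.all? (λ y → (x Finₚ.≟ y) ⊎-dec (outcomeGraph {n} W₀ (pos x) (pos y) ≟ᵇ true)) Q) Q

        good bad : List (List (Fin n))
        good = filter realised? firstCliques
        bad  = filter (λ Q → ¬? (realised? Q)) firstCliques

        good⁻ : ∀ {Q} → Q ∈ good → Q ∈ firstCliques × Realised Q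
        good⁻ = ∈ₚ.∈-filter⁻ realised? {xs = firstCliques}

        bad⁻ : ∀ {Q} → Q ∈ bad → Q ∈ firstCliques × ¬ Realised Q
        bad⁻ = ∈ₚ.∈-filter⁻ (λ Q → ¬? (realised? Q)) {xs = firstCliques}

        pos-∈ : ∀ {Q x} → Q ∈ firstCliques → x ∈ Q → (pos x , x) ∈ a
        pos-∈ Q∈ x∈ = targetAt-∈ a (subst (_ ∈_) (sym pats) (∈ₚ.∈-concat⁺′ x∈ Q∈))

        MissesIn : List (Fin n) → Fin (length (pairs n)) → Set
        MissesIn Q e = e ∈ₛ (imageEdges F a ─ W₀) × (∃[ x ] ∃[ y ] x ∈ Q × y ∈ Q × Joins e (pos x) (pos y))

        miss : ∀ {Q} → Q ∈ bad → ∃[ e ] MissesIn Q e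
        miss {Q} m = search (searchList (λ x → Any.any? (λ y → ¬? (x Finₚ.≟ y) ×-dec ¬? (outcomeGraph {n} W₀ (pos x) (pos y) ≟ᵇ true)) Q) Q)
          where
          Q∈ = proj₁ (bad⁻ m)
          search : (∃[ x ] x ∈ Q × Any (λ y → x ≢ y × outcomeGraph {n} W₀ (pos x) (pos y) ≢ true) Q) ⊎
                   (∀ x → x ∈ Q → ¬ Any (λ y → x ≢ y × outcomeGraph {n} W₀ (pos x) (pos y) ≢ true) Q) → ∃[ e ] MissesIn Q e
          search (inj₂ none) = contradiction (All.tabulate λ {x} x∈ → All.tabulate λ {y} y∈ → decide x y x∈ y∈ (x Finₚ.≟ y) (outcomeGraph {n} W₀ (pos x) (pos y) ≟ᵇ true)) (proj₂ (bad⁻ m))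
            where
            decide : ∀ x y → x ∈ Q → y ∈ Q → Dec (x ≡ y) → Dec (outcomeGraph {n} W₀ (pos x) (pos y) ≡ true) → x ≡ y ⊎ outcomeGraph {n} W₀ (pos x) (pos y) ≡ true
            decide x y x∈ y∈ (yes e)  _       = inj₁ e
            decide x y x∈ y∈ (no _)   (yes w) = inj₂ w
            decide x y x∈ y∈ (no x≢y) (no ¬w) = contradiction (lose y∈ (x≢y , ¬w)) (none x x∈)
          search (inj₁ (x , x∈ , some)) =
            let y , y∈ , x≢y , ¬w = find some
                e , e∈ , J = missing-edge (image F a) {W₀} (image-sym F symF a) (λ q → x≢y (same-target ut (pos-∈ Q∈ x∈) (subst (λ z → (z , y) ∈ a) (sym q) (pos-∈ Q∈ y∈))))
                               (image⁺ F a (x , y , pos-∈ Q∈ x∈ , pos-∈ Q∈ y∈ , clique-edge F Δ (first∈ Q∈) x∈ y∈ x≢y)) ¬w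
            in e , e∈ , x , y , x∈ , y∈ , J

        joins-end : ∀ {e i j i′ j′} → Joins {n} e i j → Joins e i′ j′ → i ≡ i′ ⊎ i ≡ j′
        joins-end (inj₁ p) (inj₁ q) = inj₁ (cong proj₁ (trans (sym p) q))
        joins-end (inj₁ p) (inj₂ q) = inj₂ (cong proj₁ (trans (sym p) q))
        joins-end (inj₂ p) (inj₁ q) = inj₂ (cong proj₂ (trans (sym p) q))
        joins-end (inj₂ p) (inj₂ q) = inj₁ (cong proj₂ (trans (sym p) q))

        same-pos : ∀ {Q Q′ x y} → Q ∈ firstCliques → Q′ ∈ firstCliques → x ∈ Q → y ∈ Q′ → pos x ≡ pos y → Q ≡ Q′
        same-pos {y = y} Q∈ Q′∈ x∈ y∈ e with same-target ut (pos-∈ Q∈ x∈) (subst (λ z → (z , y) ∈ a) (sym e) (pos-∈ Q′∈ y∈))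
        ... | refl = ∈-concat-unique firstPatterns-unique Q∈ Q′∈ x∈ y∈

        misses-disjoint : ∀ {Q Q′ e} → Q ∈ firstCliques → Q′ ∈ firstCliques → MissesIn Q e → MissesIn Q′ e → Q ≡ Q′
        misses-disjoint {e = e} Q∈ Q′∈ (_ , x , y , x∈ , y∈ , J) (_ , x′ , y′ , x′∈ , y′∈ , J′) with joins-end {e} J J′
        ... | inj₁ q = same-pos Q∈ Q′∈ x∈ x′∈ q
        ... | inj₂ q = same-pos Q∈ Q′∈ x∈ y′∈ q

        witnesses : ∀ Bs → (∀ {Q} → Q ∈ Bs → Q ∈ bad) → Unique (concat Bs) →
          ∃[ es ] Unique es × length es ≡ length Bs × (∀ {e} → e ∈ es → ∃[ Q ] Q ∈ Bs × MissesIn Q e)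
        witnesses []       _   _ = [] , [] , refl , λ ()
        witnesses (Q ∷ Bs) sub u with witnesses Bs (sub ∘ there) (Unique-++⁻ʳ Q u) | miss (sub (here refl))
        ... | es , ue , le , from | e , me = e ∷ es , ∉⇒All≢ fresh ∷ ue , cong suc le ,
                λ { (here refl) → Q , here refl , me ; (there m) → let Q′ , Q′∈ , q = from m in Q′ , there Q′∈ , q }
          where
          fresh : e ∉ es
          fresh m with from m
          ... | Q′ , Q′∈ , q with misses-disjoint {e = e} (proj₁ (bad⁻ (sub (here refl)))) (proj₁ (bad⁻ (sub (there Q′∈)))) me q
          ...   | refl = Unique-++-disjoint Q u x∈ (∈ₚ.∈-concat⁺′ x∈ Q′∈)
            where x∈ = proj₁ (proj₂ (proj₂ (proj₂ me)))

        -- Every unrealised clique misses an edge inside its own image; the images are disjoint, so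
        -- these are distinct elements of the fragment.
        bad≤ : length bad ≤ ℓ′
        bad≤ = let es , ue , le , from = witnesses bad id (Unique-concat-filter (λ Q → ¬? (realised? Q)) firstCliques firstPatterns-unique) in
          ≤-trans (≤-reflexive (sym le)) (≤-trans (length≤∣D∣ (imageEdges F a ─ W₀) es ue λ m → proj₁ (proj₂ (proj₂ (from m)))) missing)

        n≡ : n ≡ 8 * h + length outside
        n≡ = trans (sym (Listₚ.length-tabulate id)) (trans (length-∖ (allFin n) XY (allFin-unique n) XY-unique (λ {x} _ → ∈ₚ.∈-allFin x)) (cong (_+ length outside) ∣XY∣))

        -- The cliques beyond the quota cover at most 8 h + Δ + 1 vertices, and `slack` bounds the
        -- damaged cliques and the rounding by h more vertices. The total 9 h is divided by Δ + 1 ≥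
        -- 3.
        few-left : length (bad ++ drop quota cliques) ≤ 3 * h
        few-left = *-cancelˡ-≤ (suc Δ) (begin
          suc Δ * length (bad ++ drop quota cliques)             ≡⟨ trans (cong (suc Δ *_) (Listₚ.length-++ bad)) (*-distribˡ-+ (suc Δ) (length bad) _) ⟩
          suc Δ * length bad + suc Δ * length (drop quota cliques) ≤⟨ +-mono-≤ (*-monoʳ-≤ (suc Δ) bad≤) dropped ⟩
          suc Δ * ℓ′ + (8 * h + suc Δ)                           ≡⟨ lem (suc Δ) ℓ′ (8 * h) ⟩
          8 * h + suc Δ * suc ℓ′                                 ≤⟨ +-monoʳ-≤ (8 * h) slack ⟩
          8 * h + h                                              ≡⟨ lem′ h ⟩
          3 * (3 * h)                                            ≤⟨ *-monoˡ-≤ (3 * h) (s≤s 2≤Δ) ⟩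
          suc Δ * (3 * h)                                        ∎)
          where
          open ≤-Reasoning
          lem : ∀ a b c → a * b + (c + a) ≡ c + a * (1 + b)
          lem = solve-∀
          lem′ : ∀ h → 8 * h + h ≡ 3 * (3 * h)
          lem′ = solve-∀
          all≤n : suc Δ * length cliques ≤ n
          all≤n = ≤-trans (≤-reflexive (trans (*-comm (suc Δ) _) (sym (length-concat cliques (All.map IsClique.size areCliques))))) (length≤n (concat cliques) (Unique-++⁻ˡ (concat cliques) distinct))
          dropped : suc Δ * length (drop quota cliques) ≤ 8 * h + suc Δ
          dropped = begin
            suc Δ * length (drop quota cliques)                  ≡⟨ trans (cong (suc Δ *_) (Listₚ.length-drop quota cliques)) (*-distribˡ-∸ (suc Δ) (length cliques) quota) ⟩
            suc Δ * length cliques ∸ suc Δ * quota               ≤⟨ ∸-monoˡ-≤ (suc Δ * quota) all≤n ⟩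
            n ∸ suc Δ * quota                                    ≤⟨ m≤n+o⇒m∸n≤o n (suc Δ * quota) bound ⟩
            8 * h + suc Δ                                        ∎
            where
            lem″ : ∀ a b c → a + b * (1 + c) ≡ b * c + (a + b)
            lem″ = solve-∀
            bound : n ≤ suc Δ * quota + (8 * h + suc Δ)
            bound = begin
              n                                                  ≡⟨ n≡ ⟩
              8 * h + length outside                             ≤⟨ +-monoʳ-≤ (8 * h) (m≤n*[1+m/n] (length outside) (suc Δ)) ⟩
              8 * h + suc Δ * suc quota                          ≡⟨ lem″ (8 * h) (suc Δ) quota ⟩
              suc Δ * quota + (8 * h + suc Δ)                    ∎

      first-phase : PartialEmbedding F Δ XY (3 * h) W₀
      first-phase = record
        { a₁ = kept ; Qs = bad ++ drop quota cliques ; residue = rest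
        ; uniq-t = Unique-map-filter proj₁ keep? a ut ; uniq-p = Unique-map-filter proj₂ keep? a up
        ; avoids = λ t∈ xy → avoid t∈ xy
        ; cover = covered ; disjoint = apart ; uniq-rest = subst Unique (sym reassoc) unique-rest
        ; closed = closed ; realised = realised
        ; areCliques = All.tabulate λ m → case ∈ₚ.∈-++⁻ bad m of λ { (inj₁ q) → first∈ (proj₁ (bad⁻ q)) ; (inj₂ q) → drop∈ q }
        ; cliqueFree = cliqueFree ; few = few-left }
        where
        keep? : ∀ (c : Fin n × Fin n) → Dec (proj₂ c ∈ concat good)
        keep? c = proj₂ c ∈? concat good
        kept : Placement n
        kept = filter keep? a
        kept⁻ : ∀ {c} → c ∈ kept → c ∈ a × proj₂ c ∈ concat good
        kept⁻ = ∈ₚ.∈-filter⁻ keep? {xs = a}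
        reassoc : concat (bad ++ drop quota cliques) ++ rest ≡ concat bad ++ (concat (drop quota cliques) ++ rest)
        reassoc = trans (cong (_++ rest) (sym (Listₚ.concat-++ bad (drop quota cliques)))) (Listₚ.++-assoc (concat bad) _ rest)
        bad⊆ : ∀ {x} → x ∈ concat bad → x ∈ firstPatterns
        bad⊆ m = let Q , x∈ , Q∈ = ∈ₚ.∈-concat⁻′ bad m in ∈ₚ.∈-concat⁺′ x∈ (proj₁ (bad⁻ Q∈))
        good⊆ : ∀ {x} → x ∈ concat good → ∃[ Q ] x ∈ Q × Q ∈ firstCliques × Realised Q
        good⊆ m = let Q , x∈ , Q∈ = ∈ₚ.∈-concat⁻′ good m ; Q∈′ , r = good⁻ Q∈ in Q , x∈ , Q∈′ , r
        unique-rest : Unique (concat bad ++ (concat (drop quota cliques) ++ rest))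
        unique-rest = Uniqueₚ.++⁺ (Unique-concat-filter (λ Q → ¬? (realised? Q)) firstCliques firstPatterns-unique) (Unique-++⁻ʳ firstPatterns unique-split)
          λ (p , q) → Unique-++-disjoint firstPatterns unique-split (bad⊆ p) q
        kept-pattern : ∀ {x} → x ∈ patterns kept → x ∈ concat good
        kept-pattern m = let v , c∈ = pattern-∈ kept m in proj₂ (kept⁻ c∈)
        good-kept : ∀ {x} → x ∈ concat good → x ∈ patterns kept
        good-kept m = let Q , x∈ , Q∈ , _ = good⊆ m in ∈ₚ.∈-map⁺ proj₂ (∈ₚ.∈-filter⁺ keep? (pos-∈ Q∈ x∈) m)
        avoid : ∀ {t} → t ∈ targets kept → t ∉ XY
        avoid m xy with ∈ₚ.∈-map⁻ proj₁ m
        ... | c , c∈ , refl = proj₂ (∈-∖⁻ (allFin n) (⊆out (∈ₚ.∈-map⁺ proj₁ (proj₁ (kept⁻ c∈))))) xy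
        covered : ∀ x → x ∈ patterns kept ⊎ x ∈ concat (bad ++ drop quota cliques) ++ rest
        covered x = split (∈ₚ.∈-++⁻ firstPatterns (subst (x ∈_) (trans (cong (_++ rest) split-concat) (Listₚ.++-assoc firstPatterns _ rest)) (vs⊆ (∈ₚ.∈-allFin x))))
          where
          sort : ∀ {Q} → x ∈ Q → Q ∈ firstCliques → Dec (Realised Q) → x ∈ patterns kept ⊎ x ∈ concat (bad ++ drop quota cliques) ++ rest
          sort x∈ Q∈ (yes r) = inj₁ (good-kept (∈ₚ.∈-concat⁺′ x∈ (∈ₚ.∈-filter⁺ realised? Q∈ r)))
          sort x∈ Q∈ (no ¬r) = inj₂ (subst (x ∈_) (sym reassoc) (∈ₚ.∈-++⁺ˡ (∈ₚ.∈-concat⁺′ x∈ (∈ₚ.∈-filter⁺ (λ Q → ¬? (realised? Q)) Q∈ ¬r))))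
          split : x ∈ firstPatterns ⊎ x ∈ concat (drop quota cliques) ++ rest → x ∈ patterns kept ⊎ x ∈ concat (bad ++ drop quota cliques) ++ rest
          split (inj₂ m) = inj₂ (subst (x ∈_) (sym reassoc) (∈ₚ.∈-++⁺ʳ (concat bad) m))
          split (inj₁ m) = let Q , x∈ , Q∈ = ∈ₚ.∈-concat⁻′ firstCliques m in sort x∈ Q∈ (realised? Q)
        apart : ∀ {x} → x ∈ patterns kept → x ∉ concat (bad ++ drop quota cliques) ++ rest
        apart {x} m m′ = go (good⊆ (kept-pattern m)) (∈ₚ.∈-++⁻ (concat bad) (subst (x ∈_) reassoc m′))
          where
          go : (∃[ Q ] x ∈ Q × Q ∈ firstCliques × Realised Q) → x ∈ concat bad ⊎ x ∈ concat (drop quota cliques) ++ rest → ⊥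
          go (Q , x∈ , Q∈ , r) (inj₂ q) = Unique-++-disjoint firstPatterns unique-split (∈ₚ.∈-concat⁺′ x∈ Q∈) q
          go (Q , x∈ , Q∈ , r) (inj₁ q) = let Q′ , x∈′ , Q′∈ = ∈ₚ.∈-concat⁻′ bad q in
            proj₂ (bad⁻ Q′∈) (subst Realised (∈-concat-unique firstPatterns-unique Q∈ (proj₁ (bad⁻ Q′∈)) x∈ x∈′) r)
        closed : ∀ {x y} → x ∈ patterns kept → F x y ≡ true → y ∈ patterns kept
        closed m f = let Q , x∈ , Q∈ , r = good⊆ (kept-pattern m) in
          good-kept (∈ₚ.∈-concat⁺′ (clique-closed F Δ maxdeg (first∈ Q∈) x∈ f) (∈ₚ.∈-filter⁺ realised? Q∈ r))
        realised : ∀ {i j x y} → (i , x) ∈ kept → (j , y) ∈ kept → F x y ≡ true → outcomeGraph {n} W₀ i j ≡ true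
        realised {i} {j} {x} {y} ix jy f =
          let ix∈ , x∈good = kept⁻ ix
              jy∈ , _ = kept⁻ jy
              Q , x∈ , Q∈ , r = good⊆ x∈good
          in go ix∈ jy∈ (All.lookup (All.lookup r x∈) (clique-closed F Δ maxdeg (first∈ Q∈) x∈ f))
          where
          go : (i , x) ∈ a → (j , y) ∈ a → x ≡ y ⊎ outcomeGraph {n} W₀ (pos x) (pos y) ≡ true → outcomeGraph {n} W₀ i j ≡ true
          go ix∈ jy∈ (inj₁ e) = case trans (sym (subst (λ z → F x z ≡ true) (sym e) f)) (irrF x) of λ ()
          go ix∈ jy∈ (inj₂ w) = subst₂ (λ u v → outcomeGraph {n} W₀ u v ≡ true) (same-pattern up (targetAt-∈ a (∈ₚ.∈-map⁺ proj₂ ix∈)) ix∈) (same-pattern up (targetAt-∈ a (∈ₚ.∈-map⁺ proj₂ jy∈)) jy∈) w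

-- Deciding whether a copy exists

module _ {n m : ℕ} (H : Adj m) (F : Adj n) where

  IsCopy : (Fin n → Fin m) → Set
  IsCopy φ = (∀ i j → φ i ≡ φ j → i ≡ j) × (∀ u v → F u v ≡ true → H (φ u) (φ v) ≡ true)

  isCopy? : ∀ φ → Dec (IsCopy φ)
  isCopy? φ = Finₚ.all? (λ i → Finₚ.all? λ j → (φ i Finₚ.≟ φ j) →-dec (i Finₚ.≟ j)) ×-dec
              Finₚ.all? (λ u → Finₚ.all? λ v → (F u v ≟ᵇ true) →-dec (H (φ u) (φ v) ≟ᵇ true))

  vectors : (k : ℕ) → List (Vec (Fin m) k)
  vectors zero    = [] ∷ []
  vectors (suc k) = concatMap (λ v → map (_∷ v) (allFin m)) (vectors k)

  ∈-vectors : ∀ {k} (v : Vec (Fin m) k) → v ∈ vectors k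
  ∈-vectors []      = here refl
  ∈-vectors (x ∷ v) = ∈ₚ.∈-concatMap⁺ (λ v → map (_∷ v) (allFin m)) (lose (∈-vectors v) (∈ₚ.∈-map⁺ (_∷ v) (∈ₚ.∈-allFin x)))

  abstract
    -- Maps are searched through their vectors of values. The decision makes the absence of a copy
    -- an indicator that can be averaged.
    containsCopy? : Dec (ContainsCopy H F)
    containsCopy? = map′ to from (Any.any? (λ v → isCopy? (Vec.lookup v)) (vectors n))
      where
      to : Any (λ v → IsCopy (Vec.lookup v)) (vectors n) → ContainsCopy H F
      to some = let v , _ , inj , edge = find some in Vec.lookup v , (λ {i} {j} → inj i j) , edge
      from : ContainsCopy H F → Any (λ v → IsCopy (Vec.lookup v)) (vectors n)
      from (φ , inj , edge) = lose (∈-vectors (Vec.tabulate φ))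
        ( (λ i j e → inj (trans (sym (Vecₚ.lookup∘tabulate φ i)) (trans e (Vecₚ.lookup∘tabulate φ j))))
        , λ u v f → subst₂ (λ a b → H a b ≡ true) (sym (Vecₚ.lookup∘tabulate φ u)) (sym (Vecₚ.lookup∘tabulate φ v)) (edge u v f) )

module _ {n : ℕ} (F G : Adj n) where

  copyIn? : ∀ (ω : Outcome n) → Dec (ContainsCopy (G ∪G outcomeGraph {n} ω) F)
  copyIn? ω = containsCopy? (G ∪G outcomeGraph {n} ω) F

  noCopy : Outcome n → ℕ
  noCopy ω = ι (¬? (copyIn? ω))

  copy-mono : ∀ {ω ω′ : Outcome n} → ω ⊆ₛ ω′ → ContainsCopy (G ∪G outcomeGraph {n} ω) F → ContainsCopy (G ∪G outcomeGraph {n} ω′) F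
  copy-mono {ω} {ω′} sub (φ , inj , edge) = φ , inj , λ u v f → raise u v (∨-true⁻ {G (φ u) (φ v)} (edge u v f))
    where
    raise : ∀ u v → G (φ u) (φ v) ≡ true ⊎ outcomeGraph {n} ω (φ u) (φ v) ≡ true → (G ∪G outcomeGraph {n} ω′) (φ u) (φ v) ≡ true
    raise u v (inj₁ g) = ∨-true⁺ {G (φ u) (φ v)} (inj₁ g)
    raise u v (inj₂ o) = ∨-true⁺ {G (φ u) (φ v)} (inj₂ (outcomeGraph-mono {n} {ω} {ω′} sub o))

  noCopy-antitone : ∀ {ω ω′ : Outcome n} → ω ⊆ₛ ω′ → noCopy ω′ ≤ noCopy ω
  noCopy-antitone {ω} {ω′} sub = ι-mono (¬? (copyIn? ω′)) (¬? (copyIn? ω)) λ ¬c c → ¬c (copy-mono sub c)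

  -- The failure probability of both phases together

  module _ (symF : ∀ u v → F u v ≡ F v u) (irrF : ∀ u → F u u ≡ false) (symG : ∀ u v → G u v ≡ G v u) (irrG : ∀ u → G u u ≡ false)
           (Δ : ℕ) (maxdeg : MaxDegreeAtMost F Δ) where

    -- Call W₀ good if at least one placement has a short fragment. For good W₀ the later rounds
    -- fail with probability at most 3 R / λ′. For the other W₀ all L placements are long, which by
    -- `one-round` has probability at most 2^-(ℓ′+1). The two conditions on δ₀ make each at most 1 /
    -- (2 δ₀).
    two-phase : ∀ {K D} (DP : DensePair G K D) → let open DensePair DP in
      ∀ k l d₁ r₁ d₂ λ′ r R C s′ δ₀ → .{{_ : NonZero r₁}} .{{_ : NonZero r}} .{{_ : NonZero λ′}} .{{_ : NonZero C}} .{{_ : NonZero Δ}} .{{_ : NonZero s′}} .{{_ : NonZero D}} →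
      let s = C * Δ * s′ ; ℓ′ = n * Δ / r₁ in
      2 ≤ Δ → n ≤ C * s → 2 * D * s ≤ h →
      0 < d₁ → d₁ ^ suc Δ ≤ s′ ^ 2 → 6 * r₁ * (k + l) ≤ k * d₁ → suc Δ * suc ℓ′ ≤ h → 2 * δ₀ ≤ 2 ^ suc ℓ′ →
      0 < d₂ → d₂ ^ (Δ * suc (suc Δ)) ≤ s′ ^ (2 * suc Δ) → λ′ * r * (k + l) ≤ k * d₂ → n * Δ < r ^ R → 3 ≤ λ′ → 6 * R * δ₀ ≤ λ′ →
      δ₀ * rounds k l (length (pairs n)) (suc R) noCopy ≤ ((k + l) ^ length (pairs n)) ^ suc R
    two-phase {K} {D} DP k l d₁ r₁ d₂ λ′ r R C s′ δ₀ 2≤Δ n≤Cs 2Ds≤h d₁>0 d₁≤ q₁ slack δ₁ d₂>0 d₂≤ q₂ nΔ< 3≤λ δ₂ =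
      *-cancelˡ-≤ (L * (2 ^ j * λ′) * 2) {{m*n≢0 _ 2 {{m*n≢0 L _ {{>-nonZero L>0}} {{m*n≢0 (2 ^ j) λ′ {{m^n≢0 2 j}}}}}}}} (begin
        L * (2 ^ j * λ′) * 2 * (δ₀ * EV)                            ≡⟨ lem₁ L (2 ^ j) λ′ δ₀ EV ⟩
        2 * δ₀ * (2 ^ j * (λ′ * (L * EV)))                          ≤⟨ *-monoʳ-≤ (2 * δ₀) averaged ⟩
        2 * δ₀ * (2 ^ j * (L * (3 * R * B ^ R * B)) + λ′ * (B ^ R * (L * B)))  ≡⟨ lem₂ δ₀ (2 ^ j) L R (B ^ R) B λ′ ⟩
        L * (B * B ^ R) * (2 ^ j * (6 * R * δ₀) + 2 * δ₀ * λ′)      ≤⟨ *-monoʳ-≤ (L * (B * B ^ R)) (+-mono-≤ (*-monoʳ-≤ (2 ^ j) δ₂) (*-monoˡ-≤ λ′ δ₁)) ⟩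
        L * (B * B ^ R) * (2 ^ j * λ′ + 2 ^ j * λ′)                 ≡⟨ lem₃ L (B * B ^ R) (2 ^ j * λ′) ⟩
        L * (2 ^ j * λ′) * 2 * (B * B ^ R)                          ∎)
      where
      open DensePair DP
      open ≤-Reasoning
      N = length (pairs n)
      B = (k + l) ^ N
      s = C * Δ * s′
      ℓ′ = n * Δ / r₁
      j = suc ℓ′
      XY = X ++ Y
      CD : CliqueDecomposition F Δ (allFin n)
      CD = decompose F Δ n (allFin n) (≤-reflexive (Listₚ.length-tabulate {n = n} (λ i → i))) (allFin-unique n)
      fam = firstFamily F symF irrF Δ maxdeg XY distinct CD
      L = length fam
      V : Outcome n → ℕ
      V W₀ = rounds k l N R (λ Z → noCopy (W₀ ∪ₛ Z))
      EV = E k l N V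
      lem₁ : ∀ L t λ′ δ x → L * (t * λ′) * 2 * (δ * x) ≡ 2 * δ * (t * (λ′ * (L * x)))
      lem₁ = solve-∀
      lem₂ : ∀ δ t L R q B λ′ → 2 * δ * (t * (L * (3 * R * q * B)) + λ′ * (q * (L * B))) ≡ L * (B * q) * (t * (6 * R * δ) + 2 * δ * λ′)
      lem₂ = solve-∀
      lem₃ : ∀ L q x → L * q * (x + x) ≡ L * x * 2 * q
      lem₃ = solve-∀
      ∣XY∣ : length XY ≡ 8 * h
      ∣XY∣ = trans (Listₚ.length-++ X) (trans (cong₂ _+_ ∣X∣ ∣Y∣) (lem h))
        where
        lem : ∀ h → 4 * h + 4 * h ≡ 8 * h
        lem = solve-∀
      out≡ : n ≡ 8 * h + length (outside F symF irrF Δ maxdeg XY distinct CD)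
      out≡ = trans (sym (Listₚ.length-tabulate {n = n} (λ i → i))) (trans (length-∖ (allFin n) XY (allFin-unique n) distinct (λ {x} _ → ∈ₚ.∈-allFin x)) (cong (_+ length (allFin n ∖ XY)) ∣XY∣))
      2s≤h : 2 * s ≤ h
      2s≤h = ≤-trans (*-monoˡ-≤ s (≤-trans (≤-reflexive (sym (*-identityʳ 2))) (*-monoʳ-≤ 2 (>-nonZero⁻¹ D)))) 2Ds≤h
      3s≤2h : 3 * s ≤ 2 * h
      3s≤2h = ≤-trans (≤-trans (m≤m+n (3 * s) s) (≤-reflexive (lem s))) (*-monoʳ-≤ 2 2s≤h)
        where
        lem : ∀ s → 3 * s + s ≡ 2 * (2 * s)
        lem = solve-∀
      3s≤out : 3 * s ≤ length (outside F symF irrF Δ maxdeg XY distinct CD)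
      3s≤out = ≤-trans 3s≤2h (+-cancelˡ-≤ (8 * h) _ _ (≤-trans (≤-trans (m≤m+n _ (54 * h)) (≤-reflexive (lem h))) (≤-trans 64h≤n (≤-reflexive out≡))))
        where
        lem : ∀ h → 8 * h + 2 * h + 54 * h ≡ 64 * h
        lem = solve-∀
      wf : ∀ {a} → a ∈ fam → InFirstFamily F symF irrF Δ maxdeg XY distinct CD a
      wf = firstFamily-wf F symF irrF Δ maxdeg XY distinct CD
      L>0 : 0 < L
      L>0 = subst (0 <_) (sym (trans (firstFamily-length F symF irrF Δ maxdeg XY distinct CD) (*-identityˡ _))) (ff>0 _ _ (firstPatterns-length F symF irrF Δ maxdeg XY distinct CD))
      first : 2 ^ j * E k l N (#long (imageEdges F) fam ℓ′) ≤ L * B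
      first = one-round (imageEdges F) fam k l d₁ r₁ L (n * Δ) d₁>0 q₁
        (λ a a∈ → imageEdges-small F symF maxdeg a (InFirstFamily.ut (wf a∈)) (InFirstFamily.up (wf a∈)))
        (firstFamily-spread F symF irrF Δ maxdeg XY distinct CD {C} {s′} {d₁} 3s≤out n≤Cs d₁≤)
      -- The placement carried on is `bestFor`, not `a` itself: the fragment is what W₀ misses of
      -- that one.
      good-outcome : ∀ W₀ → (∃[ a ] a ∈ fam × ∣ fragment (imageEdges F) fam W₀ a ∣ ≤ ℓ′) → λ′ * V W₀ ≤ 3 * R * B ^ R
      good-outcome W₀ (a , a∈ , short) = second-phase F symF irrF Δ maxdeg G symG irrG DP
        (first-phase F symF irrF Δ maxdeg XY distinct CD W₀ (bestFor (imageEdges F) fam W₀ a) (wf (proj₁ (bestFor-∈ (imageEdges F) fam W₀ a∈))) ℓ′ h short 2≤Δ ∣XY∣ slack)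
        k l d₂ λ′ r R C s′ 3s≤2h 2Ds≤h n≤Cs d₂≤ d₂>0 3≤λ q₂ nΔ<
        (λ Z → noCopy (W₀ ∪ₛ Z)) (λ Z → ι≤1 (¬? (copyIn? (W₀ ∪ₛ Z)))) (λ Z c → ι-no (¬? (copyIn? (W₀ ∪ₛ Z))) λ ¬c → ¬c c)
      pointwise : ∀ W₀ → λ′ * (L * V W₀) ≤ L * (3 * R * B ^ R) + λ′ * (B ^ R * #long (imageEdges F) fam ℓ′ W₀)
      pointwise W₀ = go (searchList (long? (imageEdges F) fam ℓ′ W₀) fam)
        where
        swap : ∀ a b c → a * (b * c) ≡ b * (a * c)
        swap = solve-∀
        go : (∃[ a ] a ∈ fam × ∣ fragment (imageEdges F) fam W₀ a ∣ ≤ ℓ′) ⊎ (∀ a → a ∈ fam → ¬ (∣ fragment (imageEdges F) fam W₀ a ∣ ≤ ℓ′)) → λ′ * (L * V W₀) ≤ L * (3 * R * B ^ R) + λ′ * (B ^ R * #long (imageEdges F) fam ℓ′ W₀)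
        go (inj₁ good) = ≤-trans (≤-reflexive (swap λ′ L (V W₀))) (≤-trans (*-monoʳ-≤ L (good-outcome W₀ good)) (m≤m+n _ _))
        go (inj₂ none) = ≤-trans (*-monoʳ-≤ λ′ (≤-trans (≤-reflexive (*-comm L (V W₀))) (*-mono-≤ (rounds-≤1 k l N R (λ Z → ι≤1 (¬? (copyIn? (W₀ ∪ₛ Z))))) all-long))) (m≤n+m _ _)
          where
          all-long : L ≤ #long (imageEdges F) fam ℓ′ W₀
          all-long = ≤-trans (≤-reflexive (sym (∑-length fam))) (∑-mono fam λ a a∈ → ≤-reflexive (sym (ι-yes (¬? (long? (imageEdges F) fam ℓ′ W₀ a)) (none a a∈))))
      averaged : 2 ^ j * (λ′ * (L * EV)) ≤ 2 ^ j * (L * (3 * R * B ^ R * B)) + λ′ * (B ^ R * (L * B))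
      averaged = begin
        2 ^ j * (λ′ * (L * EV))                                          ≡⟨ cong (2 ^ j *_) (trans (cong (λ′ *_) (E-*ˡ k l N L)) (E-*ˡ k l N λ′)) ⟩
        2 ^ j * E k l N (λ W₀ → λ′ * (L * V W₀))                         ≤⟨ *-monoʳ-≤ (2 ^ j) (E-mono k l N pointwise) ⟩
        2 ^ j * E k l N (λ W₀ → L * (3 * R * B ^ R) + λ′ * (B ^ R * #long (imageEdges F) fam ℓ′ W₀))  ≡⟨ cong (2 ^ j *_) (trans (E-+ k l N) (cong₂ _+_ (E-const k l N _) (sym (trans (cong (λ′ *_) (E-*ˡ k l N (B ^ R))) (E-*ˡ k l N λ′))))) ⟩
        2 ^ j * (B * (L * (3 * R * B ^ R)) + λ′ * (B ^ R * X₁))          ≡⟨ lem₄ (2 ^ j) B L R (B ^ R) λ′ X₁ ⟩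
        2 ^ j * (L * (3 * R * B ^ R * B)) + λ′ * (B ^ R * (2 ^ j * X₁))  ≤⟨ +-monoʳ-≤ _ (*-monoʳ-≤ λ′ (*-monoʳ-≤ (B ^ R) first)) ⟩
        2 ^ j * (L * (3 * R * B ^ R * B)) + λ′ * (B ^ R * (L * B))       ∎
        where
        X₁ = E k l N (#long (imageEdges F) fam ℓ′)
        lem₄ : ∀ t B L R q λ′ x → t * (B * (L * (3 * R * q)) + λ′ * (q * x)) ≡ t * (L * (3 * R * q * B)) + λ′ * (q * (t * x))
        lem₄ = solve-∀

-- Sprinkling

E-01 : ∀ N (f : Subset N → ℕ) → E 0 1 N f ≡ f ∅
E-01 zero    f = refl
E-01 (suc N) f = trans (+-identityʳ _) (E-01 N (f ∘ (false ∷_)))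

-- The union of independent random sets of densities k₁ / (k₁ + l₁) and k₂ / (k₂ + l₂).
E-∪ : ∀ k₁ l₁ k₂ l₂ N (f : Subset N → ℕ) →
      E k₁ l₁ N (λ W → E k₂ l₂ N (λ Y → f (W ∪ₛ Y))) ≡ E (k₁ * (k₂ + l₂) + l₁ * k₂) (l₁ * l₂) N f
E-∪ k₁ l₁ k₂ l₂ zero    f = refl
E-∪ k₁ l₁ k₂ l₂ (suc N) f = begin
  k₁ * E k₁ l₁ N (λ W → k₂ * Y₁ W + l₂ * Y₁ W) + l₁ * E k₁ l₁ N (λ W → k₂ * Y₁ W + l₂ * Y₀ W)
    ≡⟨ cong₂ (λ a b → k₁ * a + l₁ * b) (trans (E-+ k₁ l₁ N) (cong₂ _+_ (sym (E-*ˡ k₁ l₁ N k₂)) (sym (E-*ˡ k₁ l₁ N l₂)))) (trans (E-+ k₁ l₁ N) (cong₂ _+_ (sym (E-*ˡ k₁ l₁ N k₂)) (sym (E-*ˡ k₁ l₁ N l₂)))) ⟩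
  k₁ * (k₂ * E k₁ l₁ N Y₁ + l₂ * E k₁ l₁ N Y₁) + l₁ * (k₂ * E k₁ l₁ N Y₁ + l₂ * E k₁ l₁ N Y₀)
    ≡⟨ cong₂ (λ a b → k₁ * (k₂ * a + l₂ * a) + l₁ * (k₂ * a + l₂ * b)) (E-∪ k₁ l₁ k₂ l₂ N (f ∘ (true ∷_))) (E-∪ k₁ l₁ k₂ l₂ N (f ∘ (false ∷_))) ⟩
  k₁ * (k₂ * a + l₂ * a) + l₁ * (k₂ * a + l₂ * b)
    ≡⟨ lem k₁ l₁ k₂ l₂ a b ⟩
  (k₁ * (k₂ + l₂) + l₁ * k₂) * a + l₁ * l₂ * b
    ∎
  where
  open ≡-Reasoning
  Y₁ Y₀ : Subset N → ℕ
  Y₁ W = E k₂ l₂ N (λ Y → f (true ∷ (W ∪ₛ Y)))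
  Y₀ W = E k₂ l₂ N (λ Y → f (false ∷ (W ∪ₛ Y)))
  a = E (k₁ * (k₂ + l₂) + l₁ * k₂) (l₁ * l₂) N (f ∘ (true ∷_))
  b = E (k₁ * (k₂ + l₂) + l₁ * k₂) (l₁ * l₂) N (f ∘ (false ∷_))
  lem : ∀ k₁ l₁ k₂ l₂ a b → k₁ * (k₂ * a + l₂ * a) + l₁ * (k₂ * a + l₂ * b) ≡ (k₁ * (k₂ + l₂) + l₁ * k₂) * a + l₁ * l₂ * b
  lem = solve-∀

-- A point is missed by the union exactly when every round misses it, which has weight l ^ j; K is
-- the complementary weight.
rounds≡E : ∀ k l N j → ∃[ K ] K + l ^ j ≡ (k + l) ^ j × (∀ f → rounds k l N j f ≡ E K (l ^ j) N f)
rounds≡E k l N zero    = 0 , refl , λ f → sym (E-01 N f)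
rounds≡E k l N (suc j) with rounds≡E k l N j
... | K , e , eq = k * (K + l ^ j) + l * K , trans (lem k l K (l ^ j)) (cong ((k + l) *_) e) ,
    λ f → trans (E-cong k l N λ W → eq (λ Y → f (W ∪ₛ Y))) (E-∪ k l K (l ^ j) N f)
  where
  lem : ∀ k l K q → k * (K + q) + l * K + l * q ≡ (k + l) * (K + q)
  lem = solve-∀

-- Coordinate by coordinate, this compares two averages of x ≤ y, and the hypothesis says that the
-- denser set puts at least as much weight on the smaller value x.
E-antitone : ∀ P Q K L N (f : Subset N → ℕ) → (∀ {S T} → S ⊆ₛ T → f T ≤ f S) → Q * (K + L) ≤ L * (P + Q) →
             E P Q N f * (K + L) ^ N ≤ (P + Q) ^ N * E K L N f
E-antitone P Q K L zero    f anti h = ≤-reflexive (trans (*-identityʳ _) (sym (*-identityˡ _)))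
E-antitone P Q K L (suc N) f anti h = begin
  (P * x + Q * y) * ((K + L) * (K + L) ^ N)                       ≡⟨ *-assoc (P * x + Q * y) (K + L) _ ⟨
  (P * x + Q * y) * (K + L) * (K + L) ^ N                         ≤⟨ *-monoˡ-≤ ((K + L) ^ N) mix ⟩
  (K * x + L * y) * (P + Q) * (K + L) ^ N                         ≡⟨ lem K L x y (P + Q) ((K + L) ^ N) ⟩
  (P + Q) * (K * (x * (K + L) ^ N) + L * (y * (K + L) ^ N))       ≤⟨ *-monoʳ-≤ (P + Q) (+-mono-≤ (*-monoʳ-≤ K (E-antitone P Q K L N (f ∘ (true ∷_)) (anti ∘ Subₚ.s⊆s) h)) (*-monoʳ-≤ L (E-antitone P Q K L N (f ∘ (false ∷_)) (anti ∘ Subₚ.s⊆s) h))) ⟩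
  (P + Q) * (K * ((P + Q) ^ N * x′) + L * ((P + Q) ^ N * y′))     ≡⟨ lem′ K L x′ y′ (P + Q) ((P + Q) ^ N) ⟩
  (P + Q) * (P + Q) ^ N * (K * x′ + L * y′)                       ∎
  where
  open ≤-Reasoning
  x y x′ y′ : ℕ
  x  = E P Q N (f ∘ (true ∷_))
  y  = E P Q N (f ∘ (false ∷_))
  x′ = E K L N (f ∘ (true ∷_))
  y′ = E K L N (f ∘ (false ∷_))
  x≤y : x ≤ y
  x≤y = E-mono P Q N λ W → anti (Subₚ.out⊆ Subₚ.⊆-refl)
  lem : ∀ K L x y D B → (K * x + L * y) * D * B ≡ D * (K * (x * B) + L * (y * B))
  lem = solve-∀
  lem′ : ∀ K L x y D B → D * (K * (B * x) + L * (B * y)) ≡ D * B * (K * x + L * y)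
  lem′ = solve-∀
  -- Writing y = x + t avoids subtraction; only the coefficient of t differs between the two sides.
  mix : (P * x + Q * y) * (K + L) ≤ (K * x + L * y) * (P + Q)
  mix = subst (λ y → (P * x + Q * y) * (K + L) ≤ (K * x + L * y) * (P + Q)) (m+[n∸m]≡n x≤y) (begin
    (P * x + Q * (x + t)) * (K + L)                               ≡⟨ lem₁ P Q K L x t ⟩
    (P + Q) * (K + L) * x + Q * (K + L) * t                       ≤⟨ +-monoʳ-≤ ((P + Q) * (K + L) * x) (*-monoˡ-≤ t h) ⟩
    (P + Q) * (K + L) * x + L * (P + Q) * t                       ≡⟨ lem₂ P Q K L x t ⟩
    (K * x + L * (x + t)) * (P + Q)                               ∎)
    where
    t = y ∸ x
    lem₁ : ∀ P Q K L x t → (P * x + Q * (x + t)) * (K + L) ≡ (P + Q) * (K + L) * x + Q * (K + L) * t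
    lem₁ = solve-∀
    lem₂ : ∀ P Q K L x t → (P + Q) * (K + L) * x + L * (P + Q) * t ≡ (K * x + L * (x + t)) * (P + Q)
    lem₂ = solve-∀

-- (1 - k / b)^j ≥ 1 - j k / b with b = k + l.
bernoulli-complement : ∀ k l j → (k + l) ^ j * (k + l) ≤ l ^ j * (k + l) + j * k * (k + l) ^ j
bernoulli-complement k l zero    = m≤m+n _ 0
bernoulli-complement k l (suc j) = begin
  b * b ^ j * b                                        ≡⟨ *-assoc b (b ^ j) b ⟩
  b * (b ^ j * b)                                      ≤⟨ *-monoʳ-≤ b (bernoulli-complement k l j) ⟩
  b * (l ^ j * b + j * k * b ^ j)                      ≡⟨ lem k l (l ^ j) b (j * k) (b ^ j) ⟩
  k * l ^ j * b + (l * l ^ j * b + j * k * (b * b ^ j))  ≤⟨ +-monoˡ-≤ _ (*-monoˡ-≤ b (*-monoʳ-≤ k (^-monoˡ-≤ j (m≤n+m l k)))) ⟩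
  k * b ^ j * b + (l * l ^ j * b + j * k * (b * b ^ j))  ≡⟨ lem′ k b (b ^ j) (l * l ^ j) j ⟩
  l * l ^ j * b + suc j * k * (b * b ^ j)              ∎
  where
  open ≤-Reasoning
  b = k + l
  lem : ∀ k l q b c d → (k + l) * (q * b + c * d) ≡ k * q * b + (l * q * b + c * ((k + l) * d))
  lem = solve-∀
  lem′ : ∀ k b d q j → k * d * b + (q * b + j * k * (b * d)) ≡ q * b + (1 + j) * k * (b * d)
  lem′ = solve-∀

-- The union of the rounds has density at most j k / (k + l) by Bernoulli, hence at most P / (P +
-- Q), and failure is antitone.
sprinkle : ∀ P Q k l N j (f : Subset N → ℕ) .{{_ : NonZero (k + l)}} → (∀ {S T} → S ⊆ₛ T → f T ≤ f S) → j * k * (P + Q) ≤ (k + l) * P →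
           E P Q N f * ((k + l) ^ N) ^ j ≤ (P + Q) ^ N * rounds k l N j f
sprinkle P Q k l N j f anti h with rounds≡E k l N j
... | K , e , eq = begin
  E P Q N f * ((k + l) ^ N) ^ j                ≡⟨ cong (E P Q N f *_) (trans (^-*-assoc (k + l) N j) (trans (cong ((k + l) ^_) (*-comm N j)) (sym (^-*-assoc (k + l) j N)))) ⟩
  E P Q N f * ((k + l) ^ j) ^ N                ≡⟨ cong (λ z → E P Q N f * z ^ N) e ⟨
  E P Q N f * (K + l ^ j) ^ N                  ≤⟨ E-antitone P Q K (l ^ j) N f anti (subst (λ z → Q * z ≤ l ^ j * (P + Q)) (sym e) dense) ⟩
  (P + Q) ^ N * E K (l ^ j) N f                ≡⟨ cong ((P + Q) ^ N *_) (eq f) ⟨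
  (P + Q) ^ N * rounds k l N j f               ∎
  where
  open ≤-Reasoning
  b = k + l
  lem₁ : ∀ P Q x b → P * x * b + Q * x * b ≡ (P + Q) * (x * b)
  lem₁ = solve-∀
  lem₂ : ∀ D y b z x → D * (y * b + z * x) ≡ y * D * b + z * D * x
  lem₂ = solve-∀
  lem₃ : ∀ y D b P x → y * D * b + b * P * x ≡ P * x * b + y * D * b
  lem₃ = solve-∀
  dense : Q * b ^ j ≤ l ^ j * (P + Q)
  dense = *-cancelʳ-≤ _ _ b (+-cancelˡ-≤ (P * b ^ j * b) _ _ (begin
    P * b ^ j * b + Q * b ^ j * b                          ≡⟨ lem₁ P Q (b ^ j) b ⟩
    (P + Q) * (b ^ j * b)                                  ≤⟨ *-monoʳ-≤ (P + Q) (bernoulli-complement k l j) ⟩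
    (P + Q) * (l ^ j * b + j * k * b ^ j)                  ≡⟨ lem₂ (P + Q) (l ^ j) b (j * k) (b ^ j) ⟩
    l ^ j * (P + Q) * b + j * k * (P + Q) * b ^ j          ≤⟨ +-monoʳ-≤ (l ^ j * (P + Q) * b) (*-monoˡ-≤ (b ^ j) h) ⟩
    l ^ j * (P + Q) * b + b * P * b ^ j                    ≡⟨ lem₃ (l ^ j) (P + Q) b P (b ^ j) ⟩
    P * b ^ j * b + l ^ j * (P + Q) * b                    ∎))

-- Choice of the parameters

-- Integer roots by search; as f dominates the identity, t steps suffice. It produces both b and
-- `ρ`.
largest : (f : ℕ → ℕ) → (∀ x → x ≤ f x) → ∀ t → f 0 ≤ t → ∃[ m ] f m ≤ t × t < f (suc m)
largest f grows t f0≤ = climb t 0 f0≤ (≤-reflexive (sym (+-identityʳ t)))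
  where
  climb : ∀ fuel m → f m ≤ t → t ≤ fuel + m → ∃[ m ] f m ≤ t × t < f (suc m)
  climb fuel m fm≤ t≤ with f (suc m) ≤? t
  ... | no f≰ = m , fm≤ , ≰⇒> f≰
  climb zero       m fm≤ t≤ | yes f≤ = contradiction (≤-trans (grows (suc m)) f≤) (<⇒≱ (s≤s t≤))
  climb (suc fuel) m fm≤ t≤ | yes f≤ = climb fuel (suc m) f≤ (subst (t ≤_) (sym (+-suc fuel m)) t≤)

below-largest : (f : ℕ → ℕ) → (∀ {x y} → x ≤ y → f x ≤ f y) → ∀ {t m x} → t < f (suc m) → f x ≤ t → x ≤ m
below-largest f mono {m = m} {x} t< fx≤ with x ≤? m
... | yes x≤m = x≤m
... | no x≰m  = contradiction (≤-trans (mono (≰⇒> x≰m)) fx≤) (<⇒≱ t<)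

m≤2^m : ∀ m → m ≤ 2 ^ m
m≤2^m zero    = z≤n
m≤2^m (suc m) = ≤-trans (+-mono-≤ (m^n>0 2 m) (m≤2^m m)) (≤-reflexive (cong (2 ^ m +_) (sym (+-identityʳ (2 ^ m)))))

m≤m^1+n : ∀ m n → m ≤ m ^ suc n
m≤m^1+n zero      n = z≤n
m≤m^1+n m@(suc _) n = ≤-trans (≤-reflexive (sym (*-identityʳ m))) (*-monoʳ-≤ m (m^n>0 m n))

-- Here b is ⌊n^(2/(Δ+1))⌋. Only the upper bound on n * n is exported: it turns the hypothesis on p
-- into p ≥ c / (b + 1).
PerturbedEmbedding : (K D Δ k R δ₀ n : ℕ) → Set
PerturbedEmbedding K D Δ k R δ₀ n = ∀ (F G : Adj n) →
  (∀ u v → F u v ≡ F v u) → (∀ u → F u u ≡ false) → (∀ u v → G u v ≡ G v u) → (∀ u → G u u ≡ false) →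
  MaxDegreeAtMost F Δ → DensePair G K D →
  ∃[ b ] 0 < b × k ≤ b × n * n < suc b ^ suc Δ ×
    δ₀ * rounds k (b ∸ k) (length (pairs n)) (suc R) (noCopy F G) ≤ ((k + (b ∸ k)) ^ length (pairs n)) ^ suc R

-- `k` and `R` precede δ₀ because they determine the constant of the theorem; δ₀ affects only the
-- threshold n₀.
perturbed-embedding : ∀ K D Δ → .{{_ : NonZero K}} → .{{_ : NonZero D}} → 2 ≤ Δ →
  ∃[ k ] ∃[ R ] 0 < k × (∀ δ₀ → ∃[ n₀ ] (∀ n → n₀ ≤ n → PerturbedEmbedding K D Δ k R δ₀ n))
perturbed-embedding K D Δ 2≤Δ = k , R , >-nonZero⁻¹ k , λ δ₀ → n₀ δ₀ , embedding δ₀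
  where
  instance
    Δ≢0 : NonZero Δ
    Δ≢0 = >-nonZero (<⇒≤ 2≤Δ)
  -- With s = C Δ s′ and s′ = h / q, the choice of `q` gives 2 D s ≤ h. Rounding costs a factor 2,
  -- so n ≤ K h ≤ 2 K q s′ = C s, which fixes `C`, and n ≤ A s′. `r₁` brings the first fragment down
  -- to h / (2 (Δ + 1)), and `k` pays for 6 r₁, for A in d₁ = b / A and for its rounding.
  C A β A′ R r₁ k q : ℕ
  C  = 4 * K * D
  A  = C * C * Δ
  β  = Δ * suc (suc Δ)
  A′ = A ^ (2 * suc Δ)
  R  = suc ((4 * β + 1) * suc Δ)
  r₁ = Δ * K * (2 * suc Δ)
  k  = 12 * A * r₁
  q  = 2 * D * C * Δ
  instance
    C≢0 : NonZero C
    C≢0 = m*n≢0 (4 * K) D {{m*n≢0 4 K}}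
    A≢0 : NonZero A
    A≢0 = m*n≢0 (C * C) Δ {{m*n≢0 C C}}
    A′≢0 : NonZero A′
    A′≢0 = m^n≢0 A (2 * suc Δ)
    r₁≢0 : NonZero r₁
    r₁≢0 = m*n≢0 (Δ * K) (2 * suc Δ) {{m*n≢0 Δ K}}
    k≢0 : NonZero k
    k≢0 = m*n≢0 (12 * A) r₁ {{m*n≢0 12 A}}
    q≢0 : NonZero q
    q≢0 = m*n≢0 (2 * D * C) Δ {{m*n≢0 (2 * D) C {{m*n≢0 2 D}}}}
    β≢0 : NonZero β
    β≢0 = m*n≢0 Δ (suc (suc Δ))
    2β≢0 : NonZero (2 * β)
    2β≢0 = m*n≢0 2 β
  ρ₀ b₀ n₀ : ℕ → ℕ
  -- Sums in place of maxima: each summand here and in the next two lines is a lower bound used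
  -- below.
  ρ₀ δ₀ = A′ * Δ + 6 * R * δ₀ + 3
  b₀ δ₀ = ρ₀ δ₀ ^ (2 * β) * A′ + A + k
  n₀ δ₀ = b₀ δ₀ ^ suc Δ + K * q + K * (2 * suc Δ) + 2 * δ₀ * r₁ + 1
  embedding : ∀ δ₀ n → n₀ δ₀ ≤ n → PerturbedEmbedding K D Δ k R δ₀ n
  embedding δ₀ n n₀≤n F G symF irrF symG irrG maxdeg DP = b , b>0 , k≤b , b-max ,
    two-phase F G symF irrF symG irrG Δ maxdeg DP k (b ∸ k) d₁ r₁ d₂ ρ ρ R C s′ δ₀ 2≤Δ n≤Cs 2Ds≤h
      d₁>0 d₁≤ (subst (λ z → 6 * r₁ * z ≤ k * d₁) (sym b≡) q₁) slack δ₁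
      d₂>0 d₂≤ (subst (λ z → ρ * ρ * z ≤ k * d₂) (sym b≡) (m≤n*m d₂ k)) nΔ< 3≤ρ 6Rδ≤ρ
    where
    open DensePair DP using (h; n≤Kh)
    open ≤-Reasoning
    p₁ : b₀ δ₀ ^ suc Δ ≤ n
    p₁ = ≤-trans (≤-trans (≤-trans (≤-trans (m≤m+n _ (K * q)) (m≤m+n _ (K * (2 * suc Δ)))) (m≤m+n _ (2 * δ₀ * r₁))) (m≤m+n _ 1)) n₀≤n
    p₂ : K * q ≤ n
    p₂ = ≤-trans (≤-trans (≤-trans (≤-trans (m≤n+m _ (b₀ δ₀ ^ suc Δ)) (m≤m+n _ (K * (2 * suc Δ)))) (m≤m+n _ (2 * δ₀ * r₁))) (m≤m+n _ 1)) n₀≤n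
    p₃ : K * (2 * suc Δ) ≤ n
    p₃ = ≤-trans (≤-trans (≤-trans (m≤n+m _ (b₀ δ₀ ^ suc Δ + K * q)) (m≤m+n _ (2 * δ₀ * r₁))) (m≤m+n _ 1)) n₀≤n
    p₄ : 2 * δ₀ * r₁ ≤ n
    p₄ = ≤-trans (≤-trans (m≤n+m _ (b₀ δ₀ ^ suc Δ + K * q + K * (2 * suc Δ))) (m≤m+n _ 1)) n₀≤n
    n>0 : 0 < n
    n>0 = ≤-trans (m≤n+m 1 (b₀ δ₀ ^ suc Δ + K * q + K * (2 * suc Δ) + 2 * δ₀ * r₁)) n₀≤n
    n≤n² : n ≤ n * n
    n≤n² = ≤-trans (≤-reflexive (sym (*-identityʳ n))) (*-monoʳ-≤ n n>0)
    q≤h : q ≤ h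
    q≤h = *-cancelˡ-≤ K (≤-trans p₂ n≤Kh)
    s′ : ℕ
    s′ = h / q
    s′>0 : 0 < s′
    s′>0 = m≥n⇒m/n>0 q≤h
    instance
      s′≢0 : NonZero s′
      s′≢0 = >-nonZero s′>0
    2Ds≤h : 2 * D * (C * Δ * s′) ≤ h
    2Ds≤h = ≤-trans (≤-reflexive (lem D C Δ s′)) (m/n*n≤m h q)
      where
      lem : ∀ D C Δ s → 2 * D * (C * Δ * s) ≡ s * (2 * D * C * Δ)
      lem = solve-∀
    n≤Cs : n ≤ C * (C * Δ * s′)
    n≤Cs = begin
      n                               ≤⟨ n≤Kh ⟩
      K * h                           ≤⟨ *-monoʳ-≤ K (m≤n*[1+m/n] h q) ⟩
      K * (q * suc s′)                ≤⟨ *-monoʳ-≤ K (*-monoʳ-≤ q (+-monoˡ-≤ s′ s′>0)) ⟩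
      K * (q * (s′ + s′))             ≡⟨ lem K D C Δ s′ ⟩
      4 * K * D * (C * Δ * s′)        ∎
      where
      lem : ∀ K D C Δ s → K * (2 * D * C * Δ * (s + s)) ≡ 4 * K * D * (C * Δ * s)
      lem = solve-∀
    n≤As : n ≤ A * s′
    n≤As = ≤-trans n≤Cs (≤-reflexive (lem C Δ s′))
      where
      lem : ∀ C Δ s → C * (C * Δ * s) ≡ C * C * Δ * s
      lem = solve-∀
    broot : ∃[ b ] b ^ suc Δ ≤ n * n × n * n < suc b ^ suc Δ
    broot = largest (_^ suc Δ) (λ x → m≤m^1+n x Δ) (n * n) z≤n
    b : ℕ
    b = proj₁ broot
    b^≤ : b ^ suc Δ ≤ n * n
    b^≤ = proj₁ (proj₂ broot)
    b-max : n * n < suc b ^ suc Δ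
    b-max = proj₂ (proj₂ broot)
    b₀≤b : b₀ δ₀ ≤ b
    b₀≤b = below-largest (_^ suc Δ) (^-monoˡ-≤ (suc Δ)) b-max (≤-trans p₁ n≤n²)
    k≤b : k ≤ b
    k≤b = ≤-trans (m≤n+m k _) b₀≤b
    A≤b : A ≤ b
    A≤b = ≤-trans (≤-trans (m≤n+m A (ρ₀ δ₀ ^ (2 * β) * A′)) (m≤m+n _ k)) b₀≤b
    b>0 : 0 < b
    b>0 = ≤-trans (>-nonZero⁻¹ k) k≤b
    instance
      b≢0 : NonZero b
      b≢0 = >-nonZero b>0
    b≡ : k + (b ∸ k) ≡ b
    b≡ = m+[n∸m]≡n k≤b
    d₁ : ℕ
    d₁ = b / A
    d₁>0 : 0 < d₁
    d₁>0 = m≥n⇒m/n>0 A≤b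
    d₁≤ : d₁ ^ suc Δ ≤ s′ ^ 2
    d₁≤ = *-cancelʳ-≤ _ _ (A ^ 2) {{m^n≢0 A 2}} (begin
      d₁ ^ suc Δ * A ^ 2              ≤⟨ *-monoʳ-≤ (d₁ ^ suc Δ) (^-monoʳ-≤ A (s≤s (<⇒≤ 2≤Δ))) ⟩
      d₁ ^ suc Δ * A ^ suc Δ          ≡⟨ ^-distribʳ-* d₁ A (suc Δ) ⟨
      (d₁ * A) ^ suc Δ                ≤⟨ ^-monoˡ-≤ (suc Δ) (m/n*n≤m b A) ⟩
      b ^ suc Δ                       ≤⟨ b^≤ ⟩
      n * n                           ≤⟨ *-mono-≤ n≤As n≤As ⟩
      A * s′ * (A * s′)               ≡⟨ lem A s′ ⟩
      s′ ^ 2 * A ^ 2                  ∎)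
      where
      lem : ∀ A s → A * s * (A * s) ≡ s * (s * 1) * (A * (A * 1))
      lem = solve-∀
    q₁ : 6 * r₁ * b ≤ k * d₁
    q₁ = begin
      6 * r₁ * b                      ≤⟨ *-monoʳ-≤ (6 * r₁) (m≤n*[1+m/n] b A) ⟩
      6 * r₁ * (A * suc d₁)           ≤⟨ *-monoʳ-≤ (6 * r₁) (*-monoʳ-≤ A (+-monoˡ-≤ d₁ d₁>0)) ⟩
      6 * r₁ * (A * (d₁ + d₁))        ≡⟨ lem r₁ A d₁ ⟩
      12 * A * r₁ * d₁                ∎
      where
      lem : ∀ r A d → 6 * r * (A * (d + d)) ≡ 12 * A * r * d
      lem = solve-∀
    ℓ′ : ℕ
    ℓ′ = n * Δ / r₁
    slack : suc Δ * suc ℓ′ ≤ h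
    slack = *-cancelˡ-≤ 2 (begin
      2 * (suc Δ * suc ℓ′)            ≡⟨ lem₁ (suc Δ) ℓ′ ⟩
      2 * suc Δ * ℓ′ + 2 * suc Δ      ≤⟨ +-mono-≤ (*-cancelˡ-≤ (Δ * K) {{m*n≢0 Δ K}} small) (*-cancelˡ-≤ K (≤-trans p₃ n≤Kh)) ⟩
      h + h                           ≡⟨ cong (h +_) (sym (+-identityʳ h)) ⟩
      2 * h                           ∎)
      where
      lem₁ : ∀ d l → 2 * (d * (1 + l)) ≡ 2 * d * l + 2 * d
      lem₁ = solve-∀
      lem₂ : ∀ x y l → x * (y * l) ≡ l * (x * y)
      lem₂ = solve-∀
      lem₃ : ∀ K h Δ → K * h * Δ ≡ Δ * K * h
      lem₃ = solve-∀
      small : Δ * K * (2 * suc Δ * ℓ′) ≤ Δ * K * h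
      small = begin
        Δ * K * (2 * suc Δ * ℓ′)      ≡⟨ lem₂ (Δ * K) (2 * suc Δ) ℓ′ ⟩
        ℓ′ * r₁                       ≤⟨ m/n*n≤m (n * Δ) r₁ ⟩
        n * Δ                         ≤⟨ *-monoˡ-≤ Δ n≤Kh ⟩
        K * h * Δ                     ≡⟨ lem₃ K h Δ ⟩
        Δ * K * h                     ∎
    δ₁ : 2 * δ₀ ≤ 2 ^ suc ℓ′
    δ₁ = ≤-trans (*-cancelʳ-≤ _ _ r₁ (begin
      2 * δ₀ * r₁                     ≤⟨ p₄ ⟩
      n                               ≤⟨ m≤m*n n Δ ⟩
      n * Δ                           ≤⟨ m≤n*[1+m/n] (n * Δ) r₁ ⟩
      r₁ * suc ℓ′                     ≡⟨ *-comm r₁ (suc ℓ′) ⟩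
      suc ℓ′ * r₁                     ∎)) (m≤2^m (suc ℓ′))
    -- Both λ′ and r will be ρ, the largest integer with ρ^(2β) A′ ≤ b; this is the room available
    -- to d₂.
    power : ℕ → ℕ
    power x = x ^ (2 * β) * A′
    power-mono : ∀ {x y} → x ≤ y → power x ≤ power y
    power-mono x≤y = *-monoˡ-≤ A′ (^-monoˡ-≤ (2 * β) x≤y)
    power-grows : ∀ x → x ≤ power x
    power-grows x = ≤-trans (subst (λ z → x ≤ x ^ z) (suc-pred (2 * β)) (m≤m^1+n x (pred (2 * β)))) (m≤m*n _ A′)
    ρroot : ∃[ ρ ] power ρ ≤ b × b < power (suc ρ)
    ρroot = largest power power-grows b (≤-trans (≤-reflexive (cong (_* A′) (zero^ (2 * β)))) z≤n)
      where
      zero^ : ∀ e .{{_ : NonZero e}} → 0 ^ e ≡ 0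
      zero^ (suc e) = refl
    ρ : ℕ
    ρ = proj₁ ρroot
    ρ≤ : power ρ ≤ b
    ρ≤ = proj₁ (proj₂ ρroot)
    ρ-max : b < power (suc ρ)
    ρ-max = proj₂ (proj₂ ρroot)
    ρ₀≤ρ : ρ₀ δ₀ ≤ ρ
    ρ₀≤ρ = below-largest power power-mono ρ-max (≤-trans (≤-trans (m≤m+n _ A) (m≤m+n _ k)) b₀≤b)
    3≤ρ : 3 ≤ ρ
    3≤ρ = ≤-trans (m≤n+m 3 _) ρ₀≤ρ
    6Rδ≤ρ : 6 * R * δ₀ ≤ ρ
    6Rδ≤ρ = ≤-trans (≤-trans (m≤n+m _ (A′ * Δ)) (m≤m+n _ 3)) ρ₀≤ρ
    A′Δ≤ρ : A′ * Δ ≤ ρ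
    A′Δ≤ρ = ≤-trans (≤-trans (m≤m+n _ (6 * R * δ₀)) (m≤m+n _ 3)) ρ₀≤ρ
    A′≤ρ : A′ ≤ ρ
    A′≤ρ = ≤-trans (m≤m*n A′ Δ) A′Δ≤ρ
    Δ≤ρ : Δ ≤ ρ
    Δ≤ρ = ≤-trans (m≤n*m Δ A′) A′Δ≤ρ
    instance
      ρ≢0 : NonZero ρ
      ρ≢0 = >-nonZero (≤-trans (s≤s z≤n) 3≤ρ)
    d₂ : ℕ
    d₂ = ρ * ρ * b
    d₂>0 : 0 < d₂
    d₂>0 = >-nonZero⁻¹ d₂ {{m*n≢0 (ρ * ρ) b {{m*n≢0 ρ ρ}}}}
    -- Multiplying by b raises the exponent β of b to β + 1 = (Δ + 1)², so that b^(Δ+1) ≤ n²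
    -- applies. The one extra factor b is the polynomial room, and it pays for ρ^(2β) A′.
    d₂≤ : d₂ ^ β ≤ s′ ^ (2 * suc Δ)
    d₂≤ = *-cancelʳ-≤ _ _ b (begin
      (ρ * ρ * b) ^ β * b                              ≡⟨ cong (_* b) (^-distribʳ-* (ρ * ρ) b β) ⟩
      (ρ * ρ) ^ β * b ^ β * b                          ≡⟨ trans (*-assoc ((ρ * ρ) ^ β) (b ^ β) b) (cong₂ _*_ squared shifted) ⟩
      ρ ^ (2 * β) * (b ^ suc Δ) ^ suc Δ                ≤⟨ *-monoʳ-≤ (ρ ^ (2 * β)) (^-monoˡ-≤ (suc Δ) (≤-trans b^≤ (*-mono-≤ n≤As n≤As))) ⟩
      ρ ^ (2 * β) * (A * s′ * (A * s′)) ^ suc Δ        ≡⟨ cong (ρ ^ (2 * β) *_) (trans (sq (A * s′) (suc Δ)) (^-distribʳ-* A s′ (2 * suc Δ))) ⟩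
      ρ ^ (2 * β) * (A′ * s′ ^ (2 * suc Δ))            ≡⟨ *-assoc (ρ ^ (2 * β)) A′ _ ⟨
      power ρ * s′ ^ (2 * suc Δ)                       ≤⟨ *-monoˡ-≤ _ ρ≤ ⟩
      b * s′ ^ (2 * suc Δ)                             ≡⟨ *-comm b _ ⟩
      s′ ^ (2 * suc Δ) * b                             ∎)
      where
      sq : ∀ x e → (x * x) ^ e ≡ x ^ (2 * e)
      sq x e = trans (cong (λ z → (x * z) ^ e) (sym (*-identityʳ x))) (^-*-assoc x 2 e)
      squared : (ρ * ρ) ^ β ≡ ρ ^ (2 * β)
      squared = sq ρ β
      exponent : ∀ Δ → Δ * (2 + Δ) + 1 ≡ (1 + Δ) * (1 + Δ)
      exponent = solve-∀
      shifted : b ^ β * b ≡ (b ^ suc Δ) ^ suc Δ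
      shifted = trans (cong (b ^ β *_) (sym (*-identityʳ b))) (trans (sym (^-distribˡ-+-* b β 1))
        (trans (cong (b ^_) (exponent Δ)) (sym (^-*-assoc b (suc Δ) (suc Δ)))))
    -- Maximality of ρ bounds b + 1 by (ρ + 1)^(2β) A′ ≤ ρ^(4β+1), and n ≤ n² < (b + 1)^(Δ+1). The
    -- last factor ρ of ρ ^ R covers Δ.
    nΔ< : n * Δ < ρ ^ R
    nΔ< = begin-strict
      n * Δ                                            ≤⟨ *-monoʳ-≤ n Δ≤ρ ⟩
      n * ρ                                            <⟨ *-monoˡ-< ρ (≤-<-trans n≤n² b-max) ⟩
      suc b ^ suc Δ * ρ                                ≤⟨ *-monoˡ-≤ ρ (^-monoˡ-≤ (suc Δ) ρ-max) ⟩
      power (suc ρ) ^ suc Δ * ρ                        ≤⟨ *-monoˡ-≤ ρ (^-monoˡ-≤ (suc Δ) (*-mono-≤ (^-monoˡ-≤ (2 * β) suc≤sq) A′≤ρ)) ⟩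
      ((ρ ^ 2) ^ (2 * β) * ρ) ^ suc Δ * ρ              ≡⟨ cong (λ z → z ^ suc Δ * ρ) (trans (cong₂ _*_ (^-*-assoc ρ 2 (2 * β)) (sym (*-identityʳ ρ))) (sym (^-distribˡ-+-* ρ (2 * (2 * β)) 1))) ⟩
      (ρ ^ (2 * (2 * β) + 1)) ^ suc Δ * ρ              ≡⟨ cong (_* ρ) (trans (^-*-assoc ρ (2 * (2 * β) + 1) (suc Δ)) (cong (λ z → ρ ^ ((z + 1) * suc Δ)) (four β))) ⟩
      ρ ^ ((4 * β + 1) * suc Δ) * ρ                    ≡⟨ *-comm _ ρ ⟩
      ρ ^ R                                            ∎
      where
      four : ∀ β → 2 * (2 * β) ≡ 4 * β
      four = solve-∀
      suc≤sq : suc ρ ≤ ρ ^ 2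
      suc≤sq = begin
        1 + ρ              ≤⟨ +-monoˡ-≤ ρ (≤-trans (s≤s z≤n) 3≤ρ) ⟩
        ρ + ρ              ≡⟨ cong (ρ +_) (sym (+-identityʳ ρ)) ⟩
        2 * ρ              ≤⟨ *-monoˡ-≤ ρ (<⇒≤ 3≤ρ) ⟩
        ρ * ρ              ≡⟨ cong (ρ *_) (sym (*-identityʳ ρ)) ⟩
        ρ ^ 2              ∎

-- From counting to rational probabilities

ℕ→ℚ≡ : ∀ k → ℕ→ℚ k ≡ mkℚ (posℤ k) 0 (Coprimality.sym (Coprimality.1-coprimeTo k))
ℕ→ℚ≡ k = ℚₚ.normalize-coprime (Coprimality.sym (Coprimality.1-coprimeTo k))

ℕ→ℚ-mono : ∀ {a b} → a ≤ b → ℕ→ℚ a ℚ.≤ ℕ→ℚ b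
ℕ→ℚ-mono {a} {b} a≤b = subst₂ ℚ._≤_ (sym (ℕ→ℚ≡ a)) (sym (ℕ→ℚ≡ b)) (ℚ.*≤* (subst₂ ℤ._≤_ (sym (ℤₚ.*-identityʳ (posℤ a))) (sym (ℤₚ.*-identityʳ (posℤ b))) (ℤ.+≤+ a≤b)))

ℕ→ℚ-reflect : ∀ {a b} → ℕ→ℚ a ℚ.≤ ℕ→ℚ b → a ≤ b
ℕ→ℚ-reflect {a} {b} h = ℤₚ.drop‿+≤+ (subst₂ ℤ._≤_ (ℤₚ.*-identityʳ (posℤ a)) (ℤₚ.*-identityʳ (posℤ b)) (ℚₚ.drop-*≤* (subst₂ ℚ._≤_ (ℕ→ℚ≡ a) (ℕ→ℚ≡ b) h)))

toℚᵘ-ℕ→ℚ : ∀ k → toℚᵘ (ℕ→ℚ k) ℚᵘ.≃ ℚᵘ.mkℚᵘ (posℤ k) 0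
toℚᵘ-ℕ→ℚ k = ℚₚ.toℚᵘ-fromℚᵘ (ℚᵘ.mkℚᵘ (posℤ k) 0)

ℕ→ℚ-+ : ∀ a b → ℕ→ℚ (a + b) ≡ ℕ→ℚ a ℚ.+ ℕ→ℚ b
ℕ→ℚ-+ a b = ℚₚ.toℚᵘ-injective (ℚᵘₚ.≃-trans (toℚᵘ-ℕ→ℚ (a + b)) (ℚᵘₚ.≃-sym (ℚᵘₚ.≃-trans (ℚₚ.toℚᵘ-homo-+ (ℕ→ℚ a) (ℕ→ℚ b))
  (ℚᵘₚ.≃-trans (ℚᵘₚ.+-cong (toℚᵘ-ℕ→ℚ a) (toℚᵘ-ℕ→ℚ b)) (ℚᵘ.*≡* (cong (ℤ._* (posℤ 1)) (cong₂ ℤ._+_ (ℤₚ.*-identityʳ (posℤ a)) (ℤₚ.*-identityʳ (posℤ b)))))))))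

ℕ→ℚ-* : ∀ a b → ℕ→ℚ (a * b) ≡ ℕ→ℚ a ℚ.* ℕ→ℚ b
ℕ→ℚ-* a b = ℚₚ.toℚᵘ-injective (ℚᵘₚ.≃-trans (toℚᵘ-ℕ→ℚ (a * b)) (ℚᵘₚ.≃-sym (ℚᵘₚ.≃-trans (ℚₚ.toℚᵘ-homo-* (ℕ→ℚ a) (ℕ→ℚ b))
  (ℚᵘₚ.≃-trans (ℚᵘₚ.*-cong (toℚᵘ-ℕ→ℚ a) (toℚᵘ-ℕ→ℚ b)) (ℚᵘ.*≡* (cong (ℤ._* (posℤ 1)) (sym (ℤₚ.pos-* a b))))))))

ℕ→ℚ-^ : ∀ a k → ℕ→ℚ (a ^ k) ≡ ℕ→ℚ a ^ℚ k
ℕ→ℚ-^ a zero    = refl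
ℕ→ℚ-^ a (suc k) = trans (ℕ→ℚ-* a (a ^ k)) (cong (ℕ→ℚ a ℚ.*_) (ℕ→ℚ-^ a k))

^ℚ-distrib-* : ∀ x y k → (x ℚ.* y) ^ℚ k ≡ (x ^ℚ k) ℚ.* (y ^ℚ k)
^ℚ-distrib-* x y zero    = refl
^ℚ-distrib-* x y (suc k) = trans (cong ((x ℚ.* y) ℚ.*_) (^ℚ-distrib-* x y k))
  (solveℚ 4 (λ a b c d → (a :* b) :* (c :* d) := (a :* c) :* (b :* d)) refl x y (x ^ℚ k) (y ^ℚ k))
  where open ℚSolver.+-*-Solver using (_:*_; _:=_) renaming (solve to solveℚ)

ℕ→ℚ-nonNeg : ∀ {k} → ℚ.NonNegative (ℕ→ℚ k)
ℕ→ℚ-nonNeg {k} = ℚₚ.normalize-nonNeg k 1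

ℕ→ℚ-pos : ∀ k → 0 < k → ℚ.Positive (ℕ→ℚ k)
ℕ→ℚ-pos (suc k) _ = subst ℚ.Positive (sym (ℕ→ℚ≡ (suc k))) _

record Fraction (p : ℚ) : Set where
  field
    num den : ℕ
    den>0   : 0 < den
    p*den   : p ℚ.* ℕ→ℚ den ≡ ℕ→ℚ num

fraction : ∀ p → 0ℚ ℚ.≤ p → Fraction p
fraction p@(mkℚ (posℤ a) d c) _ = record
  { num = a ; den = suc d ; den>0 = s≤s z≤n
  ; p*den = ℚₚ.toℚᵘ-injective (ℚᵘₚ.≃-trans (ℚₚ.toℚᵘ-homo-* p (ℕ→ℚ (suc d))) (ℚᵘₚ.≃-trans (ℚᵘₚ.*-congˡ {toℚᵘ p} (toℚᵘ-ℕ→ℚ (suc d)))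
      (ℚᵘₚ.≃-trans (ℚᵘ.*≡* (trans (ℤₚ.*-identityʳ _) (cong (λ z → posℤ a ℤ.* posℤ z) (sym (*-identityʳ (suc d)))))) (ℚᵘₚ.≃-sym (toℚᵘ-ℕ→ℚ a))))) }
fraction (mkℚ -[1+ a ] d c) (ℚ.*≤* ())

-- The denominator is the witness, as a positive numerator is at least 1. This replaces ε and δ by
-- unit fractions 1 / c₀ and 1 / δ₀.
fraction-pos : ∀ p → 0ℚ ℚ.< p → ∃[ d ] 0 < d × 1ℚ ℚ.≤ p ℚ.* ℕ→ℚ d
fraction-pos p 0<p = den , den>0 , subst (1ℚ ℚ.≤_) (sym p*den) (ℕ→ℚ-mono num>0)
  where
  open Fraction (fraction p (ℚₚ.<⇒≤ 0<p))
  go : ∀ m → p ℚ.* ℕ→ℚ den ≡ ℕ→ℚ m → 1 ≤ m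
  go (suc _) _ = s≤s z≤n
  go zero    e = contradiction (subst₂ ℚ._<_ (ℚₚ.*-zeroˡ (ℕ→ℚ den)) e (ℚₚ.*-monoˡ-<-pos (ℕ→ℚ den) {{ℕ→ℚ-pos den den>0}} 0<p)) (ℚₚ.<-irrefl refl)
  num>0 : 1 ≤ num
  num>0 = go num p*den

-- The probability mass as a weighted count

weightℚ : ∀ {k} → ℚ → Vec Bool k → ℚ
weightℚ p ω = List.foldr (λ b acc → (if b then p else (1ℚ ℚ.- p)) ℚ.* acc) 1ℚ (Vec.toList ω)

sumℚ : List ℚ → ℚ
sumℚ = List.foldr ℚ._+_ 0ℚ

mass : ∀ k → ℚ → (Vec Bool k → Bool) → ℚ
mass k p keep = sumℚ (map (λ ω → if keep ω then weightℚ p ω else 0ℚ) (allBoolVecs k))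

mass-suc : ∀ k p keep → mass (suc k) p keep ≡ (1ℚ ℚ.- p) ℚ.* mass k p (keep ∘ (false ∷_)) ℚ.+ p ℚ.* mass k p (keep ∘ (true ∷_))
mass-suc k p keep = go (allBoolVecs k)
  where
  open ℚSolver.+-*-Solver using (_:*_; _:+_; _:=_) renaming (solve to solveℚ)
  term : ∀ {j} → (Vec Bool j → Bool) → Vec Bool j → ℚ
  term keep ω = if keep ω then weightℚ p ω else 0ℚ
  pull : ∀ (b : Bool) q w → (if b then q ℚ.* w else 0ℚ) ≡ q ℚ.* (if b then w else 0ℚ)
  pull true  q w = refl
  pull false q w = sym (ℚₚ.*-zeroʳ q)
  go : ∀ vs → sumℚ (map (term keep) (concatMap (λ v → (false ∷ v) ∷ (true ∷ v) ∷ []) vs)) ≡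
       (1ℚ ℚ.- p) ℚ.* sumℚ (map (term (keep ∘ (false ∷_))) vs) ℚ.+ p ℚ.* sumℚ (map (term (keep ∘ (true ∷_))) vs)
  go []       = sym (trans (cong₂ ℚ._+_ (ℚₚ.*-zeroʳ (1ℚ ℚ.- p)) (ℚₚ.*-zeroʳ p)) refl)
  go (v ∷ vs) rewrite go vs | pull (keep (false ∷ v)) (1ℚ ℚ.- p) (weightℚ p v) | pull (keep (true ∷ v)) p (weightℚ p v) =
    solveℚ 6 (λ q p a b c d → (q :* a) :+ ((p :* b) :+ ((q :* c) :+ (p :* d))) := (q :* (a :+ c)) :+ (p :* (b :+ d))) refl
      (1ℚ ℚ.- p) p (term (keep ∘ (false ∷_)) v) (term (keep ∘ (true ∷_)) v)
      (sumℚ (map (term (keep ∘ (false ∷_))) vs)) (sumℚ (map (term (keep ∘ (true ∷_))) vs))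

-- With p = P / (P + Q), clearing the denominator of every coordinate turns the rational mass into
-- the integer expectation `E`.
mass≡E : ∀ k p P Q → p ℚ.* ℕ→ℚ (P + Q) ≡ ℕ→ℚ P → ∀ keep → mass k p keep ℚ.* ℕ→ℚ ((P + Q) ^ k) ≡ ℕ→ℚ (E P Q k (λ ω → if keep ω then 1 else 0))
mass≡E zero    p P Q e keep with keep []
... | true  = refl
... | false = refl
mass≡E (suc k) p P Q e keep = begin
  mass (suc k) p keep ℚ.* ℕ→ℚ ((P + Q) * (P + Q) ^ k)          ≡⟨ cong₂ ℚ._*_ (mass-suc k p keep) (ℕ→ℚ-* (P + Q) ((P + Q) ^ k)) ⟩
  ((1ℚ ℚ.- p) ℚ.* m₀ ℚ.+ p ℚ.* m₁) ℚ.* (D ℚ.* Dᵏ)                ≡⟨ solveℚ 6 (λ q p a b d e → ((q :* a) :+ (p :* b)) :* (d :* e) := ((p :* d) :* (b :* e)) :+ ((q :* d) :* (a :* e))) refl (1ℚ ℚ.- p) p m₀ m₁ D Dᵏ ⟩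
  (p ℚ.* D) ℚ.* (m₁ ℚ.* Dᵏ) ℚ.+ ((1ℚ ℚ.- p) ℚ.* D) ℚ.* (m₀ ℚ.* Dᵏ)  ≡⟨ cong₂ ℚ._+_ (cong₂ ℚ._*_ e (mass≡E k p P Q e (keep ∘ (true ∷_)))) (cong₂ ℚ._*_ e′ (mass≡E k p P Q e (keep ∘ (false ∷_)))) ⟩
  ℕ→ℚ P ℚ.* ℕ→ℚ x₁ ℚ.+ ℕ→ℚ Q ℚ.* ℕ→ℚ x₀                          ≡⟨ cong₂ ℚ._+_ (ℕ→ℚ-* P x₁) (ℕ→ℚ-* Q x₀) ⟨
  ℕ→ℚ (P * x₁) ℚ.+ ℕ→ℚ (Q * x₀)                                 ≡⟨ ℕ→ℚ-+ (P * x₁) (Q * x₀) ⟨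
  ℕ→ℚ (P * x₁ + Q * x₀)                                         ∎
  where
  open ≡-Reasoning
  open ℚSolver.+-*-Solver using (_:*_; _:+_; _:-_; :-_; con; _:=_) renaming (solve to solveℚ)
  m₀ m₁ D Dᵏ : ℚ
  m₀ = mass k p (keep ∘ (false ∷_))
  m₁ = mass k p (keep ∘ (true ∷_))
  D  = ℕ→ℚ (P + Q)
  Dᵏ = ℕ→ℚ ((P + Q) ^ k)
  x₀ x₁ : ℕ
  x₀ = E P Q k (λ ω → if keep (false ∷ ω) then 1 else 0)
  x₁ = E P Q k (λ ω → if keep (true ∷ ω) then 1 else 0)
  e′ : (1ℚ ℚ.- p) ℚ.* D ≡ ℕ→ℚ Q
  e′ = trans (solveℚ 2 (λ p d → (con 1ℚ :- p) :* d := d :- (p :* d)) refl p D) (trans (cong₂ (λ a b → a ℚ.- b) (ℕ→ℚ-+ P Q) e)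
    (solveℚ 2 (λ a b → (a :+ b) :- a := b) refl (ℕ→ℚ P) (ℕ→ℚ Q)))

abstract
  dense-pair : ∀ c₀ → 0 < c₀ → ∃[ K ] ∃[ D ] ∃[ n₁ ] 0 < K × 0 < D × (∀ {n} (G : Adj n) → (∀ u v → G u v ≡ G v u) → (∀ u → G u u ≡ false) →
    n₁ ≤ n → n * n ≤ c₀ * e G (allFin n) (allFin n) → DensePair G K D)
  dense-pair c₀ c₀>0 = 2 * n₁ , suc p ^ (p * c) * suc (suc p) , n₁ , *-mono-≤ {1} {2} (s≤s z≤n) n₁>0 , *-mono-≤ {1} (m^n>0 (suc p) (p * c)) (s≤s z≤n) ,
    λ G symG irrG n₁≤n dense → dense-pair′ G symG irrG p refl c₀ {{>-nonZero n₁>0}} n₁≤n dense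
    where
    p c n₁ : ℕ
    -- the solution of 15 (p + 2) = 16 p: each densification step multiplies the density by (p + 1) / p
    p  = 30
    c  = 128 * c₀
    n₁ = c * 4 ^ (p * c)
    n₁>0 : 0 < n₁
    n₁>0 = *-mono-≤ (*-mono-≤ {1} {128} (s≤s z≤n) c₀>0) (m^n>0 4 (p * c))

edgeCount≤e : ∀ {n} (G : Adj n) → (∀ u v → G u v ≡ G v u) → edgeCount G ≤ e G (allFin n) (allFin n)
edgeCount≤e {n} G symG = begin
  edgeCount G                                                          ≡⟨ length-filter≡∑ (λ e → G (proj₁ e) (proj₂ e) ≟ᵇ true) (pairs n) ⟩
  ∑ (pairs n) (λ e → ι (G (proj₁ e) (proj₂ e) ≟ᵇ true))                 ≤⟨ m≤m+n _ _ ⟩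
  2 * ∑ (pairs n) (λ e → ι (G (proj₁ e) (proj₂ e) ≟ᵇ true))             ≤⟨ ∑-pairs-sym G symG ⟩
  ∑ (allFin n) (degree G)                                              ≡⟨ ∑-cong (allFin n) (λ v _ → degree≡∑ G v) ⟩
  e G (allFin n) (allFin n)                                            ∎
  where open ≤-Reasoning

many-edges : ∀ {n} (G : Adj n) ε c₀ → 1ℚ ℚ.≤ ε ℚ.* ℕ→ℚ c₀ → ε ℚ.* ℕ→ℚ (n * n) ℚ.≤ ℕ→ℚ (edgeCount G) → n * n ≤ c₀ * edgeCount G
many-edges {n} G ε c₀ 1≤ h = ℕ→ℚ-reflect (begin
  ℕ→ℚ (n * n)                            ≡⟨ ℚₚ.*-identityˡ _ ⟨
  1ℚ ℚ.* ℕ→ℚ (n * n)                     ≤⟨ ℚₚ.*-monoʳ-≤-nonNeg (ℕ→ℚ (n * n)) {{ℕ→ℚ-nonNeg {(n * n)}}} 1≤ ⟩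
  ε ℚ.* ℕ→ℚ c₀ ℚ.* ℕ→ℚ (n * n)           ≡⟨ solveℚ 3 (λ a b c → a :* b :* c := b :* (a :* c)) refl ε (ℕ→ℚ c₀) (ℕ→ℚ (n * n)) ⟩
  ℕ→ℚ c₀ ℚ.* (ε ℚ.* ℕ→ℚ (n * n))         ≤⟨ ℚₚ.*-monoˡ-≤-nonNeg (ℕ→ℚ c₀) {{ℕ→ℚ-nonNeg {c₀}}} h ⟩
  ℕ→ℚ c₀ ℚ.* ℕ→ℚ (edgeCount G)           ≡⟨ ℕ→ℚ-* c₀ (edgeCount G) ⟨
  ℕ→ℚ (c₀ * edgeCount G)                 ∎)
  where
  open ℚₚ.≤-Reasoning
  open ℚSolver.+-*-Solver using (_:*_; _:=_) renaming (solve to solveℚ)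

-- Comparison of (Δ + 1)-th powers: c^(Δ+1) ≤ p^(Δ+1) n² < (p (b + 1))^(Δ+1) unless p = 0, so the
-- root n^(2/(Δ+1)) never has to be formed.
dense-enough : ∀ {n c Δ b p} (frac : Fraction p) → let open Fraction frac in
  (ℕ→ℚ c ^ℚ suc Δ) ℚ.≤ (p ^ℚ suc Δ) ℚ.* ℕ→ℚ (n * n) → n * n < suc b ^ suc Δ → c * den ≤ num * suc b
dense-enough {n} {c} {Δ} {b} {p} frac h n²< = ≮⇒≥ λ lt → <-irrefl refl (begin-strict
  (num * suc b) ^ suc Δ             <⟨ ^-monoˡ-< (suc Δ) lt ⟩
  (c * den) ^ suc Δ                 ≤⟨ ℕ→ℚ-reflect scaled ⟩
  num ^ suc Δ * (n * n)             ≤⟨ *-monoʳ-≤ (num ^ suc Δ) (<⇒≤ n²<) ⟩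
  num ^ suc Δ * suc b ^ suc Δ       ≡⟨ ^-distribʳ-* num (suc b) (suc Δ) ⟨
  (num * suc b) ^ suc Δ             ∎)
  where
  open Fraction frac
  open ≤-Reasoning
  k = suc Δ
  scaled : ℕ→ℚ ((c * den) ^ k) ℚ.≤ ℕ→ℚ (num ^ k * (n * n))
  scaled = subst₂ ℚ._≤_ left right (ℚₚ.*-monoʳ-≤-nonNeg (ℕ→ℚ (den ^ k)) {{ℕ→ℚ-nonNeg {(den ^ k)}}} h)
    where
    open ℚSolver.+-*-Solver using (_:*_; _:=_) renaming (solve to solveℚ)
    left : (ℕ→ℚ c ^ℚ k) ℚ.* ℕ→ℚ (den ^ k) ≡ ℕ→ℚ ((c * den) ^ k)
    left = trans (cong ((ℕ→ℚ c ^ℚ k) ℚ.*_) (ℕ→ℚ-^ den k)) (trans (sym (^ℚ-distrib-* (ℕ→ℚ c) (ℕ→ℚ den) k))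
      (trans (cong (_^ℚ k) (sym (ℕ→ℚ-* c den))) (sym (ℕ→ℚ-^ (c * den) k))))
    right : (p ^ℚ k) ℚ.* ℕ→ℚ (n * n) ℚ.* ℕ→ℚ (den ^ k) ≡ ℕ→ℚ (num ^ k * (n * n))
    right = trans (solveℚ 3 (λ a b d → a :* b :* d := a :* d :* b) refl (p ^ℚ k) (ℕ→ℚ (n * n)) (ℕ→ℚ (den ^ k)))
      (trans (cong (ℚ._* ℕ→ℚ (n * n)) (trans (cong ((p ^ℚ k) ℚ.*_) (ℕ→ℚ-^ den k)) (trans (sym (^ℚ-distrib-* p (ℕ→ℚ den) k))
        (trans (cong (_^ℚ k) p*den) (sym (ℕ→ℚ-^ num k)))))) (sym (ℕ→ℚ-* (num ^ k) (n * n))))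

num≤den : ∀ {p} (frac : Fraction p) → p ℚ.≤ 1ℚ → Fraction.num frac ≤ Fraction.den frac
num≤den frac p≤1 = ℕ→ℚ-reflect (subst₂ ℚ._≤_ p*den (ℚₚ.*-identityˡ (ℕ→ℚ den)) (ℚₚ.*-monoʳ-≤-nonNeg (ℕ→ℚ den) {{ℕ→ℚ-nonNeg {den}}} p≤1))
  where open Fraction frac

probability-bound : ∀ {m δ} δ₀ a x → 0 < δ₀ → 0 < x → 1ℚ ℚ.≤ δ ℚ.* ℕ→ℚ δ₀ → m ℚ.* ℕ→ℚ x ≡ ℕ→ℚ a → δ₀ * x ≤ x + δ₀ * a → 1ℚ ℚ.- δ ℚ.≤ m
probability-bound {m} {δ} δ₀ a x δ₀>0 x>0 1≤ mx h = ℚₚ.*-cancelʳ-≤-pos (ℕ→ℚ (δ₀ * x)) {{ℕ→ℚ-pos (δ₀ * x) (*-mono-≤ δ₀>0 x>0)}} (begin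
  (1ℚ ℚ.- δ) ℚ.* ℕ→ℚ (δ₀ * x)             ≡⟨ cong ((1ℚ ℚ.- δ) ℚ.*_) (ℕ→ℚ-* δ₀ x) ⟩
  (1ℚ ℚ.- δ) ℚ.* (d ℚ.* y)                ≡⟨ solveℚ 3 (λ δ d y → (con 1ℚ :- δ) :* (d :* y) := d :* y :+ :- (δ :* d :* y)) refl δ d y ⟩
  d ℚ.* y ℚ.+ ℚ.- (δ ℚ.* d ℚ.* y)         ≤⟨ ℚₚ.+-mono-≤ lower (ℚₚ.neg-antimono-≤ (ℚₚ.*-monoʳ-≤-nonNeg y {{ℕ→ℚ-nonNeg {x}}} 1≤)) ⟩
  y ℚ.+ d ℚ.* (m ℚ.* y) ℚ.+ ℚ.- (1ℚ ℚ.* y)  ≡⟨ solveℚ 3 (λ d m y → y :+ d :* (m :* y) :+ :- (con 1ℚ :* y) := m :* (d :* y)) refl d m y ⟩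
  m ℚ.* (d ℚ.* y)                         ≡⟨ cong (m ℚ.*_) (ℕ→ℚ-* δ₀ x) ⟨
  m ℚ.* ℕ→ℚ (δ₀ * x)                      ∎)
  where
  open ℚₚ.≤-Reasoning
  open ℚSolver.+-*-Solver using (_:*_; _:+_; _:-_; :-_; con; _:=_) renaming (solve to solveℚ)
  d y : ℚ
  d = ℕ→ℚ δ₀
  y = ℕ→ℚ x
  lower : d ℚ.* y ℚ.≤ y ℚ.+ d ℚ.* (m ℚ.* y)
  lower = subst₂ ℚ._≤_ (ℕ→ℚ-* δ₀ x) (trans (ℕ→ℚ-+ x (δ₀ * a)) (cong (y ℚ.+_) (trans (ℕ→ℚ-* δ₀ a) (cong (d ℚ.*_) (sym mx))))) (ℕ→ℚ-mono h)

-- The event consists of all outcomes with a copy. Sprinkling bounds its complement by the failure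
-- of the rounds, and the two weights add up to D ^ N.
copy-probability : ∀ {n} (F G : Adj n) {p δ} (frac : Fraction p) → p ℚ.≤ 1ℚ → ∀ δ₀ → 0 < δ₀ → 1ℚ ℚ.≤ δ ℚ.* ℕ→ℚ δ₀ →
  ∀ k l j → .{{_ : NonZero (k + l)}} → j * k * Fraction.den frac ≤ (k + l) * Fraction.num frac →
  δ₀ * rounds k l (length (pairs n)) j (noCopy F G) ≤ ((k + l) ^ length (pairs n)) ^ j →
  ProbContainsAtLeast G F p (1ℚ ℚ.- δ)
copy-probability {n} F G {p} {δ} frac p≤1 δ₀ δ₀>0 1≤ k l j sprinkled few =
  (λ ω → does (copyIn? F G ω)) , (λ ω h → witness (copyIn? F G ω) h) ,
  probability-bound {δ = δ} δ₀ X (D ^ N) δ₀>0 (m^n>0 D {{>-nonZero (subst (0 <_) (sym D≡) den>0)}} N) 1≤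
    (mass≡E N p num Q (trans (cong (λ z → p ℚ.* ℕ→ℚ z) D≡) p*den) (λ ω → does (copyIn? F G ω))) (begin
      δ₀ * D ^ N                    ≡⟨ cong (δ₀ *_) total ⟨
      δ₀ * (X + Y)                  ≡⟨ trans (*-distribˡ-+ δ₀ X Y) (+-comm (δ₀ * X) _) ⟩
      δ₀ * Y + δ₀ * X               ≤⟨ +-monoˡ-≤ (δ₀ * X) failure ⟩
      D ^ N + δ₀ * X                ∎)
  where
  open Fraction frac
  open ≤-Reasoning
  witness : ∀ {P : Set} (d : Dec P) → does d ≡ true → P
  witness (yes x) _ = x
  N Q D X Y B : ℕ
  N = length (pairs n)
  Q = den ∸ num
  D = num + Q
  X = E num Q N (λ ω → ι (copyIn? F G ω))
  Y = E num Q N (noCopy F G)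
  B = ((k + l) ^ N) ^ j
  D≡ : D ≡ den
  D≡ = m+[n∸m]≡n (num≤den frac p≤1)
  total : X + Y ≡ D ^ N
  total = trans (sym (E-+ num Q N)) (trans (E-cong num Q N λ ω → ι-¬? (copyIn? F G ω)) (trans (E-const num Q N 1) (*-identityʳ _)))
  swap : ∀ a b c → a * (b * c) ≡ b * (a * c)
  swap = solve-∀
  failure : δ₀ * Y ≤ D ^ N
  failure = *-cancelʳ-≤ _ _ B {{m^n≢0 ((k + l) ^ N) j {{m^n≢0 (k + l) N}}}} (begin
    δ₀ * Y * B                                        ≡⟨ *-assoc δ₀ Y B ⟩
    δ₀ * (Y * B)                                      ≤⟨ *-monoʳ-≤ δ₀ (sprinkle num Q k l N j (noCopy F G) (noCopy-antitone F G) (subst (λ z → j * k * z ≤ (k + l) * num) (sym D≡) sprinkled)) ⟩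
    δ₀ * (D ^ N * rounds k l N j (noCopy F G))        ≡⟨ swap δ₀ (D ^ N) _ ⟩
    D ^ N * (δ₀ * rounds k l N j (noCopy F G))        ≤⟨ *-monoʳ-≤ (D ^ N) few ⟩
    D ^ N * B                                         ∎)

module _ (Δ k R n b : ℕ) (F G : Adj n) (k≤b : k ≤ b) (b>0 : 0 < b) (n²< : n * n < suc b ^ suc Δ) where

  private
    b≡ : k + (b ∸ k) ≡ b
    b≡ = m+[n∸m]≡n k≤b

  -- The constant is 2 (R + 1) k: there are R + 1 rounds of density k / b, and p is compared with b
  -- + 1 ≤ 2 b.
  sprinkled : ∀ {p} (frac : Fraction p) → (ℕ→ℚ (2 * (suc R * k)) ^ℚ suc Δ) ℚ.≤ (p ^ℚ suc Δ) ℚ.* ℕ→ℚ (n * n) →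
              suc R * k * Fraction.den frac ≤ (k + (b ∸ k)) * Fraction.num frac
  sprinkled frac p-large = subst (λ z → suc R * k * den ≤ z * num) (sym b≡) (*-cancelˡ-≤ 2 (begin
    2 * (suc R * k * den)         ≡⟨ *-assoc 2 (suc R * k) den ⟨
    2 * (suc R * k) * den         ≤⟨ dense-enough {n} {2 * (suc R * k)} {Δ} {b} frac p-large n²< ⟩
    num * suc b                   ≤⟨ *-monoʳ-≤ num (+-monoˡ-≤ b b>0) ⟩
    num * (b + b)                 ≡⟨ lem num b ⟩
    2 * (b * num)                 ∎))
    where
    open Fraction frac
    open ≤-Reasoning
    lem : ∀ a b → a * (b + b) ≡ 2 * (b * a)
    lem = solve-∀

  embedded : ∀ δ δ₀ p → 0 < δ₀ → 1ℚ ℚ.≤ δ ℚ.* ℕ→ℚ δ₀ → 0ℚ ℚ.≤ p → p ℚ.≤ 1ℚ →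
    (ℕ→ℚ (2 * (suc R * k)) ^ℚ suc Δ) ℚ.≤ (p ^ℚ suc Δ) ℚ.* ℕ→ℚ (n * n) →
    δ₀ * rounds k (b ∸ k) (length (pairs n)) (suc R) (noCopy F G) ≤ ((k + (b ∸ k)) ^ length (pairs n)) ^ suc R →
    ProbContainsAtLeast G F p (1ℚ ℚ.- δ)
  embedded δ δ₀ p δ₀>0 1≤δδ₀ 0≤p p≤1 p-large few = copy-probability F G {p} {δ} (fraction p 0≤p) p≤1 δ₀ δ₀>0 1≤δδ₀ k (b ∸ k) (suc R)
    {{>-nonZero (subst (0 <_) (sym b≡) b>0)}} (sprinkled {p} (fraction p 0≤p) p-large) few

-- Order of the choices: the dense pair, the constant c, then the threshold for δ

Conclusion : (ε c δ : ℚ) (Δ n : ℕ) → Set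
Conclusion ε c δ Δ n = (F G : Adj n) → IsSimpleGraph F → IsSimpleGraph G → MaxDegreeAtMost F Δ →
  (p : ℚ) → 0ℚ ℚ.≤ p → p ℚ.≤ 1ℚ → c ^ℚ suc Δ ℚ.≤ (p ^ℚ suc Δ) ℚ.* ℕ→ℚ (n * n) →
  ε ℚ.* ℕ→ℚ (n * n) ℚ.≤ ℕ→ℚ (edgeCount G) → ProbContainsAtLeast G F p (1ℚ ℚ.- δ)

conclusion : ∀ {ε δ c₀ δ₀ K D n₁ k R Δ} n → 1ℚ ℚ.≤ ε ℚ.* ℕ→ℚ c₀ → 0 < δ₀ → 1ℚ ℚ.≤ δ ℚ.* ℕ→ℚ δ₀ →
  (∀ {n} (G : Adj n) → (∀ u v → G u v ≡ G v u) → (∀ u → G u u ≡ false) → n₁ ≤ n → n * n ≤ c₀ * e G (allFin n) (allFin n) → DensePair G K D) →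
  n₁ ≤ n → PerturbedEmbedding K D Δ k R δ₀ n → Conclusion ε (ℕ→ℚ (2 * (suc R * k))) δ Δ n
conclusion {ε} {δ} {c₀} {δ₀} {k = k} {R} {Δ} n 1≤εc₀ δ₀>0 1≤δδ₀ pair n₁≤n embed F G sF sG maxdeg p 0≤p p≤1 p-large G-dense =
  finish (embed F G (symmetric sF) (irreflexive sF) (symmetric sG) (irreflexive sG) maxdeg
    (pair G (symmetric sG) (irreflexive sG) n₁≤n (≤-trans (many-edges G ε c₀ 1≤εc₀ G-dense) (*-monoʳ-≤ c₀ (edgeCount≤e G (symmetric sG))))))
  where
  open IsSimpleGraph
  finish : ∃[ b ] 0 < b × k ≤ b × n * n < suc b ^ suc Δ ×
             δ₀ * rounds k (b ∸ k) (length (pairs n)) (suc R) (noCopy F G) ≤ ((k + (b ∸ k)) ^ length (pairs n)) ^ suc R →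
           ProbContainsAtLeast G F p (1ℚ ℚ.- δ)
  finish (b , b>0 , k≤b , n²< , few) = embedded Δ k R n b F G k≤b b>0 n²< δ δ₀ p δ₀>0 1≤δδ₀ 0≤p p≤1 p-large few

theorem1p6 : (ε : ℚ) → 0ℚ ℚ.< ε → (Δ : ℕ) → Δ ≥ 2 →
    Σ ℚ λ c → 0ℚ ℚ.< c ×
    ((δ : ℚ) → 0ℚ ℚ.< δ →
    Σ ℕ λ N → (n : ℕ) → n ≥ N →
    (F G : Adj n) → IsSimpleGraph F → IsSimpleGraph G →
    MaxDegreeAtMost F Δ →
    (p : ℚ) → 0ℚ ℚ.≤ p → p ℚ.≤ 1ℚ →
    c ^ℚ (Data.Nat.suc Δ) ℚ.≤ (p ^ℚ (Data.Nat.suc Δ)) ℚ.* ℕ→ℚ (n Data.Nat.* n) →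
    ε ℚ.* ℕ→ℚ (n Data.Nat.* n) ℚ.≤ ℕ→ℚ (edgeCount G) →
    ProbContainsAtLeast G F p (1ℚ ℚ.- δ))
theorem1p6 ε ε>0 Δ 2≤Δ = choose-pair (fraction-pos ε ε>0)
  where
  Goal : Set
  Goal = Σ ℚ λ c → 0ℚ ℚ.< c × (∀ δ → 0ℚ ℚ.< δ → Σ ℕ λ N → ∀ n → n ≥ N → Conclusion ε c δ Δ n)
  choose-rounds : ∀ {c₀ K D n₁} → 1ℚ ℚ.≤ ε ℚ.* ℕ→ℚ c₀ →
    (∀ {n} (G : Adj n) → (∀ u v → G u v ≡ G v u) → (∀ u → G u u ≡ false) → n₁ ≤ n → n * n ≤ c₀ * e G (allFin n) (allFin n) → DensePair G K D) →
    ∃[ k ] ∃[ R ] 0 < k × (∀ δ₀ → ∃[ n₀ ] (∀ n → n₀ ≤ n → PerturbedEmbedding K D Δ k R δ₀ n)) → Goal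
  choose-rounds {c₀} {K} {D} {n₁} 1≤εc₀ pair (k , R , k>0 , embedding) = ℕ→ℚ (2 * (suc R * k)) ,
    ℚₚ.positive⁻¹ (ℕ→ℚ (2 * (suc R * k))) {{ℕ→ℚ-pos (2 * (suc R * k)) (*-mono-≤ {1} {2} (s≤s z≤n) (*-mono-≤ {1} {suc R} (s≤s z≤n) k>0))}} ,
    λ δ δ>0 → choose-n δ (fraction-pos δ δ>0)
    where
    choose-n : ∀ δ → ∃[ d ] 0 < d × 1ℚ ℚ.≤ δ ℚ.* ℕ→ℚ d → Σ ℕ λ N → ∀ n → n ≥ N → Conclusion ε (ℕ→ℚ (2 * (suc R * k))) δ Δ n
    choose-n δ (δ₀ , δ₀>0 , 1≤δδ₀) = n₁ + proj₁ (embedding δ₀) , λ n n≥ →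
      conclusion {ε} {δ} {c₀} {δ₀} {K} {D} {n₁} {k} {R} {Δ} n 1≤εc₀ δ₀>0 1≤δδ₀ pair (≤-trans (m≤m+n n₁ _) n≥) (proj₂ (embedding δ₀) n (≤-trans (m≤n+m _ n₁) n≥))
  choose-pair : ∃[ d ] 0 < d × 1ℚ ℚ.≤ ε ℚ.* ℕ→ℚ d → Goal
  choose-pair (c₀ , c₀>0 , 1≤εc₀) = go (dense-pair c₀ c₀>0)
    where
    go : _ → Goal
    go (K , D , n₁ , K>0 , D>0 , pair) = choose-rounds {c₀} {K} {D} {n₁} 1≤εc₀ pair (perturbed-embedding K D Δ {{>-nonZero K>0}} {{>-nonZero D>0}} 2≤Δ)
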